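{- The derivation of the conclusion tableau is valid; that is: if $\mathbf{T}=(G,\mathcal{G},\mathcal{M},\mathcal{X},\simeq)$ is a decisive matroid tableau, then the conclusion tableau $\mathbf{T}!$ for $\mathbf{T}$ is a valid matroid tableau.
   Context: Matroids are pairs $M=(E,\mathcal{I})$ with $E$ a finite ground set and $\mathcal{I}$ the system of independent sets; $\mathrm{rk}_M$ is the rank function. A matroid $N=(E',\mathcal{I}')$ is an extension of $M=(E,\mathcal{I})$ if $E\subseteq E'$ and $\mathcal{I}=\{X\in\mathcal{I}'\mid X\subseteq E\}$. A digraph is a pair $D=(V,A)$ with $V$ finite and $A\subseteq V\times V$. A path in $D$ is a non-empty, non-repeating sequence of vertices $p_1p_2\ldots p_n$ with $(p_i,p_{i+1})\in A$ for $1\le i<n$. A routing from $X$ to $Y$ in $D$ is a family $R$ of paths in $D$ such that every $x\in X$ is the first vertex of some $p\in R$, every $p\in R$ ends in a vertex of $Y$, and any two distinct paths of $R$ are vertex-disjoint. For $E,T\subseteq V$, $\Gamma(D,T,E)$ is the matroid on $E$ whose independent sets are those $X\subseteq E$ for which there is a routing from $X$ to $T$ in $D$. A matroid $(E,\mathcal{I})$ is a gammoid if it equals $\Gamma(D,T,E)$ for some digraph $D=(V,A)$ with $E\subseteq V$ and some $T\subseteq V$; it is a strict gammoid if such a representation exists with $V=E$. A matroid tableau is a tuple $\mathbf{T}=(G,\mathcal{G},\mathcal{M},\mathcal{X},\simeq)$ where $G$ is a matroid (the goal), $\mathcal{G},\mathcal{M},\mathcal{X}$ are families of matroids, and $\simeq$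 is an equivalence relation on $\{G'\mid G'\text{ is a minor of }G\}\cup\mathcal{G}\cup\mathcal{M}\cup\mathcal{X}$. $\mathbf{T}$ is valid if (i) all matroids in $\mathcal{G}$ are gammoids, (ii) no matroid in $\mathcal{M}$ is a strict gammoid, (iii) no matroid in $\mathcal{X}$ is a gammoid, and (iv) every equivalence class of $\simeq$ either consists only of gammoids or contains no gammoid. $\mathbf{T}$, with goal $G=(E,\mathcal{I})$, is decisive if it is valid and at least one of the following holds: (D1) there is $M\in\mathcal{G}$ with $G\simeq M$; (D2) there is $X\in\mathcal{X}$ that is isomorphic to a minor of $G$; (D3) for every extension $N=(E',\mathcal{I}')$ of $G$ with $|E'|=\mathrm{rk}_G(E)^2\cdot|E|+\mathrm{rk}_G(E)+|E|$ there is a matroid $M\in\mathcal{M}$ that is isomorphic to $N$. For a decisive tableau $\mathbf{T}$, the tableau $\mathbf{T}!=(G,\mathcal{G}',\mathcal{M},\mathcal{X}',\simeq)$ is the conclusion tableau for $\mathbf{T}$ if either $\mathcal{G}'=\mathcal{G}\cup\{G'\mid G'\text{ is a minor of }G\}$, $\mathcal{X}'=\mathcal{X}$, and $\mathbf{T}$ satisfies (D1); or $\mathcal{G}'=\mathcal{G}$, $\mathcal{X}'=\mathcal{X}\cup\{G\}$, and $\mathbf{T}$ satisfies (D2) or (D3). -}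

module Defs where

open import Data.List.Base using (List; []; _∷_; _++_; map; length; filter; deduplicate)
open import Data.List.Extrema.Nat using (max)
open import Data.List.Membership.Propositional using (_∈_; _∉_)
open import Data.List.NonEmpty.Base using (List⁺; toList; head; last)
open import Data.List.Relation.Binary.BagAndSetEquality using (_∼[_]_; set)
open import Data.List.Relation.Binary.Disjoint.Propositional using (Disjoint)
open import Data.List.Relation.Binary.Subset.Propositional using (_⊆_)
open import Data.List.Relation.Unary.All using (All)
open import Data.List.Relation.Unary.Linked using (Linked)
open import Data.List.Relation.Unary.Unique.Propositional using (Unique)
open import Data.Nat.Base using (ℕ; _<_; _+_; _*_; _^_)
open import Data.Product using (_×_; _,_; ∃-syntax)
open import Data.Sum using (_⊎_)
open import Function.Bundles using (_⇔_)
open import Level using (0ℓ; Level) renaming (suc to lsuc)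
open import Relation.Binary.Core using (Rel)
open import Relation.Binary.Definitions using (DecidableEquality; Symmetric; Transitive)
open import Relation.Binary.PropositionalEquality using (_≡_; _≢_)
open import Relation.Nullary.Negation.Core using (¬_)
open import Relation.Unary using (Pred; Decidable; _≐_; _∪_)
import Relation.Binary.Definitions as Bin

1ℓ : Level
1ℓ = lsuc 0ℓ

-- The objects that ground sets and digraphs are made of.  There are infinitely
-- many of them, so that every finite set has extensions of every finite size.
record Universe : Set₁ where
  field
    Element : Set
    _≟_     : DecidableEquality Element
    fresh   : (xs : List Element) → ∃[ x ] x ∉ xs

module Matroids (𝕌 : Universe) where

  open Universe 𝕌 public

  -- A finite set is a list of which only the membership relation matters:
  -- order and repetitions are irrelevant, and equality is _∼[ set ]_.
  FinSet : Set
  FinSet = List Element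

  ∣_∣ : FinSet → ℕ
  ∣ X ∣ = length (deduplicate _≟_ X)

  subsets : FinSet → List FinSet
  subsets []      = [] ∷ []
  subsets (x ∷ X) = subsets X ++ map (x ∷_) (subsets X)

  -- Since ground sets are finite, the set of independent sets is given as a
  -- decidable one.  By `hereditary`, Indep depends only on the members of its
  -- argument.
  record Matroid : Set₁ where
    field
      E          : FinSet
      Indep      : Pred FinSet 0ℓ
      indep?     : Decidable Indep
      within     : ∀ {X} → Indep X → X ⊆ E
      empty      : Indep []
      hereditary : ∀ {X Y} → X ⊆ Y → Indep Y → Indep X
      augment    : ∀ {X Y} → Indep X → Indep Y → ∣ X ∣ < ∣ Y ∣ →
                   ∃[ y ] (y ∈ Y × y ∉ X × Indep (y ∷ X))

  open Matroid public

  infix 4 _≈_ _≅_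

  -- Equality of matroids as pairs (E , 𝓘).
  _≈_ : Rel Matroid 0ℓ
  M ≈ N = (E M ∼[ set ] E N) × (Indep M ≐ Indep N)

  rk : Matroid → FinSet → ℕ
  rk M X = max 0 (map ∣_∣ (filter (indep? M) (subsets X)))

  IsExtension : Matroid → Matroid → Set
  IsExtension N M =
    E M ⊆ E N × (∀ X → Indep M X ⇔ (Indep N X × X ⊆ E M))

  IsBase : Matroid → FinSet → FinSet → Set
  IsBase M C B =
    B ⊆ C × Indep M B × (∀ {c} → c ∈ C → Indep M (c ∷ B) → c ∈ B)

  -- K = M / C.
  IsContraction : Matroid → FinSet → Matroid → Set
  IsContraction M C K =
    C ⊆ E M ×
    (∀ x → x ∈ E K ⇔ (x ∈ E M × x ∉ C)) ×
    (∀ X → Indep K X ⇔ (X ⊆ E K × ∃[ B ] (IsBase M C B × Indep M (X ++ B))))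

  -- N is a restriction of a contraction of M; that N is a restriction of K says
  -- the same as that K is an extension of N.
  IsMinor : Matroid → Matroid → Set₁
  IsMinor N M = ∃[ C ] ∃[ K ] (IsContraction M C K × IsExtension K N)

  -- A bijection between the ground sets is given as the restriction of a map
  -- defined on all elements; its values outside E M are irrelevant.
  record _≅_ (M N : Matroid) : Set where
    field
      f         : Element → Element
      injective : ∀ {x y} → x ∈ E M → y ∈ E M → f x ≡ f y → x ≡ y
      image     : map f (E M) ∼[ set ] E N
      preserves : ∀ X → X ⊆ E M → Indep M X ⇔ Indep N (map f X)

  record Digraph : Set where
    field
      V     : FinSet
      A     : List (Element × Element)
      A⊆V×V : ∀ {x y} → (x , y) ∈ A → x ∈ V × y ∈ V

  open Digraph public

  IsPath : Digraph → List⁺ Element → Set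
  IsPath D p =
    toList p ⊆ V D ×
    Unique (toList p) ×
    Linked (λ x y → (x , y) ∈ A D) (toList p)

  record IsRouting (D : Digraph) (X Y : FinSet) (R : List (List⁺ Element)) : Set where
    field
      paths    : All (IsPath D) R
      starts   : ∀ {x} → x ∈ X → ∃[ p ] (p ∈ R × head p ≡ x)
      ends     : ∀ {p} → p ∈ R → last p ∈ Y
      disjoint : ∀ {p q} → p ∈ R → q ∈ R → p ≢ q → Disjoint (toList p) (toList q)

  -- M = Γ(D, T, E) with E the ground set of M.
  IsΓ : Digraph → FinSet → Matroid → Set
  IsΓ D T M =
    T ⊆ V D × E M ⊆ V D ×
    (∀ X → Indep M X ⇔ (X ⊆ E M × ∃[ R ] IsRouting D X T R))

  Gammoid : Matroid → Set
  Gammoid M = ∃[ D ] ∃[ T ] IsΓ D T M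

  StrictGammoid : Matroid → Set
  StrictGammoid M = ∃[ D ] ∃[ T ] (IsΓ D T M × (V D ∼[ set ] E M))

  Family : Set₂
  Family = Pred Matroid 1ℓ

  Minors : Matroid → Family
  Minors G N = IsMinor N G

  record Tuple : Set₂ where
    field
      G     : Matroid
      𝒢 ℳ 𝒳 : Family
      _≃_   : Rel Matroid 1ℓ

    Domain : Family
    Domain = Minors G ∪ 𝒢 ∪ ℳ ∪ 𝒳

  -- The families are sets of matroids, hence closed under _≈_, and _≃_ is an
  -- equivalence relation on Domain, where equality of matroids is _≈_.
  record IsTableau (T : Tuple) : Set₁ where
    open Tuple T
    field
      𝒢-resp  : 𝒢 Bin.Respects _≈_
      ℳ-resp  : ℳ Bin.Respects _≈_
      𝒳-resp  : 𝒳 Bin.Respects _≈_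
      ≃-on    : ∀ {M N} → M ≃ N → Domain M × Domain N
      ≃-refl  : ∀ {M N} → Domain M → M ≈ N → M ≃ N
      ≃-sym   : Symmetric _≃_
      ≃-trans : Transitive _≃_

  record IsValid (T : Tuple) : Set₁ where
    open Tuple T
    field
      gammoids  : ∀ M → 𝒢 M → Gammoid M
      nonStrict : ∀ M → ℳ M → ¬ StrictGammoid M
      nonGams   : ∀ M → 𝒳 M → ¬ Gammoid M
      classes   : ∀ M → Domain M →
                  (∀ N → M ≃ N → Gammoid N) ⊎ (∀ N → M ≃ N → ¬ Gammoid N)

  module _ (T : Tuple) where
    open Tuple T

    D1 : Set₁
    D1 = ∃[ M ] (𝒢 M × G ≃ M)

    D2 : Set₁
    D2 = ∃[ X ] (𝒳 X × ∃[ N ] (IsMinor N G × X ≅ N))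

    D3 : Set₁
    D3 = let r = rk G (E G) ; n = ∣ E G ∣ in
         ∀ N → IsExtension N G → ∣ E N ∣ ≡ r ^ 2 * n + r + n →
         ∃[ M ] (ℳ M × M ≅ N)

    IsDecisive : Set₁
    IsDecisive = IsValid T × (D1 ⊎ D2 ⊎ D3)

    data IsConclusion : Tuple → Set₂ where
      accept : D1 → IsConclusion record
        { G = G ; 𝒢 = 𝒢 ∪ Minors G ; ℳ = ℳ ; 𝒳 = 𝒳 ; _≃_ = _≃_ }
      reject : D2 ⊎ D3 → IsConclusion record
        { G = G ; 𝒢 = 𝒢 ; ℳ = ℳ ; 𝒳 = 𝒳 ∪ (G ≈_) ; _≃_ = _≃_ }

{-# OPTIONS --safe #-}
-- By the linkage lemma a gammoid is given by a family of subsets (A i), i ∈ rows, of a set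
-- cols: X is independent iff the family has a transversal avoiding X.  Contracting a base of C
-- just deletes it from cols, so minors of gammoids are gammoids; this settles acceptance.
--
-- Rejection by (D3) needs: a gammoid of rank r on n elements has a representation with at most
-- n r² columns outside the ground set; padded with loops it is a strict gammoid extending it.
-- Eliminating a column c by a pivot either represents the same matroid, or some circuit X
-- becomes independent.  For generic integer weights on the family, such an X yields a vector x_c
-- in the left and a vector y_c in the right kernel such that x_c ⊗ y_c pairs non-trivially with
-- (copies of) c, and with at most r columns in all.  If no column could be eliminated and there
-- were more than n r² of them, one could choose more than n r of these tensors with triangular
-- pairings; but the tensors live in a space of dimension n r.
module Submission where

open import Defs
open import Data.Bool.Base using (Bool; true; false)
import Data.Bool.Properties as Boolₚ
open import Data.Empty using (⊥; ⊥-elim)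
open import Data.Integer.Base as ℤ using (ℤ; 0ℤ; 1ℤ)
import Data.Integer.Properties as ℤₚ
open import Data.Integer.Tactic.RingSolver using (solve-∀)
open import Data.List.Base using (List; []; _∷_; _++_; map; length; filter; deduplicate; initLast; _∷ʳ′_; cartesianProduct)
open import Data.List.Extrema.Nat using (v≤max⁺)
import Data.List.Membership.DecPropositional as DecMembership
open import Data.List.Membership.Propositional using (_∈_; _∉_; find; lose)
open import Data.List.Membership.Propositional.Properties using (∈-++⁺ˡ; ∈-++⁺ʳ; ∈-++⁻; ∈-filter⁺; ∈-filter⁻; ∈-deduplicate⁺; ∈-deduplicate⁻; ∈-∃++; ∈-map⁺; ∈-map⁻; ∈-cartesianProduct⁺; ∈-cartesianProduct⁻)
open import Data.List.NonEmpty.Base using (List⁺; _∷_; toList; head; last)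
open import Data.List.Properties using (length-++; length-map)
open import Data.List.Relation.Binary.Subset.Propositional using (_⊆_)
open import Data.List.Relation.Unary.All using (All; []; _∷_; all?)
import Data.List.Relation.Unary.All as All
open import Data.List.Relation.Unary.AllPairs using ([]; _∷_)
open import Data.List.Relation.Unary.Any using (here; there; any?)
import Data.List.Relation.Unary.Any as Any
open import Data.List.Relation.Unary.Linked using (Linked; []; [-]; _∷_)
import Data.List.Relation.Unary.Linked as Linked
import Data.List.Relation.Unary.Unique.DecPropositional.Properties as DecUniqueₚ
open import Data.List.Relation.Unary.Unique.Propositional using (Unique)
import Data.List.Relation.Unary.Unique.Propositional.Properties as Uniqueₚ
open import Data.Nat.Base using (ℕ; zero; suc; _≤_; _<_; z≤n; s≤s; _+_; _*_; _^_; _∸_)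
open import Data.Nat.ListAction using (sum)
import Data.Nat.Properties as ℕₚ
open import Data.Nat.Tactic.RingSolver using () renaming (solve-∀ to solve-∀-ℕ)
open import Data.Product using (_×_; _,_; proj₁; proj₂; ∃-syntax; Σ-syntax)
import Data.Product.Properties as Productₚ
open import Data.Sum using (_⊎_; inj₁; inj₂; [_,_]′)
open import Function.Base using (_∘_; case_of_)
open import Function.Bundles using (_⇔_; mk⇔; Equivalence)
open import Function.Construct.Composition using (_⇔-∘_)
open import Function.Construct.Symmetry using (⇔-sym)
open import Level using (0ℓ)
open import Relation.Binary.Core using (Rel)
open import Relation.Binary.Definitions using (Decidable)
open import Relation.Binary.PropositionalEquality using (_≡_; _≢_; refl; sym; trans; cong; cong₂; subst; subst₂; module ≡-Reasoning)
open import Relation.Nullary using (¬_; Dec; yes; no; ¬?)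
open import Relation.Nullary.Decidable using (¬¬-excluded-middle; decidable-stable; _×-dec_; map′; _⊎-dec_)

-- This suffices, since they serve to prove negations or decidable statements (matchability,
-- inequalities of numbers), and since being a gammoid is never decided: (D1) reads it off the class
-- of the goal, (D2) and (D3) refute it.
--
-- Determinants and polynomials are avoided as well. Nonsingular means having trivial kernel, kernel
-- vectors come from elimination without division, and genericity rests on one fact: on a coordinate
-- line through a point where a system is nonsingular, it becomes singular at one value at most.
--
-- The dimension n r arises as follows. A left vector is annihilated by all columns outside the
-- ground set, so its products with the n columns inside determine it. A right vector is annihilated
-- by all rows, so its entries at the targets determine it, and there are at most r targets once
-- these lie in the ground set. The last factor r bounds the number of columns with which a single
-- tensor can pair non-trivially.

module _ (𝕌 : Universe) where

  open Matroids 𝕌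
  open DecMembership _≟_ using (_∈?_; _∉?_)

  -- Finite sets and their cardinalities

  infixl 7 _∩_
  infixl 6 _∖_

  opaque
    _∩_ _∖_ : FinSet → FinSet → FinSet
    X ∩ Y = filter (_∈? Y) X
    X ∖ Y = filter (_∉? Y) X

    ∈-∩⁺ : ∀ {x X Y} → x ∈ X → x ∈ Y → x ∈ X ∩ Y
    ∈-∩⁺ {Y = Y} = ∈-filter⁺ (_∈? Y)

    ∈-∩⁻ : ∀ {x} X Y → x ∈ X ∩ Y → x ∈ X × x ∈ Y
    ∈-∩⁻ X Y = ∈-filter⁻ (_∈? Y) {xs = X}

    ∈-∖⁺ : ∀ {x X Y} → x ∈ X → x ∉ Y → x ∈ X ∖ Y
    ∈-∖⁺ {Y = Y} = ∈-filter⁺ (_∉? Y)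

    ∈-∖⁻ : ∀ {x} X Y → x ∈ X ∖ Y → x ∈ X × x ∉ Y
    ∈-∖⁻ X Y = ∈-filter⁻ (_∉? Y) {xs = X}

  ∖⊆ : ∀ X Y → X ∖ Y ⊆ X
  ∖⊆ X Y x∈ = proj₁ (∈-∖⁻ X Y x∈)

  ⊆-++⁻ : ∀ {X Y Z : FinSet} → X ⊆ Z → Y ⊆ Z → X ++ Y ⊆ Z
  ⊆-++⁻ {X} X⊆Z Y⊆Z z∈ = [ X⊆Z , Y⊆Z ]′ (∈-++⁻ X z∈)

  ∷-⊆ : ∀ {x} {X Z : FinSet} → x ∈ Z → X ⊆ Z → x ∷ X ⊆ Z
  ∷-⊆ x∈Z X⊆Z (here refl) = x∈Z
  ∷-⊆ x∈Z X⊆Z (there y∈)  = X⊆Z y∈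

  length-mono : ∀ {xs ys : FinSet} → Unique xs → xs ⊆ ys → length xs ≤ length ys
  length-mono [] _ = z≤n
  length-mono {x ∷ xs} (x≢xs ∷ xs!) xs⊆ys with ∈-∃++ (xs⊆ys (here refl))
  ... | as , bs , refl = begin
      suc (length xs)               ≤⟨ s≤s (length-mono xs! xs⊆as++bs) ⟩
      suc (length (as ++ bs))       ≡⟨ cong suc (length-++ as) ⟩
      suc (length as + length bs)   ≡⟨ ℕₚ.+-suc (length as) (length bs) ⟨
      length as + suc (length bs)   ≡⟨ length-++ as ⟨
      length (as ++ x ∷ bs)         ∎
    where
    open ℕₚ.≤-Reasoning
    xs⊆as++bs : xs ⊆ as ++ bs
    xs⊆as++bs y∈xs with ∈-++⁻ as (xs⊆ys (there y∈xs))
    ... | inj₁ y∈as         = ∈-++⁺ˡ y∈as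
    ... | inj₂ (here refl)  = ⊥-elim (All.lookup x≢xs y∈xs refl)
    ... | inj₂ (there y∈bs) = ∈-++⁺ʳ as y∈bs

  dedup : FinSet → FinSet
  dedup = deduplicate _≟_

  dedup-! : ∀ X → Unique (dedup X)
  dedup-! = DecUniqueₚ.deduplicate-! _≟_

  ∈-dedup⁺ : ∀ {x X} → x ∈ X → x ∈ dedup X
  ∈-dedup⁺ = ∈-deduplicate⁺ _≟_

  ∈-dedup⁻ : ∀ {x} X → x ∈ dedup X → x ∈ X
  ∈-dedup⁻ X = ∈-deduplicate⁻ _≟_ X

  card-mono : ∀ {X Y} → X ⊆ Y → ∣ X ∣ ≤ ∣ Y ∣
  card-mono {X} X⊆Y = length-mono (dedup-! X) λ x∈ → ∈-dedup⁺ (X⊆Y (∈-dedup⁻ X x∈))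

  card-cong : ∀ {X Y} → X ⊆ Y → Y ⊆ X → ∣ X ∣ ≡ ∣ Y ∣
  card-cong X⊆Y Y⊆X = ℕₚ.≤-antisym (card-mono X⊆Y) (card-mono Y⊆X)

  card-unique : ∀ {X} → Unique X → ∣ X ∣ ≡ length X
  card-unique {X} X! = ℕₚ.≤-antisym
    (length-mono (dedup-! X) (∈-dedup⁻ X)) (length-mono X! ∈-dedup⁺)

  card≤length : ∀ X → ∣ X ∣ ≤ length X
  card≤length X = length-mono (dedup-! X) (∈-dedup⁻ X)

  card-++ : ∀ {X Y} → (∀ {x} → x ∈ X → x ∉ Y) → ∣ X ++ Y ∣ ≡ ∣ X ∣ + ∣ Y ∣
  card-++ {X} {Y} disj = begin
    ∣ X ++ Y ∣                    ≡⟨ card-cong to from ⟩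
    ∣ dedup X ++ dedup Y ∣        ≡⟨ card-unique (Uniqueₚ.++⁺ (dedup-! X) (dedup-! Y)
                                       λ (x∈X , x∈Y) → disj (∈-dedup⁻ X x∈X) (∈-dedup⁻ Y x∈Y)) ⟩
    length (dedup X ++ dedup Y)   ≡⟨ length-++ (dedup X) ⟩
    ∣ X ∣ + ∣ Y ∣                 ∎
    where
    open ≡-Reasoning
    to : X ++ Y ⊆ dedup X ++ dedup Y
    to = ⊆-++⁻ (λ x∈ → ∈-++⁺ˡ (∈-dedup⁺ x∈)) (λ y∈ → ∈-++⁺ʳ (dedup X) (∈-dedup⁺ y∈))
    from : dedup X ++ dedup Y ⊆ X ++ Y
    from = ⊆-++⁻ {dedup X} (λ x∈ → ∈-++⁺ˡ (∈-dedup⁻ X x∈)) (λ y∈ → ∈-++⁺ʳ X (∈-dedup⁻ Y y∈))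

  card-∷ : ∀ {x X} → x ∉ X → ∣ x ∷ X ∣ ≡ suc ∣ X ∣
  card-∷ x∉X = card-++ {_ ∷ []} λ { (here refl) → x∉X }

  card-split : ∀ X Y → ∣ X ∣ ≡ ∣ X ∩ Y ∣ + ∣ X ∖ Y ∣
  card-split X Y = trans
    (card-cong to (⊆-++⁻ {X ∩ Y} (λ x∈ → proj₁ (∈-∩⁻ X Y x∈)) (∖⊆ X Y)))
    (card-++ λ x∈∩ x∈∖ → proj₂ (∈-∖⁻ X Y x∈∖) (proj₂ (∈-∩⁻ X Y x∈∩)))
    where
    to : X ⊆ X ∩ Y ++ (X ∖ Y)
    to {x} x∈X with x ∈? Y
    ... | yes x∈Y = ∈-++⁺ˡ (∈-∩⁺ x∈X x∈Y)
    ... | no  x∉Y = ∈-++⁺ʳ (X ∩ Y) (∈-∖⁺ x∈X x∉Y)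

  card-modular : ∀ X Y → ∣ X ++ Y ∣ + ∣ X ∩ Y ∣ ≡ ∣ X ∣ + ∣ Y ∣
  card-modular X Y = begin
    ∣ X ++ Y ∣ + ∣ X ∩ Y ∣             ≡⟨ cong (_+ ∣ X ∩ Y ∣) (trans (card-cong to from)
                                            (card-++ λ x∈∖ → proj₂ (∈-∖⁻ X Y x∈∖))) ⟩
    ∣ X ∖ Y ∣ + ∣ Y ∣ + ∣ X ∩ Y ∣      ≡⟨ ℕₚ.+-comm (∣ X ∖ Y ∣ + ∣ Y ∣) _ ⟩
    ∣ X ∩ Y ∣ + (∣ X ∖ Y ∣ + ∣ Y ∣)    ≡⟨ ℕₚ.+-assoc (∣ X ∩ Y ∣) _ _ ⟨
    ∣ X ∩ Y ∣ + ∣ X ∖ Y ∣ + ∣ Y ∣      ≡⟨ cong (_+ ∣ Y ∣) (card-split X Y) ⟨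
    ∣ X ∣ + ∣ Y ∣                      ∎
    where
    open ≡-Reasoning
    to : X ++ Y ⊆ (X ∖ Y) ++ Y
    to {z} z∈ with z ∈? Y | ∈-++⁻ X z∈
    ... | yes z∈Y | _        = ∈-++⁺ʳ (X ∖ Y) z∈Y
    ... | no  z∉Y | inj₁ z∈X = ∈-++⁺ˡ (∈-∖⁺ z∈X z∉Y)
    ... | no  z∉Y | inj₂ z∈Y = ⊥-elim (z∉Y z∈Y)
    from : (X ∖ Y) ++ Y ⊆ X ++ Y
    from = ⊆-++⁻ {X ∖ Y} (λ x∈ → ∈-++⁺ˡ (∖⊆ X Y x∈)) (∈-++⁺ʳ X)

  card-++-≤ : ∀ X Y → ∣ X ++ Y ∣ ≤ ∣ X ∣ + ∣ Y ∣
  card-++-≤ X Y = subst (∣ X ++ Y ∣ ≤_) (card-modular X Y) (ℕₚ.m≤m+n (∣ X ++ Y ∣) _)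

  card-∷-≤ : ∀ x X → ∣ x ∷ X ∣ ≤ suc ∣ X ∣
  card-∷-≤ x X = card-++-≤ (x ∷ []) X

  ⊆-card : ∀ {X Y} → X ⊆ Y → ∣ Y ∣ ≤ ∣ X ∣ → Y ⊆ X
  ⊆-card {X} {Y} X⊆Y ∣Y∣≤∣X∣ {y} y∈Y with y ∈? X
  ... | yes y∈X = y∈X
  ... | no  y∉X = ⊥-elim (ℕₚ.<⇒≱ (subst (_≤ ∣ Y ∣) (card-∷ y∉X) (card-mono (∷-⊆ y∈Y X⊆Y))) ∣Y∣≤∣X∣)

  ∷-∖ : ∀ {x} X → X ⊆ x ∷ (X ∖ (x ∷ []))
  ∷-∖ {x} X {y} y∈X with y ≟ x
  ... | yes refl = here refl
  ... | no  y≢x  = there (∈-∖⁺ y∈X λ { (here y≡x) → y≢x y≡x })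

  card-∖-< : ∀ {x X} → x ∈ X → ∣ X ∖ (x ∷ []) ∣ < ∣ X ∣
  card-∖-< {x} {X} x∈X = subst (_≤ ∣ X ∣)
    (card-∷ λ x∈ → proj₂ (∈-∖⁻ X (x ∷ []) x∈) (here refl)) (card-mono (∷-⊆ x∈X (∖⊆ X (x ∷ []))))

  card-∖-≤ : ∀ x X → ∣ X ∣ ≤ suc ∣ X ∖ (x ∷ []) ∣
  card-∖-≤ x X = ℕₚ.≤-trans (card-mono (∷-∖ X)) (card-∷-≤ x (X ∖ (x ∷ [])))

  card-<-∃ : ∀ X Y → ∣ X ∣ < ∣ Y ∣ → ∃[ y ] (y ∈ Y × y ∉ X)
  card-<-∃ X Y ∣X∣<∣Y∣ = go Y (λ y∈ → y∈) λ Y⊆X → ℕₚ.<⇒≱ ∣X∣<∣Y∣ (card-mono Y⊆X)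
    where
    go : ∀ Z → Z ⊆ Y → ¬ Z ⊆ X → ∃[ y ] (y ∈ Y × y ∉ X)
    go [] _ ¬[]⊆X = ⊥-elim (¬[]⊆X λ ())
    go (z ∷ Z) Z⊆Y ¬Z⊆X with z ∈? X
    ... | no  z∉X = z , Z⊆Y (here refl) , z∉X
    ... | yes z∈X = go Z (λ y∈ → Z⊆Y (there y∈)) λ Z⊆X → ¬Z⊆X (∷-⊆ z∈X Z⊆X)

  card-map-≤ : ∀ (f : Element → Element) X → ∣ map f X ∣ ≤ ∣ X ∣
  card-map-≤ f X = ℕₚ.≤-trans (card-mono to)
    (subst (∣ map f (dedup X) ∣ ≤_) (length-map f (dedup X)) (card≤length (map f (dedup X))))
    where
    to : map f X ⊆ map f (dedup X)
    to y∈ with ∈-map⁻ f y∈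
    ... | x , x∈X , refl = ∈-map⁺ f (∈-dedup⁺ x∈X)

  left-inverse : ∀ (f : Element → Element) X →
    (∀ {x y} → x ∈ X → y ∈ X → f x ≡ f y → x ≡ y) →
    Σ[ g ∈ (Element → Element) ] (∀ {x} → x ∈ X → g (f x) ≡ x)
  left-inverse f [] _ = (λ x → x) , λ ()
  left-inverse f (z ∷ X) inj with left-inverse f X (λ x∈ y∈ → inj (there x∈) (there y∈))
  ... | g , g∘f = g′ , g′∘f
    where
    g′ : Element → Element
    g′ y with y ≟ f z
    ... | yes _ = z
    ... | no  _ = g y
    g′∘f : ∀ {x} → x ∈ z ∷ X → g′ (f x) ≡ x
    g′∘f {x} x∈ with f x ≟ f z
    ... | yes fx≡fz = inj (here refl) x∈ (sym fx≡fz)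
    g′∘f (here refl) | no fx≢fz = ⊥-elim (fx≢fz refl)
    g′∘f (there x∈)  | no _     = g∘f x∈

  card-map : ∀ (f : Element → Element) X →
    (∀ {x y} → x ∈ X → y ∈ X → f x ≡ f y → x ≡ y) → ∣ map f X ∣ ≡ ∣ X ∣
  card-map f X inj = ℕₚ.≤-antisym (card-map-≤ f X)
    (ℕₚ.≤-trans (card-mono back) (card-map-≤ g (map f X)))
    where
    g = proj₁ (left-inverse f X inj)
    back : X ⊆ map g (map f X)
    back {x} x∈X = subst (_∈ map g (map f X)) (proj₂ (left-inverse f X inj) x∈X)
                     (∈-map⁺ g (∈-map⁺ f x∈X))

  -- Reasoning up to double negation

  infixl 1 _>>=_
  _>>=_ : ∀ {a b} {P : Set a} {Q : Set b} → ¬ ¬ P → (P → ¬ ¬ Q) → ¬ ¬ Q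
  (¬¬p >>= f) ¬q = ¬¬p λ p → f p ¬q

  return : ∀ {a} {P : Set a} → P → ¬ ¬ P
  return p ¬p = ¬p p

  -- `P` need not be decidable. Were there no minimum, every set with `P` would have a smaller one,
  -- and the bound `k` on the cardinality would run out.
  minimal : ∀ (P : FinSet → Set) {X} → P X →
    ¬ ¬ (∃[ Y ] (P Y × (∀ Z → P Z → ∣ Y ∣ ≤ ∣ Z ∣)))
  minimal P {X} PX = go ∣ X ∣ PX ℕₚ.≤-refl
    where
    go : ∀ k {X} → P X → ∣ X ∣ ≤ k → ¬ ¬ (∃[ Y ] (P Y × (∀ Z → P Z → ∣ Y ∣ ≤ ∣ Z ∣)))
    go k {X} PX ∣X∣≤k ¬min = ¬min (X , PX , λ Z PZ → ℕₚ.≮⇒≥ λ ∣Z∣<∣X∣ → smaller k Z PZ (ℕₚ.≤-trans ∣Z∣<∣X∣ ∣X∣≤k))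
      where
      smaller : ∀ k Z → P Z → ¬ ∣ Z ∣ < k
      smaller (suc k) Z PZ (s≤s ∣Z∣≤k) = go k PZ ∣Z∣≤k ¬min

  -- Hall's theorem

  -- A system of distinct representatives. The values of `σ` off `rows` do not matter, and
  -- repetitions in the list `rows` are harmless.
  record Matches (A : Rel Element 0ℓ) (rows cols : FinSet) (σ : Element → Element) : Set where
    field
      inside    : ∀ {i} → i ∈ rows → σ i ∈ cols
      along     : ∀ {i} → i ∈ rows → A i (σ i)
      injective : ∀ {i j} → i ∈ rows → j ∈ rows → σ i ≡ σ j → i ≡ j

  open Matches

  Matchable : Rel Element 0ℓ → FinSet → FinSet → Set
  Matchable A rows cols = ∃[ σ ] Matches A rows cols σ

  matches-⊆ : ∀ {A rows rows′ cols cols′ σ} → rows′ ⊆ rows → cols ⊆ cols′ →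
              Matches A rows cols σ → Matches A rows′ cols′ σ
  matches-⊆ rows′⊆ cols⊆ m = record
    { inside    = λ i∈ → cols⊆ (inside m (rows′⊆ i∈))
    ; along     = λ i∈ → along m (rows′⊆ i∈)
    ; injective = λ i∈ j∈ → injective m (rows′⊆ i∈) (rows′⊆ j∈)
    }

  matchable-∷ : ∀ {A rows cols j v} → A j v → v ∈ cols →
                Matchable A (rows ∖ (j ∷ [])) (cols ∖ (v ∷ [])) → Matchable A rows cols
  matchable-∷ {A} {rows} {cols} {j} {v} Ajv v∈cols (σ , m) = σ′ , record
    { inside = inside′ ; along = along′ ; injective = injective′ }
    where
    σ′ : Element → Element
    σ′ i with i ≟ j
    ... | yes _ = v
    ... | no  _ = σ i
    keep : ∀ {i} → i ∈ rows → i ≢ j → i ∈ rows ∖ (j ∷ [])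
    keep i∈ i≢j = ∈-∖⁺ i∈ λ { (here i≡j) → i≢j i≡j }
    σ≢v : ∀ {i} → i ∈ rows → i ≢ j → v ≢ σ i
    σ≢v i∈ i≢j v≡ = proj₂ (∈-∖⁻ cols (v ∷ []) (inside m (keep i∈ i≢j))) (here (sym v≡))
    inside′ : ∀ {i} → i ∈ rows → σ′ i ∈ cols
    inside′ {i} i∈ with i ≟ j
    ... | yes _   = v∈cols
    ... | no  i≢j = ∖⊆ cols (v ∷ []) (inside m (keep i∈ i≢j))
    along′ : ∀ {i} → i ∈ rows → A i (σ′ i)
    along′ {i} i∈ with i ≟ j
    ... | yes refl = Ajv
    ... | no  i≢j  = along m (keep i∈ i≢j)
    injective′ : ∀ {i k} → i ∈ rows → k ∈ rows → σ′ i ≡ σ′ k → i ≡ k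
    injective′ {i} {k} i∈ k∈ eq with i ≟ j | k ≟ j
    ... | yes refl | yes refl = refl
    ... | yes refl | no  k≢j  = ⊥-elim (σ≢v k∈ k≢j eq)
    ... | no  i≢j  | yes refl = ⊥-elim (σ≢v i∈ i≢j (sym eq))
    ... | no  i≢j  | no  k≢j  = injective m (keep i∈ i≢j) (keep k∈ k≢j) eq

  module _ {A : Rel Element 0ℓ} (A? : Decidable A) where

    matchable? : ∀ rows cols → Dec (Matchable A rows cols)
    matchable? []         cols = yes ((λ i → i) , record { inside = λ () ; along = λ () ; injective = λ () })
    matchable? (j ∷ rows) cols with j ∈? rows
    -- A repeated row is skipped: expanding along it would demand a second column for it.
    ... | yes j∈ = map′ (λ (σ , m) → σ , matches-⊆ (∷-⊆ j∈ λ i∈ → i∈) (λ v∈ → v∈) m)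
                        (λ (σ , m) → σ , matches-⊆ there (λ v∈ → v∈) m) (matchable? rows cols)
    ... | no  j∉ = map′ to from (any? (λ v → A? j v ×-dec matchable? rows (cols ∖ (v ∷ []))) cols)
      where
      to : Any.Any (λ v → A j v × Matchable A rows (cols ∖ (v ∷ []))) cols → Matchable A (j ∷ rows) cols
      to some with find some
      ... | v , v∈ , Ajv , σ , m = matchable-∷ Ajv v∈ (σ , matches-⊆ shrink (λ u∈ → u∈) m)
        where
        shrink : (j ∷ rows) ∖ (j ∷ []) ⊆ rows
        shrink i∈ with ∈-∖⁻ (j ∷ rows) (j ∷ []) i∈
        ... | here i≡j , i∉  = ⊥-elim (i∉ (here i≡j))
        ... | there i∈ , _   = i∈
      from : Matchable A (j ∷ rows) cols → Any.Any (λ v → A j v × Matchable A rows (cols ∖ (v ∷ []))) cols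
      from (σ , m) = lose (inside m (here refl)) (along m (here refl) , σ , record
        { inside    = λ i∈ → ∈-∖⁺ (inside m (there i∈))
                        λ { (here eq) → j∉ (subst (_∈ rows) (injective m (there i∈) (here refl) eq) i∈) }
        ; along     = λ i∈ → along m (there i∈)
        ; injective = λ i∈ k∈ → injective m (there i∈) (there k∈) })

    opaque
      nbr : FinSet → FinSet → FinSet
      nbr K cols = filter (λ v → any? (λ k → A? k v) K) cols

      ∈-nbr⁺ : ∀ {K cols k v} → k ∈ K → v ∈ cols → A k v → v ∈ nbr K cols
      ∈-nbr⁺ {K} k∈ v∈ Akv = ∈-filter⁺ (λ v → any? (λ k → A? k v) K) v∈ (lose k∈ Akv)

      ∈-nbr⁻ : ∀ {v} K cols → v ∈ nbr K cols → v ∈ cols × ∃[ k ] (k ∈ K × A k v)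
      ∈-nbr⁻ K cols v∈ with ∈-filter⁻ (λ v → any? (λ k → A? k v) K) {xs = cols} v∈
      ... | v∈cols , some = v∈cols , find some

    nbr-⊆ : ∀ {K K′ cols cols′} → K ⊆ K′ → cols ⊆ cols′ → nbr K cols ⊆ nbr K′ cols′
    nbr-⊆ {K} {cols = cols} K⊆ cols⊆ v∈ with ∈-nbr⁻ K cols v∈
    ... | v∈cols , k , k∈ , Akv = ∈-nbr⁺ (K⊆ k∈) (cols⊆ v∈cols) Akv

    -- Neighbourhoods commute with unions, whereas the neighbourhood of an intersection is merely
    -- contained in the intersection of the neighbourhoods.
    nbr-submodular : ∀ K L cols →
      ∣ nbr (K ++ L) cols ∣ + ∣ nbr (K ∩ L) cols ∣ ≤ ∣ nbr K cols ∣ + ∣ nbr L cols ∣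
    nbr-submodular K L cols = begin
      ∣ nbr (K ++ L) cols ∣ + ∣ nbr (K ∩ L) cols ∣
        ≤⟨ ℕₚ.+-mono-≤ (card-mono union) (card-mono inter) ⟩
      ∣ nbr K cols ++ nbr L cols ∣ + ∣ nbr K cols ∩ nbr L cols ∣
        ≡⟨ card-modular (nbr K cols) (nbr L cols) ⟩
      ∣ nbr K cols ∣ + ∣ nbr L cols ∣ ∎
      where
      open ℕₚ.≤-Reasoning
      union : nbr (K ++ L) cols ⊆ nbr K cols ++ nbr L cols
      union v∈ with ∈-nbr⁻ (K ++ L) cols v∈
      ... | v∈cols , k , k∈ , Akv with ∈-++⁻ K k∈
      ...   | inj₁ k∈K = ∈-++⁺ˡ (∈-nbr⁺ k∈K v∈cols Akv)
      ...   | inj₂ k∈L = ∈-++⁺ʳ (nbr K cols) (∈-nbr⁺ k∈L v∈cols Akv)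
      inter : nbr (K ∩ L) cols ⊆ nbr K cols ∩ nbr L cols
      inter v∈ = ∈-∩⁺ (nbr-⊆ (λ k∈ → proj₁ (∈-∩⁻ K L k∈)) (λ u∈ → u∈) v∈)
                      (nbr-⊆ (λ k∈ → proj₂ (∈-∩⁻ K L k∈)) (λ u∈ → u∈) v∈)

    HallCondition : FinSet → FinSet → Set
    HallCondition rows cols = ∀ K → K ⊆ rows → ∣ K ∣ ≤ ∣ nbr K cols ∣

    Violates : FinSet → FinSet → FinSet → Set
    Violates rows cols K = K ⊆ rows × ∣ nbr K cols ∣ < ∣ K ∣

    matches⇒hall : ∀ {rows cols σ} → Matches A rows cols σ → HallCondition rows cols
    matches⇒hall {rows} {cols} {σ} m K K⊆ = subst (_≤ ∣ nbr K cols ∣)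
      (card-map σ K λ i∈ j∈ → injective m (K⊆ i∈) (K⊆ j∈)) (card-mono sub)
      where
      sub : map σ K ⊆ nbr K cols
      sub v∈ with ∈-map⁻ σ v∈
      ... | k , k∈ , refl = ∈-nbr⁺ k∈ (inside m (K⊆ k∈)) (along m (K⊆ k∈))

    ¬hall⇒violator : ∀ {rows cols} → ¬ HallCondition rows cols → ¬ ¬ (∃[ K ] Violates rows cols K)
    ¬hall⇒violator ¬hall ¬viol = ¬hall λ K K⊆ → ℕₚ.≮⇒≥ λ lt → ¬viol (K , K⊆ , lt)

    -- If v is needed, match it to a row j of a minimal violator K₀ of the condition
    -- without v: by submodularity K₀ lies in every violator, so none avoids j.
    hall : ∀ rows cols → HallCondition rows cols → Matchable A rows cols
    hall [] [] _ = (λ i → i) , record { inside = λ () ; along = λ () ; injective = λ () }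
    hall (j ∷ rows) [] hc = ⊥-elim (ℕₚ.<⇒≱ (s≤s z≤n) (ℕₚ.≤-trans (hc (j ∷ rows) (λ i∈ → i∈))
      (card-mono {Y = []} λ v∈ → proj₁ (∈-nbr⁻ (j ∷ rows) [] v∈))))
    hall rows (v ∷ cols) hc with v ∈? cols
    ... | yes v∈ = case hall rows cols (λ K K⊆ → ℕₚ.≤-trans (hc K K⊆)
                     (card-mono (nbr-⊆ (λ k∈ → k∈) (∷-⊆ v∈ (λ u∈ → u∈))))) of
                   λ (σ , m) → σ , matches-⊆ (λ i∈ → i∈) there m
    -- The claim is decidable, so the case distinction and the minimal violator may be used
    -- classically.
    ... | no v∉ = decidable-stable (matchable? rows (v ∷ cols))
      (¬¬-excluded-middle {A = HallCondition rows cols} >>= λ where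
        (yes hc′) → return (case hall rows cols hc′ of λ (σ , m) → σ , matches-⊆ (λ i∈ → i∈) there m)
        (no ¬hc′) → ¬hall⇒violator ¬hc′ >>= λ (K , viol) →
                    minimal (Violates rows cols) viol >>= λ (K₀ , viol₀ , min) →
                    return (remove K₀ viol₀ min))
      where
      nbr-∷ : ∀ K → ∣ nbr K (v ∷ cols) ∣ ≤ suc ∣ nbr K cols ∣
      nbr-∷ K = ℕₚ.≤-trans (card-mono sub) (card-∷-≤ v (nbr K cols))
        where
        sub : nbr K (v ∷ cols) ⊆ v ∷ nbr K cols
        sub u∈ with ∈-nbr⁻ K (v ∷ cols) u∈
        ... | here refl , _          = here refl
        ... | there u∈′ , k , k∈ , a = there (∈-nbr⁺ k∈ u∈′ a)
      remove : ∀ K₀ → Violates rows cols K₀ → (∀ K → Violates rows cols K → ∣ K₀ ∣ ≤ ∣ K ∣) →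
               Matchable A rows (v ∷ cols)
      remove K₀ (K₀⊆ , lt₀) min with any? (λ k → A? k v) K₀
      ... | no ¬some = ⊥-elim (ℕₚ.<⇒≱ lt₀ (ℕₚ.≤-trans (hc K₀ K₀⊆) (card-mono sub)))
        where
        sub : nbr K₀ (v ∷ cols) ⊆ nbr K₀ cols
        sub u∈ with ∈-nbr⁻ K₀ (v ∷ cols) u∈
        ... | here refl , k , k∈ , a = ⊥-elim (¬some (lose k∈ a))
        ... | there u∈′ , k , k∈ , a = ∈-nbr⁺ k∈ u∈′ a
      ... | yes some with find some
      ...   | j , j∈ , Ajv = matchable-∷ Ajv (here refl)
                (case hall (rows ∖ (j ∷ [])) cols hc′ of
                  λ (σ , m) → σ , matches-⊆ (λ i∈ → i∈) keep m)
        where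
        keep : cols ⊆ (v ∷ cols) ∖ (v ∷ [])
        keep u∈ = ∈-∖⁺ (there u∈) λ { (here refl) → v∉ u∈ }
        hc′ : HallCondition (rows ∖ (j ∷ [])) cols
        hc′ K K⊆ = ℕₚ.≮⇒≥ λ lt → ℕₚ.<⇒≱ K∩K₀<K₀ (min (K ∩ K₀) ((λ i∈ → K₀⊆ (proj₂ (∈-∩⁻ K K₀ i∈))) , lt∩ lt))
          where
          K∩K₀<K₀ : ∣ K ∩ K₀ ∣ < ∣ K₀ ∣
          K∩K₀<K₀ = ℕₚ.≤-<-trans (card-mono λ i∈ → ∈-∖⁺ (proj₂ (∈-∩⁻ K K₀ i∈))
                      (proj₂ (∈-∖⁻ rows (j ∷ []) (K⊆ (proj₁ (∈-∩⁻ K K₀ i∈)))))) (card-∖-< j∈)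
          -- `K` and `K₀` together lack at least two columns. Their union can lack only one, namely
          -- `v`, so their intersection lacks one too.
          lt∩ : ∣ nbr K cols ∣ < ∣ K ∣ → ∣ nbr (K ∩ K₀) cols ∣ < ∣ K ∩ K₀ ∣
          lt∩ lt = ℕₚ.+-cancelˡ-≤ (∣ nbr (K ++ K₀) cols ∣) _ _ (ℕₚ.≤-pred (begin
            suc (∣ nbr (K ++ K₀) cols ∣ + suc ∣ nbr (K ∩ K₀) cols ∣)
              ≡⟨ cong suc (ℕₚ.+-suc _ _) ⟩
            suc (suc (∣ nbr (K ++ K₀) cols ∣ + ∣ nbr (K ∩ K₀) cols ∣))
              ≤⟨ s≤s (s≤s (nbr-submodular K K₀ cols)) ⟩
            suc (suc (∣ nbr K cols ∣ + ∣ nbr K₀ cols ∣))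
              ≡⟨ cong suc (ℕₚ.+-suc _ _) ⟨
            suc (∣ nbr K cols ∣) + suc (∣ nbr K₀ cols ∣)
              ≤⟨ ℕₚ.+-mono-≤ lt lt₀ ⟩
            ∣ K ∣ + ∣ K₀ ∣
              ≡⟨ card-modular K K₀ ⟨
            ∣ K ++ K₀ ∣ + ∣ K ∩ K₀ ∣
              ≤⟨ ℕₚ.+-monoˡ-≤ _ (ℕₚ.≤-trans
                   (hc (K ++ K₀) (⊆-++⁻ (λ i∈ → ∖⊆ rows (j ∷ []) (K⊆ i∈)) K₀⊆)) (nbr-∷ (K ++ K₀))) ⟩
            suc (∣ nbr (K ++ K₀) cols ∣ + ∣ K ∩ K₀ ∣) ∎))
            where open ℕₚ.≤-Reasoning

    ¬matchable⇒violator : ∀ {rows cols} → ¬ Matchable A rows cols → ¬ ¬ (∃[ K ] Violates rows cols K)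
    ¬matchable⇒violator ¬m = ¬hall⇒violator λ hc → ¬m (hall _ _ hc)

    -- Tight sets are closed under union.
    blocked⇒tight : ∀ {rows cols} → HallCondition rows cols → ∀ Z → Z ⊆ cols →
      (∀ {z} → z ∈ Z → ¬ Matchable A rows (cols ∖ (z ∷ []))) →
      ¬ ¬ (∃[ K ] (K ⊆ rows × ∣ nbr K cols ∣ ≤ ∣ K ∣ × Z ⊆ nbr K cols))
    blocked⇒tight {cols = cols} hc [] _ _ = λ ¬p → ¬p ([] , (λ ()) , card-mono {nbr [] cols} none , λ ())
      where
      none : nbr [] cols ⊆ []
      none v∈ with ∈-nbr⁻ [] cols v∈
      ... | _ , _ , () , _
    blocked⇒tight {rows} {cols} hc (z ∷ Z) Z⊆ blocked =
      blocked⇒tight hc Z (Z⊆ ∘ there) (blocked ∘ there) >>= λ tight →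
      ¬matchable⇒violator (blocked (here refl)) >>= λ viol → return (join tight viol)
      where
      -- Deleting `z` takes a single column away, and only from sets that see `z`. A violator
      -- created by this deletion therefore sees `z` and was tight before.
      z∈ : ∀ L → L ⊆ rows → ∣ nbr L (cols ∖ (z ∷ [])) ∣ < ∣ L ∣ → z ∈ nbr L cols
      z∈ L L⊆ lt with z ∈? nbr L cols
      ... | yes z∈ = z∈
      ... | no  z∉ = ⊥-elim (ℕₚ.<⇒≱ lt (ℕₚ.≤-trans (hc L L⊆) (card-mono sub)))
        where
        sub : nbr L cols ⊆ nbr L (cols ∖ (z ∷ []))
        sub u∈ with ∈-nbr⁻ L cols u∈
        ... | u∈cols , k , k∈ , a = ∈-nbr⁺ k∈ (∈-∖⁺ u∈cols λ { (here refl) → z∉ u∈ }) a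
      tightL : ∀ L → ∣ nbr L (cols ∖ (z ∷ [])) ∣ < ∣ L ∣ → ∣ nbr L cols ∣ ≤ ∣ L ∣
      tightL L lt = ℕₚ.≤-trans (card-mono sub) (ℕₚ.≤-trans (card-∷-≤ z (nbr L (cols ∖ (z ∷ [])))) lt)
        where
        sub : nbr L cols ⊆ z ∷ nbr L (cols ∖ (z ∷ []))
        sub {u} u∈ with u ≟ z | ∈-nbr⁻ L cols u∈
        ... | yes refl | _                   = here refl
        ... | no  u≢z  | u∈cols , k , k∈ , a = there (∈-nbr⁺ k∈ (∈-∖⁺ u∈cols λ { (here u≡z) → u≢z u≡z }) a)
      union : ∀ K L → K ⊆ rows → L ⊆ rows → ∣ nbr K cols ∣ ≤ ∣ K ∣ →
              ∣ nbr L (cols ∖ (z ∷ [])) ∣ < ∣ L ∣ → ∣ nbr (K ++ L) cols ∣ ≤ ∣ K ++ L ∣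
      union K L K⊆ L⊆ tight lt = ℕₚ.+-cancelʳ-≤ (∣ K ∩ L ∣) _ _ (begin
        ∣ nbr (K ++ L) cols ∣ + ∣ K ∩ L ∣
          ≤⟨ ℕₚ.+-monoʳ-≤ _ (hc (K ∩ L) λ i∈ → K⊆ (proj₁ (∈-∩⁻ K L i∈))) ⟩
        ∣ nbr (K ++ L) cols ∣ + ∣ nbr (K ∩ L) cols ∣
          ≤⟨ nbr-submodular K L cols ⟩
        ∣ nbr K cols ∣ + ∣ nbr L cols ∣
          ≤⟨ ℕₚ.+-mono-≤ tight (tightL L lt) ⟩
        ∣ K ∣ + ∣ L ∣
          ≡⟨ card-modular K L ⟨
        ∣ K ++ L ∣ + ∣ K ∩ L ∣ ∎)
        where open ℕₚ.≤-Reasoning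
      join : ∃[ K ] (K ⊆ rows × ∣ nbr K cols ∣ ≤ ∣ K ∣ × Z ⊆ nbr K cols) →
             ∃[ L ] Violates rows (cols ∖ (z ∷ [])) L →
             ∃[ K ] (K ⊆ rows × ∣ nbr K cols ∣ ≤ ∣ K ∣ × z ∷ Z ⊆ nbr K cols)
      join (K , K⊆ , tight , Z⊆K) (L , L⊆ , lt) =
        K ++ L , ⊆-++⁻ K⊆ L⊆ , union K L K⊆ L⊆ tight lt ,
        ∷-⊆ (nbr-⊆ (∈-++⁺ʳ K) (λ u∈ → u∈) (z∈ L L⊆ lt)) (λ u∈ → nbr-⊆ ∈-++⁺ˡ (λ u∈ → u∈) (Z⊆K u∈))

  -- The linkage lemma

  last-∷ : ∀ (x y : Element) ys → last (x ∷ y ∷ ys) ≡ last (y ∷ ys)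
  last-∷ x y ys with initLast ys
  ... | []      = refl
  ... | _ ∷ʳ′ _ = refl

  data Next : List Element → Element → Element → Set where
    here  : ∀ {v w p} → Next (v ∷ w ∷ p) v w
    there : ∀ {u v w p} → Next p v w → Next (u ∷ p) v w

  next? : ∀ p v → Dec (∃[ w ] Next p v w)
  next? [] v = no λ ()
  next? (u ∷ []) v = no λ { (_ , there ()) }
  next? (u ∷ w ∷ p) v with u ≟ v | next? (w ∷ p) v
  ... | yes refl | _            = yes (w , here)
  ... | no _     | yes (x , nx) = yes (x , there nx)
  ... | no u≢v   | no ¬nx       = no λ { (_ , here) → u≢v refl ; (x , there nx) → ¬nx (x , nx) }

  next-∈-tail : ∀ {u p v w} → Next (u ∷ p) v w → w ∈ p
  next-∈-tail here                     = here refl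
  next-∈-tail {p = _ ∷ _} (there nx)   = there (next-∈-tail nx)

  next-linked : ∀ {R : Rel Element 0ℓ} {p v w} → Linked R p → Next p v w → R v w
  next-linked lk here       = Linked.head lk
  next-linked lk (there nx) = next-linked (Linked.tail lk) nx

  next-injective : ∀ {p v u w} → Unique p → Next p v w → Next p u w → v ≡ u
  next-injective _ here here = refl
  next-injective (_ ∷ w≢ ∷ _) here (there nx) = ⊥-elim (All.lookup w≢ (next-∈-tail nx) refl)
  next-injective (_ ∷ w≢ ∷ _) (there nx) here = ⊥-elim (All.lookup w≢ (next-∈-tail nx) refl)
  next-injective (_ ∷ p!) (there nx) (there ny) = next-injective p! nx ny

  next-exists : ∀ {v} (p : List⁺ Element) → v ∈ toList p → v ≢ last p → ∃[ w ] Next (toList p) v w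
  next-exists (x ∷ []) (here refl) v≢last = ⊥-elim (v≢last refl)
  next-exists (x ∷ y ∷ p) (here refl) v≢last = y , here
  next-exists {v} (x ∷ y ∷ p) (there v∈) v≢last
    with next-exists (y ∷ p) v∈ (subst (v ≢_) (last-∷ x y p) v≢last)
  ... | w , nx = w , there nx

  -- The loop at `v` is there for vertices that lie on no path of the routing: they are matched with
  -- themselves.
  Step : Digraph → Rel Element 0ℓ
  Step D v w = v ≡ w ⊎ (v , w) ∈ A D

  step? : ∀ D → Decidable (Step D)
  step? D v w = (v ≟ w) ⊎-dec any? (Productₚ.≡-dec _≟_ _≟_ (v , w)) (A D)

  module _ (D : Digraph) (T X : FinSet) (X⊆V : X ⊆ V D) where

    -- A vertex outside `T` goes to its successor on the path through it, or to itself if there is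
    -- no such path. Members of `X` are never hit: each of them begins a path, so it is no
    -- successor, and it has a successor itself unless it is in `T`.
    routing⇒matchable : ∃[ R ] IsRouting D X T R → Matchable (Step D) (V D ∖ T) (V D ∖ X)
    routing⇒matchable (R , isR) = σ , record
      { inside = inside′ ; along = along′ ; injective = injective′ }
      where
      open IsRouting isR
      Moves Stays : Element → Element → Set
      Moves v w = ∃[ p ] (p ∈ R × Next (toList p) v w)
      Stays v w = v ≡ w × (∀ {p u} → p ∈ R → ¬ Next (toList p) v u)
      target : ∀ v → ∃[ w ] (Moves v w ⊎ Stays v w)
      target v with any? (λ p → next? (toList p) v) R
      ... | yes some = case find some of λ (p , p∈ , w , nx) → w , inj₁ (p , p∈ , nx)
      ... | no ¬some = v , inj₂ (refl , λ p∈ nx → ¬some (lose p∈ (_ , nx)))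
      σ : Element → Element
      σ v = proj₁ (target v)
      rowV : ∀ {v} → v ∈ V D ∖ T → v ∈ V D
      rowV = ∖⊆ (V D) T
      rowT : ∀ {v} → v ∈ V D ∖ T → v ∉ T
      rowT v∈ = proj₂ (∈-∖⁻ (V D) T v∈)
      path : ∀ {p} → p ∈ R → IsPath D p
      path = All.lookup paths
      meet : ∀ {p q u} → p ∈ R → q ∈ R → u ∈ toList p → u ∈ toList q → ¬ ¬ p ≡ q
      meet p∈ q∈ u∈p u∈q p≢q = disjoint p∈ q∈ p≢q (u∈p , u∈q)
      ¬stays : ∀ {p v} → p ∈ R → v ∈ toList p → v ∉ T → ¬ Stays v v
      ¬stays {p} {v} p∈ v∈p v∉T (_ , ¬nx) =
        ¬nx p∈ (proj₂ (next-exists p v∈p λ v≡ → v∉T (subst (_∈ T) (sym v≡) (ends p∈))))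
      moves-V : ∀ {v w} → Moves v w → w ∈ V D
      moves-V (p , p∈ , nx) = proj₁ (path p∈) (there (next-∈-tail nx))
      avoids : ∀ {v w} → v ∉ T → Moves v w ⊎ Stays v w → w ∉ X
      avoids v∉T (inj₁ (p , p∈ , nx)) w∈X with starts w∈X
      ... | q , q∈ , refl = meet p∈ q∈ (there (next-∈-tail nx)) (here refl)
              λ { refl → Uniqueₚ.Unique[x∷xs]⇒x∉xs (proj₁ (proj₂ (path p∈))) (next-∈-tail nx) }
      avoids v∉T (inj₂ (refl , ¬nx)) w∈X with starts w∈X
      ... | q , q∈ , refl = ¬stays q∈ (here refl) v∉T (refl , ¬nx)
      inside′ : ∀ {v} → v ∈ V D ∖ T → σ v ∈ V D ∖ X
      inside′ {v} v∈ with target v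
      ... | w , inj₁ mv = ∈-∖⁺ (moves-V mv) (avoids (rowT v∈) (inj₁ mv))
      ... | w , inj₂ (refl , ¬nx) = ∈-∖⁺ (rowV v∈) (avoids (rowT v∈) (inj₂ (refl , ¬nx)))
      along′ : ∀ {v} → v ∈ V D ∖ T → Step D v (σ v)
      along′ {v} v∈ with target v
      ... | w , inj₁ (p , p∈ , nx) = inj₂ (next-linked (proj₂ (proj₂ (path p∈))) nx)
      ... | w , inj₂ (v≡w , _)     = inj₁ v≡w
      injective′ : ∀ {v u} → v ∈ V D ∖ T → u ∈ V D ∖ T → σ v ≡ σ u → v ≡ u
      injective′ {v} {u} v∈ u∈ eq = decidable-stable (v ≟ u) (go (target v) (target u) eq)
        where
        go : (t : ∃[ w ] (Moves v w ⊎ Stays v w)) (s : ∃[ w ] (Moves u w ⊎ Stays u w)) →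
             proj₁ t ≡ proj₁ s → ¬ ¬ v ≡ u
        go (w , inj₁ (p , p∈ , nx)) (w , inj₁ (q , q∈ , ny)) refl =
          meet p∈ q∈ (there (next-∈-tail nx)) (there (next-∈-tail ny)) >>=
          λ { refl → return (next-injective (proj₁ (proj₂ (path p∈))) nx ny) }
        go (w , inj₁ (p , p∈ , nx)) (w , inj₂ (refl , ¬ny)) refl =
          ⊥-elim (¬stays p∈ (there (next-∈-tail nx)) (rowT u∈) (refl , ¬ny))
        go (w , inj₂ (refl , ¬nx)) (w , inj₁ (q , q∈ , ny)) refl =
          ⊥-elim (¬stays q∈ (there (next-∈-tail ny)) (rowT v∈) (refl , ¬nx))
        go (w , inj₂ (refl , _)) (w , inj₂ (refl , _)) refl = return refl

    module _ {σ : Element → Element} (m : Matches (Step D) (V D ∖ T) (V D ∖ X) σ) where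

      data Orbit (x : Element) : Element → Set where
        start : Orbit x x
        next  : ∀ {w} → Orbit x w → w ∈ V D ∖ T → Orbit x (σ w)

      data Walk : Element → List⁺ Element → Set where
        stop : ∀ {v} → v ∈ T → Walk v (v ∷ [])
        move : ∀ {v p} → v ∉ T → Walk (σ v) p → Walk v (v ∷ toList p)

      walk-functional : ∀ {v p q} → Walk v p → Walk v q → p ≡ q
      walk-functional (stop _)     (stop _)     = refl
      walk-functional (stop v∈T)   (move v∉T _) = ⊥-elim (v∉T v∈T)
      walk-functional (move v∉T _) (stop v∈T)   = ⊥-elim (v∉T v∈T)
      walk-functional (move _ wp)  (move _ wq)  with walk-functional wp wq
      ... | refl = refl

      σ∉X : ∀ {w} → w ∈ V D ∖ T → σ w ∉ X
      σ∉X w∈ = proj₂ (∈-∖⁻ (V D) X (inside m w∈))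

      -- Both orbits can be traced back simultaneously because `σ` is injective off `T`, and they
      -- reach their starts simultaneously because `σ` misses `X`.
      orbits-disjoint : ∀ {x y u} → x ∈ X → y ∈ X → Orbit x u → Orbit y u → x ≡ y
      orbits-disjoint {x} {y} x∈ y∈ ox oy = go ox oy refl
        where
        go : ∀ {u v} → Orbit x u → Orbit y v → u ≡ v → x ≡ y
        go start      start      refl = refl
        go start      (next _ w∈) eq  = ⊥-elim (σ∉X w∈ (subst (_∈ X) eq x∈))
        go (next _ w∈) start     eq   = ⊥-elim (σ∉X w∈ (subst (_∈ X) (sym eq) y∈))
        go (next ox w∈) (next oy u∈) eq = go ox oy (injective m w∈ u∈ eq)

      record Goodwalk (x v : Element) (visited : FinSet) : Set where
        field
          route  : List⁺ Element
          walk   : Walk v route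
          simple : Unique (toList route)
          fresh′ : ∀ {u} → u ∈ toList route → u ∉ visited
          orbit  : ∀ {u} → u ∈ toList route → Orbit x u

      -- `k` bounds the number of unvisited vertices. The walk never returns: by the hypothesis on
      -- `v ∷ visited`, a vertex met so far is `x`, which `σ` misses, or the image of a visited
      -- vertex, which `v` is not.
      goodwalk : ∀ {x} → x ∈ X → ∀ k v visited → Orbit x v → v ∈ V D → v ∉ visited →
        (∀ {u} → u ∈ v ∷ visited → u ≡ x ⊎ (∃[ w ] (w ∈ visited × w ∈ V D ∖ T × u ≡ σ w))) →
        ∣ V D ∖ visited ∣ ≤ k → Goodwalk x v visited
      goodwalk x∈X zero v visited ov v∈V v∉ _ bound =
        ⊥-elim (ℕₚ.<⇒≱ (s≤s z≤n) (ℕₚ.≤-trans (card-mono {v ∷ []} λ { (here refl) → ∈-∖⁺ v∈V v∉ }) bound))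
      goodwalk {x} x∈X (suc k) v visited ov v∈V v∉ back bound with v ∈? T
      ... | yes v∈T = record
        { route  = v ∷ []
        ; walk   = stop v∈T
        ; simple = [] ∷ []
        ; fresh′ = λ { (here refl) → v∉ }
        ; orbit  = λ { (here refl) → ov }
        }
      ... | no v∉T = record
        { route  = v ∷ toList (Goodwalk.route rest)
        ; walk   = move v∉T (Goodwalk.walk rest)
        ; simple = All.tabulate (λ u∈ v≡u → Goodwalk.fresh′ rest u∈ (here (sym v≡u))) ∷ Goodwalk.simple rest
        ; fresh′ = λ { (here refl) → v∉ ; (there u∈) u∈vis → Goodwalk.fresh′ rest u∈ (there u∈vis) }
        ; orbit  = λ { (here refl) → ov ; (there u∈) → Goodwalk.orbit rest u∈ }
        }
        where
        v∈row : v ∈ V D ∖ T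
        v∈row = ∈-∖⁺ v∈V v∉T
        σv∉ : σ v ∉ v ∷ visited
        σv∉ σv∈ with back σv∈
        ... | inj₁ σv≡x = σ∉X v∈row (subst (_∈ X) (sym σv≡x) x∈X)
        ... | inj₂ (w , w∈vis , w∈row , eq) = v∉ (subst (_∈ visited) (sym (injective m v∈row w∈row eq)) w∈vis)
        back′ : ∀ {u} → u ∈ σ v ∷ v ∷ visited → u ≡ x ⊎ (∃[ w ] (w ∈ v ∷ visited × w ∈ V D ∖ T × u ≡ σ w))
        back′ (here refl) = inj₂ (v , here refl , v∈row , refl)
        back′ (there u∈) with back u∈
        ... | inj₁ u≡x = inj₁ u≡x
        ... | inj₂ (w , w∈vis , rest) = inj₂ (w , there w∈vis , rest)
        bound′ : ∣ V D ∖ (v ∷ visited) ∣ ≤ k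
        bound′ = ℕₚ.≤-pred (ℕₚ.≤-trans (subst (_≤ ∣ V D ∖ visited ∣)
          (card-∷ λ v∈ → proj₂ (∈-∖⁻ (V D) (v ∷ visited) v∈) (here refl))
          (card-mono (∷-⊆ (∈-∖⁺ v∈V v∉) λ u∈ → case ∈-∖⁻ (V D) (v ∷ visited) u∈ of
            λ (u∈V , u∉) → ∈-∖⁺ u∈V λ u∈vis → u∉ (there u∈vis)))) bound)
        rest : Goodwalk x (σ v) (v ∷ visited)
        rest = goodwalk x∈X k (σ v) (v ∷ visited) (next ov v∈row) (∖⊆ (V D) X (inside m v∈row)) σv∉ back′ bound′

      walk-head : ∀ {v p} → Walk v p → head p ≡ v
      walk-head (stop _)   = refl
      walk-head (move _ _) = refl

      walk-last : ∀ {v p} → Walk v p → last p ∈ T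
      walk-last (stop v∈T) = v∈T
      walk-last (move {v} {y ∷ p} _ w) = subst (_∈ T) (sym (last-∷ v y p)) (walk-last w)

      walk-V : ∀ {v p} → v ∈ V D → Walk v p → toList p ⊆ V D
      walk-V v∈V (stop _)     = ∷-⊆ v∈V λ ()
      walk-V v∈V (move v∉T w) = ∷-⊆ v∈V (walk-V (∖⊆ (V D) X (inside m (∈-∖⁺ v∈V v∉T))) w)

      walk-linked : ∀ {x v p} → x ∈ X → Orbit x v → v ∈ V D → Walk v p → Unique (toList p) →
                    Linked (λ u w → (u , w) ∈ A D) (toList p)
      walk-linked x∈X ov v∈V (stop _) _ = [-]
      walk-linked {x} {v} x∈X ov v∈V (move {p = y ∷ p} v∉T w) (v≢ ∷ p!)
        with refl ← walk-head w
        with along m (∈-∖⁺ v∈V v∉T)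
      -- As the route is simple, it uses none of the loops in `Step`.
      ... | inj₁ v≡σv = ⊥-elim (All.lookup v≢ (here refl) v≡σv)
      ... | inj₂ arc  = arc ∷ walk-linked x∈X (next ov v∈row) (∖⊆ (V D) X (inside m v∈row)) w p!
        where v∈row = ∈-∖⁺ v∈V v∉T

      private
        good : ∀ {x} → x ∈ X → Goodwalk x x []
        good {x} x∈X = goodwalk x∈X ∣ V D ∖ [] ∣ x [] start (X⊆V x∈X) (λ ())
          (λ { (here refl) → inj₁ refl }) ℕₚ.≤-refl

        routes : ∀ Z → Z ⊆ X → List (List⁺ Element)
        routes []      _   = []
        routes (z ∷ Z) Z⊆X = Goodwalk.route (good (Z⊆X (here refl))) ∷ routes Z (Z⊆X ∘ there)

        -- Different proofs of `x ∈ X` may lead to different values of `good`, so only some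
        -- `Goodwalk` is asked for. Their routes agree by `walk-functional`.
        RouteFrom : List⁺ Element → Element → Set
        RouteFrom p x = x ∈ X × ∃[ g ] (p ≡ Goodwalk.route {x} {x} {[]} g)

        routes-∈⁻ : ∀ Z (Z⊆X : Z ⊆ X) {p} → p ∈ routes Z Z⊆X → ∃[ x ] RouteFrom p x
        routes-∈⁻ (z ∷ Z) Z⊆X (here refl) = z , Z⊆X (here refl) , good (Z⊆X (here refl)) , refl
        routes-∈⁻ (z ∷ Z) Z⊆X (there p∈)  = routes-∈⁻ Z (Z⊆X ∘ there) p∈

        routes-∈⁺ : ∀ Z (Z⊆X : Z ⊆ X) {x} → x ∈ Z → ∃[ p ] (p ∈ routes Z Z⊆X × RouteFrom p x)
        routes-∈⁺ (z ∷ Z) Z⊆X (here refl) = _ , here refl , Z⊆X (here refl) , good (Z⊆X (here refl)) , refl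
        routes-∈⁺ (z ∷ Z) Z⊆X (there x∈)  =
          case routes-∈⁺ Z (Z⊆X ∘ there) x∈ of λ (p , p∈ , from) → p , there p∈ , from

      matches⇒routing : ∃[ R ] IsRouting D X T R
      matches⇒routing = routes X (λ x∈ → x∈) , record
        { paths    = All.tabulate λ p∈ → isPath (routes-∈⁻ X _ p∈)
        ; starts   = λ x∈ → begins (routes-∈⁺ X _ x∈)
        ; ends     = λ p∈ → end (routes-∈⁻ X _ p∈)
        ; disjoint = λ p∈ q∈ p≢q (u∈p , u∈q) → disj (routes-∈⁻ X _ p∈) (routes-∈⁻ X _ q∈) p≢q u∈p u∈q
        }
        where
        isPath : ∀ {p} → ∃[ x ] RouteFrom p x → IsPath D p
        isPath (x , x∈X , g , refl) = walk-V (X⊆V x∈X) (Goodwalk.walk g) , Goodwalk.simple g ,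
          walk-linked x∈X start (X⊆V x∈X) (Goodwalk.walk g) (Goodwalk.simple g)
        begins : ∀ {R x} → ∃[ p ] (p ∈ R × RouteFrom p x) → ∃[ p ] (p ∈ R × head p ≡ x)
        begins (p , p∈ , _ , g , refl) = p , p∈ , walk-head (Goodwalk.walk g)
        end : ∀ {p} → ∃[ x ] RouteFrom p x → last p ∈ T
        end (x , _ , g , refl) = walk-last (Goodwalk.walk g)
        disj : ∀ {p q u} → ∃[ x ] RouteFrom p x → ∃[ y ] RouteFrom q y → p ≢ q → u ∈ toList p → u ∉ toList q
        disj (x , x∈X , g , refl) (y , y∈X , h , refl) p≢q u∈p u∈q
          with orbits-disjoint x∈X y∈X (Goodwalk.orbit g u∈p) (Goodwalk.orbit h u∈q)
        ... | refl = p≢q (walk-functional (Goodwalk.walk g) (Goodwalk.walk h))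

  -- Minors and isomorphic copies of gammoids

  open Equivalence using (to; from)

  -- A gammoid is the dual of a contraction of a transversal matroid: X is independent
  -- iff the family (A i)_{i ∈ rows} of subsets of cols has a transversal avoiding X.
  Represents : Rel Element 0ℓ → FinSet → FinSet → Matroid → Set
  Represents A rows cols M =
    E M ⊆ cols × (∀ X → Indep M X ⇔ (X ⊆ E M × Matchable A rows (cols ∖ X)))

  ∖-mono : ∀ {V W X Y : FinSet} → V ⊆ W → Y ⊆ X → V ∖ X ⊆ W ∖ Y
  ∖-mono {V} {X = X} V⊆W Y⊆X v∈ = case ∈-∖⁻ V X v∈ of λ (v∈V , v∉X) → ∈-∖⁺ (V⊆W v∈V) (v∉X ∘ Y⊆X)

  ∖-++ : ∀ (V X Y : FinSet) → (V ∖ Y) ∖ X ⊆ V ∖ (X ++ Y)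
  ∖-++ V X Y v∈ = case ∈-∖⁻ (V ∖ Y) X v∈ of λ (v∈∖ , v∉X) → case ∈-∖⁻ V Y v∈∖ of λ (v∈V , v∉Y) →
    ∈-∖⁺ v∈V λ v∈++ → [ v∉X , v∉Y ]′ (∈-++⁻ X v∈++)

  ++-∖ : ∀ (V X Y : FinSet) → V ∖ (X ++ Y) ⊆ (V ∖ Y) ∖ X
  ++-∖ V X Y v∈ = case ∈-∖⁻ V (X ++ Y) v∈ of λ (v∈V , v∉) →
    ∈-∖⁺ (∈-∖⁺ v∈V (v∉ ∘ ∈-++⁺ʳ X)) (v∉ ∘ ∈-++⁺ˡ)

  matchable-⊆ : ∀ {A rows cols cols′} → cols ⊆ cols′ → Matchable A rows cols → Matchable A rows cols′
  matchable-⊆ cols⊆ (σ , m) = σ , matches-⊆ (λ i∈ → i∈) cols⊆ m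

  Γ⇒represents : ∀ {D T M} → IsΓ D T M → Represents (Step D) (V D ∖ T) (V D) M
  Γ⇒represents {D} {T} (_ , E⊆V , indep) = E⊆V , λ X → mk⇔
    (λ iX → case to (indep X) iX of λ (X⊆E , R) →
      ⟨ X⊆E , routing⇒matchable D T X (λ x∈ → E⊆V (X⊆E x∈)) R ⟩)
    (λ (X⊆E , σ , m) → from (indep X) ⟨ X⊆E , matches⇒routing D T X (λ x∈ → E⊆V (X⊆E x∈)) m ⟩)
    where
    ⟨_,_⟩ : ∀ {X Y : FinSet} {P : Set} → X ⊆ Y → P → X ⊆ Y × P
    ⟨ X⊆Y , p ⟩ = X⊆Y , p

  -- These conditions allow `cols` to be read as the vertices of a digraph, `rows` as its
  -- non-targets and `A` as its arcs together with the loops of `Step`.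
  record Reflexive (A : Rel Element 0ℓ) (rows cols : FinSet) : Set where
    field
      rows⊆cols : rows ⊆ cols
      diagonal  : ∀ {i} → i ∈ rows → A i i

  -- The names of rows are irrelevant to matchability. Naming each row after its column in some
  -- fixed matching makes the representation reflexive.
  module Relabel {A : Rel Element 0ℓ} {rows cols : FinSet} {σ₀ : Element → Element}
                 (m₀ : Matches A rows cols σ₀) where

    τ : Element → Element
    τ = proj₁ (left-inverse σ₀ rows (injective m₀))

    τσ₀ : ∀ {i} → i ∈ rows → τ (σ₀ i) ≡ i
    τσ₀ = proj₂ (left-inverse σ₀ rows (injective m₀))

    A′ : Rel Element 0ℓ
    A′ w v = A (τ w) v

    rows′ : FinSet
    rows′ = map σ₀ rows

    τ-row : ∀ {w} → w ∈ rows′ → τ w ∈ rows × σ₀ (τ w) ≡ w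
    τ-row w∈ with ∈-map⁻ σ₀ w∈
    ... | i , i∈ , refl = subst (_∈ rows) (sym (τσ₀ i∈)) i∈ , cong σ₀ (τσ₀ i∈)

    relabel⁺ : ∀ {cols′} → Matchable A rows cols′ → Matchable A′ rows′ cols′
    relabel⁺ (σ , m) = σ ∘ τ , record
      { inside    = λ w∈ → inside m (proj₁ (τ-row w∈))
      ; along     = λ w∈ → along m (proj₁ (τ-row w∈))
      ; injective = λ w∈ u∈ eq → trans (sym (proj₂ (τ-row w∈)))
          (trans (cong σ₀ (injective m (proj₁ (τ-row w∈)) (proj₁ (τ-row u∈)) eq)) (proj₂ (τ-row u∈)))
      }

    relabel⁻ : ∀ {cols′} → Matchable A′ rows′ cols′ → Matchable A rows cols′
    relabel⁻ (σ , m) = σ ∘ σ₀ , record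
      { inside    = λ i∈ → inside m (∈-map⁺ σ₀ i∈)
      ; along     = λ i∈ → subst (λ k → A k _) (τσ₀ i∈) (along m (∈-map⁺ σ₀ i∈))
      ; injective = λ i∈ k∈ eq → injective m₀ i∈ k∈ (injective m (∈-map⁺ σ₀ i∈) (∈-map⁺ σ₀ k∈) eq)
      }

    relabel-reflexive : Reflexive A′ rows′ cols
    relabel-reflexive = record
      { rows⊆cols = λ w∈ → subst (_∈ cols) (proj₂ (τ-row w∈)) (inside m₀ (proj₁ (τ-row w∈)))
      ; diagonal  = λ {w} w∈ → subst (A (τ w)) (proj₂ (τ-row w∈)) (along m₀ (proj₁ (τ-row w∈)))
      }

    relabel-represents : ∀ {M cols′} → Represents A rows cols′ M → Represents A′ rows′ cols′ M
    relabel-represents (E⊆ , indep) = E⊆ , λ X → mk⇔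
      (λ iX → case to (indep X) iX of λ X⊆E×m → (λ {x} → proj₁ X⊆E×m {x}) , relabel⁺ (proj₂ X⊆E×m))
      (λ X⊆E×m → from (indep X) ((λ {x} → proj₁ X⊆E×m {x}) , relabel⁻ (proj₂ X⊆E×m)))

  module _ {A : Rel Element 0ℓ} (A? : Decidable A) {rows cols : FinSet} (rf : Reflexive A rows cols) where

    open Reflexive rf

    private
      arcs : List (Element × Element)
      arcs = filter (λ (w , v) → A? w v) (cartesianProduct rows cols)

    digraph : Digraph
    digraph = record
      { V = cols
      ; A = arcs
      ; A⊆V×V = λ wv∈ → case ∈-cartesianProduct⁻ rows cols (proj₁ (arc⁻ wv∈)) of
          λ (w∈ , v∈) → rows⊆cols w∈ , v∈
      }
      where
      arc⁻ : ∀ {w v} → (w , v) ∈ arcs → (w , v) ∈ cartesianProduct rows cols × A w v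
      arc⁻ = ∈-filter⁻ (λ (w , v) → A? w v) {xs = cartesianProduct rows cols}

    private
      T : FinSet
      T = cols ∖ rows

      ∖T⊆rows : cols ∖ T ⊆ rows
      ∖T⊆rows {v} v∈ with v ∈? rows
      ... | yes v∈rows = v∈rows
      ... | no  v∉rows = case ∈-∖⁻ cols T v∈ of λ (v∈cols , v∉T) → ⊥-elim (v∉T (∈-∖⁺ v∈cols v∉rows))

      rows⊆∖T : rows ⊆ cols ∖ T
      rows⊆∖T i∈ = ∈-∖⁺ (rows⊆cols i∈) λ i∈T → proj₂ (∈-∖⁻ cols rows i∈T) i∈

      step⁺ : ∀ {w v} → w ∈ rows → v ∈ cols → A w v → Step digraph w v
      step⁺ w∈ v∈ a = inj₂ (∈-filter⁺ (λ (w , v) → A? w v) (∈-cartesianProduct⁺ w∈ v∈) a)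

      step⁻ : ∀ {w v} → w ∈ rows → Step digraph w v → A w v
      step⁻ w∈ (inj₁ refl) = diagonal w∈
      step⁻ w∈ (inj₂ arc)  = proj₂ (∈-filter⁻ (λ (w , v) → A? w v) {xs = cartesianProduct rows cols} arc)

    represents⇒Γ : ∀ {M} → Represents A rows cols M → IsΓ digraph T M
    represents⇒Γ {M} (E⊆ , indep) = ∖⊆ cols rows , E⊆ , λ X → mk⇔
      (λ iX → (λ {x} → proj₁ (to (indep X) iX) {x}) , route X (to (indep X) iX))
      (λ X⊆E×R → from (indep X) ((λ {x} → proj₁ X⊆E×R {x}) , match X X⊆E×R))
      where
      route : ∀ X → X ⊆ E M × Matchable A rows (cols ∖ X) → ∃[ R ] IsRouting digraph X T R
      route X (X⊆E , σ , m) = matches⇒routing digraph T X (λ x∈ → E⊆ (X⊆E x∈)) {σ} record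
        { inside    = λ w∈ → inside m (∖T⊆rows w∈)
        ; along     = λ w∈ → step⁺ (∖T⊆rows w∈) (∖⊆ cols X (inside m (∖T⊆rows w∈))) (along m (∖T⊆rows w∈))
        ; injective = λ w∈ u∈ → injective m (∖T⊆rows w∈) (∖T⊆rows u∈)
        }
      match : ∀ X → X ⊆ E M × ∃[ R ] IsRouting digraph X T R → Matchable A rows (cols ∖ X)
      match X (X⊆E , R) = case routing⇒matchable digraph T X (λ x∈ → E⊆ (X⊆E x∈)) R of λ (σ , m) → σ , record
        { inside    = λ w∈ → inside m (rows⊆∖T w∈)
        ; along     = λ w∈ → step⁻ w∈ (along m (rows⊆∖T w∈))
        ; injective = λ w∈ u∈ → injective m (rows⊆∖T w∈) (rows⊆∖T u∈)
        }

  -- The empty set is independent, which provides the matching needed for relabelling. That the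
  -- vertex set is exactly `cols` is kept for the sake of strictness.
  represents⇒gammoid : ∀ {A rows cols M} → Decidable A → Represents A rows cols M →
    ∃[ D ] ∃[ T ] (IsΓ D T M × V D ≡ cols)
  represents⇒gammoid {A} {rows} {cols} {M} A? rep with to (proj₂ rep []) (empty M)
  ... | _ , σ₀ , m₀ = _ , _ , represents⇒Γ (λ w v → A? (τ w) v) relabel-reflexive {M} (relabel-represents {M} rep) , refl
    where open Relabel (matches-⊆ {cols′ = cols} (λ i∈ → i∈) (∖⊆ cols []) m₀)

  -- Bases and independence of the choice of a base

  module _ (M : Matroid) where

    base-exists : ∀ C → ∃[ B ] IsBase M C B
    base-exists C = pick (grow C (λ c∈ → c∈) [] (λ ()) (empty M))
      where
      Grown : FinSet → FinSet → Set
      Grown Z B = ∃[ B′ ] (B ⊆ B′ × B′ ⊆ C × Indep M B′ × (∀ {c} → c ∈ Z → Indep M (c ∷ B′) → c ∈ B′))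
      pick : Grown C [] → ∃[ B ] IsBase M C B
      pick (B , _ , B⊆C , iB , max) = B , B⊆C , iB , max
      grow : ∀ Z → Z ⊆ C → ∀ B → B ⊆ C → Indep M B → Grown Z B
      grow [] _ B B⊆C iB = B , (λ b∈ → b∈) , B⊆C , iB , λ ()
      grow (z ∷ Z) Z⊆C B B⊆C iB with indep? M (z ∷ B)
      ... | yes izB = step (grow Z (Z⊆C ∘ there) (z ∷ B) (∷-⊆ (Z⊆C (here refl)) B⊆C) izB)
        where
        step : Grown Z (z ∷ B) → Grown (z ∷ Z) B
        step (B′ , B⊆ , B′⊆C , iB′ , max) =
          B′ , B⊆ ∘ there , B′⊆C , iB′ , λ { (here refl) _ → B⊆ (here refl) ; (there c∈) → max c∈ }
      ... | no ¬izB = step (grow Z (Z⊆C ∘ there) B B⊆C iB)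
        where
        step : Grown Z B → Grown (z ∷ Z) B
        step (B′ , B⊆ , B′⊆C , iB′ , max) = B′ , B⊆ , B′⊆C , iB′ , λ where
          (here refl) i → ⊥-elim (¬izB (hereditary M (∷-⊆ (here refl) (there ∘ B⊆)) i))
          (there c∈)    → max c∈

    extend : ∀ {X W} → Indep M X → Indep M W →
      ∃[ Y ] (X ⊆ Y × Y ⊆ X ++ W × Indep M Y × ∣ W ∣ ≤ ∣ Y ∣)
    extend {X} {W} iX iW = go ∣ W ∣ X (λ x∈ → x∈) ∈-++⁺ˡ iX (ℕₚ.m≤n+m (∣ W ∣) (∣ X ∣))
      where
      go : ∀ k Y → X ⊆ Y → Y ⊆ X ++ W → Indep M Y → ∣ W ∣ ≤ ∣ Y ∣ + k →
           ∃[ Y ] (X ⊆ Y × Y ⊆ X ++ W × Indep M Y × ∣ W ∣ ≤ ∣ Y ∣)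
      go zero Y X⊆Y Y⊆ iY bound = Y , X⊆Y , Y⊆ , iY , subst (∣ W ∣ ≤_) (ℕₚ.+-identityʳ (∣ Y ∣)) bound
      go (suc k) Y X⊆Y Y⊆ iY bound with ∣ W ∣ ℕₚ.≤? ∣ Y ∣
      ... | yes ∣W∣≤∣Y∣ = Y , X⊆Y , Y⊆ , iY , ∣W∣≤∣Y∣
      ... | no  ∣W∣≰∣Y∣ with augment M iY iW (ℕₚ.≰⇒> ∣W∣≰∣Y∣)
      ...   | y , y∈W , y∉Y , iyY = go k (y ∷ Y) (there ∘ X⊆Y) (∷-⊆ (∈-++⁺ʳ X y∈W) Y⊆) iyY
                (subst (∣ W ∣ ≤_) (trans (ℕₚ.+-suc (∣ Y ∣) k) (cong (_+ k) (sym (card-∷ y∉Y)))) bound)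

    base-maximum : ∀ {C B X} → IsBase M C B → X ⊆ C → Indep M X → ∣ X ∣ ≤ ∣ B ∣
    base-maximum (B⊆C , iB , max) X⊆C iX = ℕₚ.≮⇒≥ λ lt →
      case augment M iB iX lt of λ (x , x∈X , x∉B , ixB) → x∉B (max (X⊆C x∈X) ixB)

    -- Extend `B₀` inside `X ++ B` to the size of `X ++ B`. Maximality of `B₀` leaves no room for
    -- further elements of `B`, so by counting all of `X` has been added.
    exchange-base : ∀ {C B B₀ X} → IsBase M C B → IsBase M C B₀ → (∀ {x} → x ∈ X → x ∉ C) →
      Indep M (X ++ B) → Indep M (X ++ B₀)
    exchange-base {C} {B} {B₀} {X} bB bB₀@(B₀⊆C , iB₀ , max₀) X∩C=∅ iXB
      with extend iB₀ iXB
    ... | Y , B₀⊆Y , Y⊆ , iY , ∣XB∣≤∣Y∣ = hereditary M (⊆-++⁻ {X} X⊆Y B₀⊆Y) iY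
      where
      Y⊆XB₀ : Y ⊆ X ++ B₀
      Y⊆XB₀ y∈Y with ∈-++⁻ B₀ (Y⊆ y∈Y)
      ... | inj₁ y∈B₀ = ∈-++⁺ʳ X y∈B₀
      ... | inj₂ y∈XB with ∈-++⁻ X y∈XB
      ...   | inj₁ y∈X = ∈-++⁺ˡ y∈X
      ...   | inj₂ y∈B = ∈-++⁺ʳ X (max₀ (proj₁ bB y∈B) (hereditary M (∷-⊆ y∈Y B₀⊆Y) iY))
      disjoint : ∀ {B x} → B ⊆ C → x ∈ X → x ∉ B
      disjoint B⊆C x∈X x∈B = X∩C=∅ x∈X (B⊆C x∈B)
      X⊆Y : X ⊆ Y
      X⊆Y = ⊆-card Y⊆XB₀ (begin
        ∣ X ++ B₀ ∣     ≡⟨ card-++ (disjoint B₀⊆C) ⟩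
        ∣ X ∣ + ∣ B₀ ∣  ≤⟨ ℕₚ.+-monoʳ-≤ (∣ X ∣) (base-maximum bB B₀⊆C iB₀) ⟩
        ∣ X ∣ + ∣ B ∣   ≡⟨ card-++ (disjoint (proj₁ bB)) ⟨
        ∣ X ++ B ∣      ≤⟨ ∣XB∣≤∣Y∣ ⟩
        ∣ Y ∣           ∎) ∘ ∈-++⁺ˡ
        where open ℕₚ.≤-Reasoning

  contraction-represents : ∀ {A rows cols M C K} → Represents A rows cols M → IsContraction M C K →
    ∃[ cols′ ] Represents A rows cols′ K
  contraction-represents {A} {rows} {cols} {M} {C} {K} (E⊆ , indep) (C⊆E , ground , indepK)
    with base-exists M C
  ... | B , bB@(B⊆C , _) = cols ∖ B , EK⊆ , λ X → mk⇔ (fwd X) (bwd X)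
    where
    EK⊆ : E K ⊆ cols ∖ B
    EK⊆ {x} x∈ = case to (ground x) x∈ of λ (x∈E , x∉C) → ∈-∖⁺ (E⊆ x∈E) (x∉C ∘ B⊆C)
    fwd : ∀ X → Indep K X → X ⊆ E K × Matchable A rows ((cols ∖ B) ∖ X)
    fwd X iX = go (to (indepK X) iX)
      where
      go : X ⊆ E K × ∃[ B′ ] (IsBase M C B′ × Indep M (X ++ B′)) → X ⊆ E K × Matchable A rows ((cols ∖ B) ∖ X)
      go (X⊆EK , B′ , bB′ , iXB′) = X⊆EK , matchable-⊆ (++-∖ cols X B) (proj₂ (to (indep (X ++ B))
        (exchange-base M bB′ bB (λ {x} x∈ → proj₂ (to (ground x) (X⊆EK x∈))) iXB′)))
    bwd : ∀ X → X ⊆ E K × Matchable A rows ((cols ∖ B) ∖ X) → Indep K X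
    bwd X (X⊆EK , m) = from (indepK X) ((λ {x} → X⊆EK {x}) , B , bB ,
      from (indep (X ++ B)) (sub , matchable-⊆ (∖-++ cols X B) m))
      where
      sub : X ++ B ⊆ E M
      sub = ⊆-++⁻ (λ {x} x∈ → proj₁ (to (ground x) (X⊆EK x∈))) (C⊆E ∘ B⊆C)

  extension-Γ : ∀ {D T M N} → IsExtension N M → IsΓ D T N → IsΓ D T M
  extension-Γ {D} {T} {M} {N} (EM⊆EN , restrict) (T⊆V , EN⊆V , indep) = T⊆V , EN⊆V ∘ EM⊆EN , λ X → mk⇔
    (λ iX → (λ {x} → proj₂ (to (restrict X) iX) {x}) , proj₂ (to (indep X) (proj₁ (to (restrict X) iX))))
    (bwd X)
    where
    bwd : ∀ X → X ⊆ E M × ∃[ R ] IsRouting D X T R → Indep M X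
    bwd X (X⊆E , R) = from (restrict X) (from (indep X) ((λ {x} x∈ → EM⊆EN (X⊆E {x} x∈)) , R) , λ {x} → X⊆E {x})

  minor-gammoid : ∀ {N G} → IsMinor N G → Gammoid G → Gammoid N
  minor-gammoid {N} {G} (C , K , contr , ext) (D , T , isΓ) =
    case represents⇒gammoid {M = K} (step? D) (proj₂ (contraction-represents {M = G} {K = K} (Γ⇒represents {M = G} isΓ) contr)) of
      λ (D′ , T′ , isΓ′ , _) → D′ , T′ , extension-Γ {M = N} {N = K} ext isΓ′

  module _ {M N : Matroid} (iso : M ≅ N) where

    open _≅_ iso renaming (injective to f-injective)

    f-image : ∀ {x} → x ∈ E M → f x ∈ E N
    f-image x∈ = to image (∈-map⁺ f x∈)

    -- Only columns need new names. The renaming `g` extends the inverse of `f` from `E N` to all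
    -- columns, and `h` undoes it.
    iso-represents : ∀ {A rows cols g h} → Represents A rows cols N →
      (∀ {v} → v ∈ cols → h (g v) ≡ v) → (∀ {x} → x ∈ E M → g (f x) ≡ x) →
      Represents (λ i w → A i (h w)) rows (map g cols) M
    iso-represents {A} {rows} {cols} {g} {h} (EN⊆ , indep) hg gf = EM⊆ , λ X → mk⇔ (fwd X) (bwd X)
      where
      f-cols : ∀ {x} → x ∈ E M → f x ∈ cols
      f-cols x∈ = EN⊆ (f-image x∈)
      EM⊆ : E M ⊆ map g cols
      EM⊆ x∈ = subst (_∈ map g cols) (gf x∈) (∈-map⁺ g (f-cols x∈))
      fwd : ∀ X → Indep M X → X ⊆ E M × Matchable (λ i w → A i (h w)) rows (map g cols ∖ X)
      fwd X iX = X⊆E , go (to (indep (map f X)) (to (preserves X X⊆E) iX))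
        where
        X⊆E : X ⊆ E M
        X⊆E = within M iX
        go : map f X ⊆ E N × Matchable A rows (cols ∖ map f X) →
             Matchable (λ i w → A i (h w)) rows (map g cols ∖ X)
        go (_ , σ , m) = g ∘ σ , record
          { inside    = λ i∈ → ∈-∖⁺ (∈-map⁺ g (col i∈)) λ gσi∈X → proj₂ (∈-∖⁻ cols (map f X) (inside m i∈))
              (subst (_∈ map f X) (trans (sym (hg (f-cols (X⊆E gσi∈X))))
                 (trans (cong h (gf (X⊆E gσi∈X))) (hg (col i∈)))) (∈-map⁺ f gσi∈X))
          ; along     = λ {i} i∈ → subst (A i) (sym (hg (col i∈))) (along m i∈)
          ; injective = λ i∈ k∈ eq → injective m i∈ k∈ (trans (sym (hg (col i∈))) (trans (cong h eq) (hg (col k∈))))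
          }
          where
          col : ∀ {i} → i ∈ rows → σ i ∈ cols
          col i∈ = ∖⊆ cols (map f X) (inside m i∈)
      bwd : ∀ X → X ⊆ E M × Matchable (λ i w → A i (h w)) rows (map g cols ∖ X) → Indep M X
      bwd X (X⊆E , σ , m) = from (preserves X (λ {x} → X⊆E {x})) (from (indep (map f X)) (fX⊆ , h ∘ σ , record
        { inside    = inside′
        ; along     = along m
        ; injective = λ i∈ k∈ eq → injective m i∈ k∈ (trans (sym (gh i∈)) (trans (cong g eq) (gh k∈)))
        }))
        where
        fX⊆ : map f X ⊆ E N
        fX⊆ y∈ with ∈-map⁻ f y∈
        ... | x , x∈ , refl = f-image (X⊆E x∈)
        col : ∀ {i} → i ∈ rows → ∃[ v ] (v ∈ cols × σ i ≡ g v)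
        col i∈ = ∈-map⁻ g (∖⊆ (map g cols) X (inside m i∈))
        gh : ∀ {i} → i ∈ rows → g (h (σ i)) ≡ σ i
        gh {i} i∈ with col i∈
        ... | v , v∈ , eq = trans (cong (g ∘ h) eq) (trans (cong g (hg v∈)) (sym eq))
        inside′ : ∀ {i} → i ∈ rows → h (σ i) ∈ cols ∖ map f X
        inside′ {i} i∈ with col i∈
        ... | v , v∈ , eq = ∈-∖⁺ (subst (_∈ cols) (trans (sym (hg v∈)) (cong h (sym eq))) v∈) avoid
          where
          avoid : h (σ i) ∉ map f X
          avoid hσi∈ with ∈-map⁻ f hσi∈
          ... | x , x∈ , hσi≡fx = proj₂ (∈-∖⁻ (map g cols) X (inside m i∈))
            (subst (_∈ X) (trans (sym (gf (X⊆E x∈))) (trans (cong g (sym hσi≡fx)) (gh i∈))) x∈)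

    private
      k : Element → Element
      k = proj₁ (left-inverse f (E M) f-injective)
      kf : ∀ {x} → x ∈ E M → k (f x) ≡ x
      kf = proj₂ (left-inverse f (E M) f-injective)
      preimage : ∀ {y} → y ∈ E N → ∃[ x ] (x ∈ E M × y ≡ f x)
      preimage y∈ = ∈-map⁻ f (from image y∈)
      fk : ∀ {y} → y ∈ E N → f (k y) ≡ y
      fk y∈ with preimage y∈
      ... | x , x∈ , refl = cong f (kf x∈)
      k-image : ∀ {y} → y ∈ E N → k y ∈ E M
      k-image y∈ with preimage y∈
      ... | x , x∈ , refl = subst (_∈ E M) (sym (kf x∈)) x∈

    fresh-injection : ∀ (avoid Z : FinSet) → Σ[ φ ∈ (Element → Element) ]
      ((∀ {z} → z ∈ Z → φ z ∉ avoid) × (∀ {z w} → z ∈ Z → w ∈ Z → φ z ≡ φ w → z ≡ w))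
    fresh-injection avoid [] = (λ z → z) , (λ ()) , λ ()
    fresh-injection avoid (z ∷ Z) with fresh-injection avoid Z | fresh (avoid ++ map (proj₁ (fresh-injection avoid Z)) Z)
    ... | φ , φ∉ , φ-inj | x , x∉ = φ′ , φ′∉ , φ′-inj
      where
      φ′ : Element → Element
      φ′ w with w ≟ z
      ... | yes _ = x
      ... | no  _ = φ w
      old : ∀ {w} → w ∈ z ∷ Z → w ≢ z → w ∈ Z
      old (here w≡z)  w≢z = ⊥-elim (w≢z w≡z)
      old (there w∈Z) _   = w∈Z
      φ′∉ : ∀ {w} → w ∈ z ∷ Z → φ′ w ∉ avoid
      φ′∉ {w} w∈ with w ≟ z
      ... | yes _   = x∉ ∘ ∈-++⁺ˡ
      ... | no  w≢z = φ∉ (old w∈ w≢z)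
      new : ∀ {w} → w ∈ Z → x ≢ φ w
      new w∈ refl = x∉ (∈-++⁺ʳ avoid (∈-map⁺ φ w∈))
      φ′-inj : ∀ {u w} → u ∈ z ∷ Z → w ∈ z ∷ Z → φ′ u ≡ φ′ w → u ≡ w
      φ′-inj {u} {w} u∈ w∈ eq with u ≟ z | w ≟ z
      ... | yes u≡z | yes w≡z = trans u≡z (sym w≡z)
      ... | yes _   | no  w≢z = ⊥-elim (new (old w∈ w≢z) eq)
      ... | no  u≢z | yes _   = ⊥-elim (new (old u∈ u≢z) (sym eq))
      ... | no  u≢z | no  w≢z = φ-inj (old u∈ u≢z) (old w∈ w≢z) eq

    -- Vertices outside `E N` could clash with elements of `E M`, hence they are renamed to fresh
    -- ones.
    iso-gammoid : Gammoid N → Gammoid M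
    iso-gammoid (D , T , isΓ) with fresh-injection (E M) (V D)
    ... | φ , φ∉ , φ-inj = case represents⇒gammoid {M = M} (λ i w → step? D i (h w))
        (iso-represents {h = h} (Γ⇒represents {M = N} isΓ) hg gf) of λ (D′ , T′ , isΓ′ , _) → D′ , T′ , isΓ′
      where
      g : Element → Element
      g v with v ∈? E N
      ... | yes _ = k v
      ... | no  _ = φ v
      g-inj : ∀ {u v} → u ∈ V D → v ∈ V D → g u ≡ g v → u ≡ v
      g-inj {u} {v} u∈ v∈ eq with u ∈? E N | v ∈? E N
      ... | yes u∈N | yes v∈N = trans (sym (fk u∈N)) (trans (cong f eq) (fk v∈N))
      ... | yes u∈N | no  _   = ⊥-elim (φ∉ v∈ (subst (_∈ E M) eq (k-image u∈N)))
      ... | no  _   | yes v∈N = ⊥-elim (φ∉ u∈ (subst (_∈ E M) (sym eq) (k-image v∈N)))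
      ... | no  _   | no  _   = φ-inj u∈ v∈ eq
      h : Element → Element
      h = proj₁ (left-inverse g (V D) g-inj)
      hg : ∀ {v} → v ∈ V D → h (g v) ≡ v
      hg = proj₂ (left-inverse g (V D) g-inj)
      gf : ∀ {x} → x ∈ E M → g (f x) ≡ x
      gf {x} x∈ with f x ∈? E N
      ... | yes _   = kf x∈
      ... | no  fx∉ = ⊥-elim (fx∉ (f-image x∈))

    -- All vertices belong to `E N`, so the inverse of `f` renames every one of them, and the new
    -- vertices make up `E M`.
    iso-strictGammoid : StrictGammoid N → StrictGammoid M
    iso-strictGammoid (D , T , isΓ , V∼E) = case represents⇒gammoid {M = M} (λ i w → step? D i (f w))
        (iso-represents {h = f} (Γ⇒represents {M = N} isΓ) (λ v∈ → fk (to V∼E v∈)) kf) of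
        λ { (D′ , T′ , isΓ′ , refl) → D′ , T′ , isΓ′ , λ {_} → mk⇔ sub sup }
      where
      sub : map k (V D) ⊆ E M
      sub x∈ with ∈-map⁻ k x∈
      ... | v , v∈ , refl = k-image (to V∼E v∈)
      sup : E M ⊆ map k (V D)
      sup x∈ = subst (_∈ map k (V D)) (kf x∈) (∈-map⁺ k (from V∼E (f-image x∈)))

  -- Strict gammoids

  _⊆?_ : ∀ (X Y : FinSet) → Dec (X ⊆ Y)
  X ⊆? Y = map′ (λ all x∈ → All.lookup all x∈) (λ X⊆Y → All.tabulate λ x∈ → X⊆Y x∈) (all? (_∈? Y) X)

  module _ {A : Rel Element 0ℓ} (A? : Decidable A) {rows cols : FinSet} where

    -- If no y ∈ Y ∖ X can be added to X, then Y ∖ X lies in the neighbourhood of a set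
    -- that is tight for X.
    matchable-augment : ∀ {X Y} → Y ⊆ cols → Matchable A rows (cols ∖ X) → Matchable A rows (cols ∖ Y) →
      ∣ X ∣ < ∣ Y ∣ → ∃[ y ] (y ∈ Y × y ∉ X × Matchable A rows (cols ∖ (y ∷ X)))
    matchable-augment {X} {Y} Y⊆ (σ , mX) (ρ , mY) ∣X∣<∣Y∣
      with any? (λ y → (y ∉? X) ×-dec matchable? A? rows (cols ∖ (y ∷ X))) Y
    ... | yes some = find some
    ... | no ¬some = ⊥-elim (blocked⇒tight A? (matches⇒hall A? mX) (Y ∖ X) (∖-mono Y⊆ (λ x∈ → x∈)) blocked
                       λ (K , K⊆ , tight , Z⊆) → ℕₚ.<⇒≱ ∣X∣<∣Y∣ (compare K K⊆ tight Z⊆))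
      where
      blocked : ∀ {z} → z ∈ Y ∖ X → ¬ Matchable A rows ((cols ∖ X) ∖ (z ∷ []))
      blocked {z} z∈ m = case ∈-∖⁻ Y X z∈ of λ (z∈Y , z∉X) →
        ¬some (lose z∈Y (z∉X , matchable-⊆ (∖-++ cols (z ∷ []) X) m))
      compare : ∀ K → K ⊆ rows → ∣ nbr A? K (cols ∖ X) ∣ ≤ ∣ K ∣ → Y ∖ X ⊆ nbr A? K (cols ∖ X) → ∣ Y ∣ ≤ ∣ X ∣
      compare K K⊆ tight Z⊆P = begin
        ∣ Y ∣                  ≡⟨ card-split Y X ⟩
        ∣ Y ∩ X ∣ + ∣ Y ∖ X ∣  ≤⟨ ℕₚ.+-mono-≤ (card-mono swap) Y∖X≤X∖Y ⟩
        ∣ X ∩ Y ∣ + ∣ X ∖ Y ∣  ≡⟨ card-split X Y ⟨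
        ∣ X ∣                  ∎
        where
        open ℕₚ.≤-Reasoning
        P Q : FinSet
        P = nbr A? K (cols ∖ X)
        Q = nbr A? K (cols ∖ Y)
        swap : Y ∩ X ⊆ X ∩ Y
        swap x∈ = case ∈-∩⁻ Y X x∈ of λ (x∈Y , x∈X) → ∈-∩⁺ x∈X x∈Y
        Q∩X⊆ : Q ∩ X ⊆ X ∖ Y
        Q∩X⊆ v∈ = case ∈-∩⁻ Q X v∈ of λ (v∈Q , v∈X) →
          ∈-∖⁺ v∈X (proj₂ (∈-∖⁻ cols Y (proj₁ (∈-nbr⁻ A? K (cols ∖ Y) v∈Q))))
        Q∖X⊆ : Q ∖ X ⊆ P ∖ Y
        Q∖X⊆ v∈ = case ∈-∖⁻ Q X v∈ of λ (v∈Q , v∉X) → case ∈-nbr⁻ A? K (cols ∖ Y) v∈Q of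
          λ (v∈∖ , k , k∈ , a) → case ∈-∖⁻ cols Y v∈∖ of
          λ (v∈cols , v∉Y) → ∈-∖⁺ (∈-nbr⁺ A? k∈ (∈-∖⁺ v∈cols v∉X) a) v∉Y
        -- `P` and `Q` are the neighbourhoods of `K` off `X` and off `Y`. `P` has no more elements
        -- than `K`, hence than `Q`; it contains `Y ∖ X`, while `Q` goes beyond `P ∖ Y` by elements
        -- of `X ∖ Y` only.
        Y∖X≤X∖Y : ∣ Y ∖ X ∣ ≤ ∣ X ∖ Y ∣
        Y∖X≤X∖Y = ℕₚ.+-cancelʳ-≤ (∣ P ∖ Y ∣) _ _ (begin
          ∣ Y ∖ X ∣ + ∣ P ∖ Y ∣   ≤⟨ ℕₚ.+-monoˡ-≤ _ (card-mono λ y∈ → ∈-∩⁺ (Z⊆P y∈) (∖⊆ Y X y∈)) ⟩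
          ∣ P ∩ Y ∣ + ∣ P ∖ Y ∣   ≡⟨ card-split P Y ⟨
          ∣ P ∣                   ≤⟨ tight ⟩
          ∣ K ∣                   ≤⟨ matches⇒hall A? mY K K⊆ ⟩
          ∣ Q ∣                   ≡⟨ card-split Q X ⟩
          ∣ Q ∩ X ∣ + ∣ Q ∖ X ∣   ≤⟨ ℕₚ.+-mono-≤ (card-mono Q∩X⊆) (card-mono Q∖X⊆) ⟩
          ∣ X ∖ Y ∣ + ∣ P ∖ Y ∣   ∎)

    strictMatroid : Matchable A rows cols → Matroid
    strictMatroid m = record
      { E          = cols
      ; Indep      = λ X → X ⊆ cols × Matchable A rows (cols ∖ X)
      ; indep?     = λ X → (X ⊆? cols) ×-dec matchable? A? rows (cols ∖ X)
      ; within     = λ iX {x} → proj₁ iX {x}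
      ; empty      = (λ ()) , matchable-⊆ (λ v∈ → ∈-∖⁺ v∈ λ ()) m
      ; hereditary = λ X⊆Y iY → (λ {x} x∈ → proj₁ iY {x} (X⊆Y x∈)) , matchable-⊆ (∖-mono (λ v∈ → v∈) X⊆Y) (proj₂ iY)
      ; augment    = augment′
      }
      where
      augment′ : ∀ {X Y} → X ⊆ cols × Matchable A rows (cols ∖ X) → Y ⊆ cols × Matchable A rows (cols ∖ Y) →
        ∣ X ∣ < ∣ Y ∣ → ∃[ y ] (y ∈ Y × y ∉ X × (y ∷ X ⊆ cols × Matchable A rows (cols ∖ (y ∷ X))))
      augment′ (X⊆ , mX) (Y⊆ , mY) lt = case matchable-augment Y⊆ mX mY lt of
        λ (y , y∈Y , y∉X , m′) → y , y∈Y , y∉X , (λ {_} → ∷-⊆ (Y⊆ y∈Y) X⊆) , m′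

  -- By `targets`, every column outside the ground set is also a row and can thus be eliminated.
  -- Moreover the targets form an independent set, so their number is at most the rank.
  record NormalRep (M : Matroid) : Set₁ where
    field
      Adj        : Rel Element 0ℓ
      Adj?       : Decidable Adj
      rows cols  : FinSet
      reflexive  : Reflexive Adj rows cols
      represents : Represents Adj rows cols M
      targets    : cols ∖ rows ⊆ E M

    open Reflexive reflexive public

    inner : FinSet
    inner = cols ∖ E M

    indep⁺ : ∀ {X} → X ⊆ E M → Matchable Adj rows (cols ∖ X) → Indep M X
    indep⁺ {X} X⊆E m = from (proj₂ represents X) ((λ {x} → X⊆E {x}) , m)

    indep⁻ : ∀ {X} → Indep M X → Matchable Adj rows (cols ∖ X)
    indep⁻ {X} iX = proj₂ (to (proj₂ represents X) iX)

  reflexive-matches : ∀ {A : Rel Element 0ℓ} {rows cols} → Reflexive A rows cols → Matchable A rows (cols ∖ (cols ∖ rows))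
  reflexive-matches {rows = rows} {cols} rf = (λ i → i) , record
    { inside    = λ i∈ → ∈-∖⁺ (rows⊆cols i∈) λ i∈∖ → proj₂ (∈-∖⁻ cols rows i∈∖) i∈
    ; along     = diagonal
    ; injective = λ _ _ eq → eq
    }
    where open Reflexive rf

  -- Matching the rows off a base of M makes all columns outside E that are no rows
  -- superfluous: together with the base they exceed the rank of M.
  normalize : ∀ {A rows cols M} → Decidable A → Represents A rows cols M → NormalRep M
  normalize {A₀} {rows₀} {cols} {M} A₀? rep₀@(E⊆ , _) with base-exists M (E M)
  ... | B , bB@(B⊆E , iB , _) with to (proj₂ rep₀ B) iB
  ...   | _ , σ₀ , m₀ = record
    { Adj        = A′
    ; Adj?       = A′?
    ; rows       = rows′
    ; cols       = cols ∖ Q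
    ; reflexive  = record { rows⊆cols = λ i∈ → ∈-∖⁺ (rows⊆cols i∈) (rows∉Q i∈) ; diagonal = diagonal }
    ; represents = (λ x∈ → ∈-∖⁺ (E⊆ x∈) λ x∈Q → proj₂ (∈-∖⁻ W (E M) x∈Q) x∈) , λ X → mk⇔ (fwd X) (bwd X)
    ; targets    = targets
    }
    where
    open Relabel (matches-⊆ {cols′ = cols} (λ i∈ → i∈) (∖⊆ cols B) m₀)
    open Reflexive relabel-reflexive
    A′? : Decidable A′
    A′? w v = A₀? (τ w) v
    rep : Represents A′ rows′ cols M
    rep = relabel-represents {M} rep₀
    W Q : FinSet
    W = cols ∖ rows′
    Q = W ∖ E M
    rows∉Q : ∀ {i} → i ∈ rows′ → i ∉ Q
    rows∉Q i∈ i∈Q = proj₂ (∈-∖⁻ cols rows′ (∖⊆ W (E M) i∈Q)) i∈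
    B⊆W : B ⊆ W
    B⊆W b∈ = ∈-∖⁺ (E⊆ (B⊆E b∈)) λ b∈rows → case ∈-map⁻ σ₀ b∈rows of
      λ { (i , i∈ , refl) → proj₂ (∈-∖⁻ cols B (inside m₀ i∈)) b∈ }
    N : Matroid
    N = strictMatroid A′? (matchable-⊆ (∖⊆ cols W) (reflexive-matches relabel-reflexive))
    iW : Indep N W
    iW = ∖⊆ cols rows′ , reflexive-matches relabel-reflexive
    targets : (cols ∖ Q) ∖ rows′ ⊆ E M
    targets {v} v∈ with v ∈? E M | ∈-∖⁻ (cols ∖ Q) rows′ v∈
    ... | yes v∈E | _ = v∈E
    ... | no  v∉E | v∈∖ , v∉rows = case ∈-∖⁻ cols Q v∈∖ of
      λ (v∈cols , v∉Q) → ⊥-elim (v∉Q (∈-∖⁺ (∈-∖⁺ v∈cols v∉rows) v∉E))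
    -- Grow `X` inside `X ++ W` to a set of size at least that of `W`, which is at least the size of
    -- `B` plus that of `Q`. At most as many elements as `B` has lie in `E M`, so the others exhaust
    -- `Q`.
    absorb : ∀ {X} → X ⊆ E M → Indep N X → Indep N (X ++ Q)
    absorb {X} X⊆E iX = case extend N {X} {W} iX iW of
      λ (Y , X⊆Y , Y⊆ , iY , ∣W∣≤∣Y∣) → hereditary N {X ++ Q} {Y} (⊆-++⁻ X⊆Y (Q⊆ Y Y⊆ iY ∣W∣≤∣Y∣)) iY
      where
      Q⊆ : ∀ Y → Y ⊆ X ++ W → Indep N Y → ∣ W ∣ ≤ ∣ Y ∣ → Q ⊆ Y
      Q⊆ Y Y⊆ iY ∣W∣≤∣Y∣ q∈ = ∖⊆ Y (E M) (⊆-card Y∖E⊆Q ∣Q∣≤ q∈)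
        where
        Y∖E⊆Q : Y ∖ E M ⊆ Q
        Y∖E⊆Q v∈ = case ∈-∖⁻ Y (E M) v∈ of λ (v∈Y , v∉E) → case ∈-++⁻ X (Y⊆ v∈Y) of λ where
          (inj₁ v∈X) → ⊥-elim (v∉E (X⊆E v∈X))
          (inj₂ v∈W) → ∈-∖⁺ v∈W v∉E
        iY∩E : Indep M (Y ∩ E M)
        iY∩E = from (proj₂ rep (Y ∩ E M)) ((λ {x} x∈ → proj₂ (∈-∩⁻ {x} Y (E M) x∈)) ,
          matchable-⊆ (∖-mono (λ v∈ → v∈) λ x∈ → proj₁ (∈-∩⁻ Y (E M) x∈)) (proj₂ iY))
        ∣Q∣≤ : ∣ Q ∣ ≤ ∣ Y ∖ E M ∣
        ∣Q∣≤ = ℕₚ.+-cancelˡ-≤ (∣ B ∣) _ _ (begin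
          ∣ B ∣ + ∣ Q ∣                ≤⟨ ℕₚ.+-monoˡ-≤ _ (card-mono λ b∈ → ∈-∩⁺ (B⊆W b∈) (B⊆E b∈)) ⟩
          ∣ W ∩ E M ∣ + ∣ Q ∣          ≡⟨ card-split W (E M) ⟨
          ∣ W ∣                        ≤⟨ ∣W∣≤∣Y∣ ⟩
          ∣ Y ∣                        ≡⟨ card-split Y (E M) ⟩
          ∣ Y ∩ E M ∣ + ∣ Y ∖ E M ∣    ≤⟨ ℕₚ.+-monoˡ-≤ _ (base-maximum M bB (λ x∈ → proj₂ (∈-∩⁻ Y (E M) x∈)) iY∩E) ⟩
          ∣ B ∣ + ∣ Y ∖ E M ∣          ∎)
          where open ℕₚ.≤-Reasoning
    fwd : ∀ X → Indep M X → X ⊆ E M × Matchable A′ rows′ ((cols ∖ Q) ∖ X)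
    fwd X iX = X⊆E , matchable-⊆ (++-∖ cols X Q) (proj₂ (absorb X⊆E
        ((λ {x} x∈ → E⊆ (X⊆E {x} x∈)) , proj₂ (to (proj₂ rep X) iX))))
      where
      X⊆E : X ⊆ E M
      X⊆E = within M iX
    bwd : ∀ X → X ⊆ E M × Matchable A′ rows′ ((cols ∖ Q) ∖ X) → Indep M X
    bwd X (X⊆E , m) = from (proj₂ rep X) ((λ {x} → X⊆E {x}) ,
      matchable-⊆ (∖-mono (∖⊆ cols Q) (λ x∈ → x∈)) m)

  fresh-set : ∀ (avoid : FinSet) k → ∃[ F ] (∣ F ∣ ≡ k × (∀ {x} → x ∈ avoid → x ∉ F))
  fresh-set avoid zero = [] , refl , λ _ ()
  fresh-set avoid (suc k) with fresh-set avoid k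
  ... | F , ∣F∣≡k , disj with fresh (avoid ++ F)
  ...   | x , x∉ = x ∷ F , trans (card-∷ (x∉ ∘ ∈-++⁺ʳ avoid)) (cong suc ∣F∣≡k) ,
            λ { y∈ (here refl) → x∉ (∈-++⁺ˡ y∈) ; y∈ (there y∈F) → disj y∈ y∈F }

  strict-extension : ∀ {M} (R : NormalRep M) k → ∣ NormalRep.cols R ∣ ≤ k →
    ∃[ N ] (IsExtension N M × ∣ E N ∣ ≡ k × StrictGammoid N)
  strict-extension {M} R k bound with fresh-set (NormalRep.cols R) (k ∸ ∣ NormalRep.cols R ∣)
  ... | F , ∣F∣≡ , cols∩F = N , ((λ x∈ → cols⊆ (proj₁ represents x∈)) , λ X → mk⇔ (fwd X) (bwd X)) ,
      trans (card-++ cols∩F) (trans (cong (∣ cols ∣ +_) ∣F∣≡) (ℕₚ.m+[n∸m]≡n bound)) , strict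
    where
    open NormalRep R
    cols⊆ : cols ⊆ cols ++ F
    cols⊆ = ∈-++⁺ˡ
    -- The padding `F` lies in no set of the family. No row can be matched into it, so its elements
    -- are coloops of `N` and do not affect the independence of subsets of `E M`.
    A⁺ : Rel Element 0ℓ
    A⁺ i v = Adj i v × v ∈ cols
    A⁺? : Decidable A⁺
    A⁺? i v = Adj? i v ×-dec (v ∈? cols)
    pad : ∀ {X} → Matchable Adj rows (cols ∖ X) → Matchable A⁺ rows ((cols ++ F) ∖ X)
    pad {X} (σ , m) = σ , record
      { inside    = λ i∈ → ∖-mono cols⊆ (λ x∈ → x∈) (inside m i∈)
      ; along     = λ i∈ → along m i∈ , ∖⊆ cols X (inside m i∈)
      ; injective = injective m
      }
    unpad : ∀ {X} → Matchable A⁺ rows ((cols ++ F) ∖ X) → Matchable Adj rows (cols ∖ X)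
    unpad {X} (σ , m) = σ , record
      { inside    = λ i∈ → ∈-∖⁺ (proj₂ (along m i∈)) (proj₂ (∈-∖⁻ (cols ++ F) X (inside m i∈)))
      ; along     = λ i∈ → proj₁ (along m i∈)
      ; injective = injective m
      }
    N : Matroid
    N = strictMatroid A⁺? (matchable-⊆ (∖⊆ (cols ++ F) []) (pad (indep⁻ (empty M))))
    fwd : ∀ X → Indep M X → Indep N X × X ⊆ E M
    fwd X iX = ((λ {x} x∈ → cols⊆ (proj₁ represents (within M iX {x} x∈))) , pad (indep⁻ iX)) , λ {x} → within M iX {x}
    bwd : ∀ X → Indep N X × X ⊆ E M → Indep M X
    bwd X ((_ , m) , X⊆E) = indep⁺ X⊆E (unpad m)
    strict : StrictGammoid N
    strict = case represents⇒gammoid {M = N} A⁺? ((λ v∈ → v∈) , λ X → mk⇔ (λ i → i) (λ i → i)) of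
      λ { (D , T , isΓ , refl) → D , T , isΓ , λ {_} → mk⇔ (λ v∈ → v∈) (λ v∈ → v∈) }

  -- Linear algebra over ℤ

  ∑ : FinSet → (Element → ℤ) → ℤ
  ∑ []       f = 0ℤ
  ∑ (x ∷ xs) f = f x ℤ.+ ∑ xs f

  ∑-cong : ∀ {f g} xs → (∀ {x} → x ∈ xs → f x ≡ g x) → ∑ xs f ≡ ∑ xs g
  ∑-cong []       _   = refl
  ∑-cong (x ∷ xs) f≗g = cong₂ ℤ._+_ (f≗g (here refl)) (∑-cong xs (f≗g ∘ there))

  ∑-zero : ∀ {f} xs → (∀ {x} → x ∈ xs → f x ≡ 0ℤ) → ∑ xs f ≡ 0ℤ
  ∑-zero []       _   = refl
  ∑-zero (x ∷ xs) f≗0 = cong₂ ℤ._+_ (f≗0 (here refl)) (∑-zero xs (f≗0 ∘ there))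

  ∑-+ : ∀ f g xs → ∑ xs (λ x → f x ℤ.+ g x) ≡ ∑ xs f ℤ.+ ∑ xs g
  ∑-+ f g []       = refl
  ∑-+ f g (x ∷ xs) = trans (cong (ℤ._+_ (f x ℤ.+ g x)) (∑-+ f g xs)) (lemma (f x) (g x) (∑ xs f) (∑ xs g))
    where
    lemma : ∀ a b c d → a ℤ.+ b ℤ.+ (c ℤ.+ d) ≡ a ℤ.+ c ℤ.+ (b ℤ.+ d)
    lemma = solve-∀

  ∑-* : ∀ c f xs → ∑ xs (λ x → c ℤ.* f x) ≡ c ℤ.* ∑ xs f
  ∑-* c f []       = sym (ℤₚ.*-zeroʳ c)
  ∑-* c f (x ∷ xs) = trans (cong (ℤ._+_ (c ℤ.* f x)) (∑-* c f xs)) (sym (ℤₚ.*-distribˡ-+ c (f x) (∑ xs f)))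

  ∑-linear : ∀ c d f g xs → ∑ xs (λ x → c ℤ.* f x ℤ.+ d ℤ.* g x) ≡ c ℤ.* ∑ xs f ℤ.+ d ℤ.* ∑ xs g
  ∑-linear c d f g xs = trans (∑-+ _ _ xs) (cong₂ ℤ._+_ (∑-* c f xs) (∑-* d g xs))

  ∑-swap : ∀ (f : Element → Element → ℤ) xs ys →
           ∑ xs (λ x → ∑ ys (f x)) ≡ ∑ ys (λ y → ∑ xs (λ x → f x y))
  ∑-swap f []       ys = sym (∑-zero ys λ _ → refl)
  ∑-swap f (x ∷ xs) ys = trans (cong (ℤ._+_ (∑ ys (f x))) (∑-swap f xs ys)) (sym (∑-+ (f x) _ ys))

  ∑-single : ∀ {f z xs} → Unique xs → z ∈ xs → (∀ {x} → x ∈ xs → x ≢ z → f x ≡ 0ℤ) → ∑ xs f ≡ f z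
  ∑-single {f} {z} {x ∷ xs} (x≢ ∷ _) (here refl) zero′ =
    trans (cong (ℤ._+_ (f z)) (∑-zero xs λ y∈ → zero′ (there y∈) λ y≡z → All.lookup x≢ y∈ (sym y≡z)))
          (ℤₚ.+-identityʳ (f z))
  ∑-single {f} {z} {x ∷ xs} (x≢ ∷ xs!) (there z∈) zero′ =
    trans (cong₂ ℤ._+_ (zero′ (here refl) (All.lookup x≢ z∈)) (∑-single xs! z∈ (zero′ ∘ there)))
          (ℤₚ.+-identityˡ (f z))

  δ : Element → Element → ℤ
  δ x y with x ≟ y
  ... | yes _ = 1ℤ
  ... | no  _ = 0ℤ

  δ-≡ : ∀ x → δ x x ≡ 1ℤ
  δ-≡ x with x ≟ x
  ... | yes _   = refl
  ... | no  x≢x = ⊥-elim (x≢x refl)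

  δ-≢ : ∀ {x y} → x ≢ y → δ x y ≡ 0ℤ
  δ-≢ {x} {y} x≢y with x ≟ y
  ... | yes x≡y = ⊥-elim (x≢y x≡y)
  ... | no  _   = refl

  ∑-δ : ∀ {xs} z (f : Element → ℤ) → Unique xs → z ∈ xs → ∑ xs (λ x → δ z x ℤ.* f x) ≡ f z
  ∑-δ z f xs! z∈ = trans
    (∑-single xs! z∈ λ {x} _ x≢z → cong (ℤ._* f x) (δ-≢ λ z≡x → x≢z (sym z≡x)))
    (trans (cong (ℤ._* f z) (δ-≡ z)) (ℤₚ.*-identityˡ (f z)))

  ∑-δ-∉ : ∀ {xs} z (f : Element → ℤ) → z ∉ xs → ∑ xs (λ x → δ z x ℤ.* f x) ≡ 0ℤ
  ∑-δ-∉ {xs} z f z∉ = ∑-zero xs λ {x} x∈ → cong (ℤ._* f x) (δ-≢ λ { refl → z∉ x∈ })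

  -- The lists may be ordered differently. Expanding `f` by `δ` and exchanging the two sums replaces
  -- an argument about permutations.
  ∑-support : ∀ {xs ys} (f : Element → ℤ) → Unique xs → Unique ys → xs ⊆ ys → (∀ {y} → y ∉ xs → f y ≡ 0ℤ) →
              ∑ ys f ≡ ∑ xs f
  ∑-support {xs} {ys} f xs! ys! xs⊆ys zero′ = begin
    ∑ ys f                                     ≡⟨ ∑-cong ys spread ⟩
    ∑ ys (λ y → ∑ xs (λ x → δ y x ℤ.* f x))    ≡⟨ ∑-swap (λ y x → δ y x ℤ.* f x) ys xs ⟩
    ∑ xs (λ x → ∑ ys (λ y → δ y x ℤ.* f x))    ≡⟨ ∑-cong xs collect ⟩
    ∑ xs f                                     ∎
    where
    open ≡-Reasoning
    spread : ∀ {y} → y ∈ ys → f y ≡ ∑ xs (λ x → δ y x ℤ.* f x)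
    spread {y} _ with y ∈? xs
    ... | yes y∈ = sym (∑-δ y f xs! y∈)
    ... | no  y∉ = trans (zero′ y∉) (sym (∑-δ-∉ y f y∉))
    collect : ∀ {x} → x ∈ xs → ∑ ys (λ y → δ y x ℤ.* f x) ≡ f x
    collect {x} x∈ = trans (∑-single ys! (xs⊆ys x∈) λ _ y≢x → cong (ℤ._* f x) (δ-≢ y≢x))
      (trans (cong (ℤ._* f x) (δ-≡ x)) (ℤₚ.*-identityˡ (f x)))

  ∑-combination : ∀ xs ys (γ : Element → ℤ) (f : Element → Element → ℤ) (w : Element → ℤ) →
    ∑ ys (λ y → ∑ xs (λ x → γ x ℤ.* f x y) ℤ.* w y) ≡ ∑ xs (λ x → γ x ℤ.* ∑ ys (λ y → f x y ℤ.* w y))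
  ∑-combination xs ys γ f w = begin
    ∑ ys (λ y → ∑ xs (λ x → γ x ℤ.* f x y) ℤ.* w y)
      ≡⟨ ∑-cong ys (λ {y} _ → trans (ℤₚ.*-comm _ (w y)) (sym (∑-* (w y) (λ x → γ x ℤ.* f x y) xs))) ⟩
    ∑ ys (λ y → ∑ xs (λ x → w y ℤ.* (γ x ℤ.* f x y)))
      ≡⟨ ∑-swap (λ y x → w y ℤ.* (γ x ℤ.* f x y)) ys xs ⟩
    ∑ xs (λ x → ∑ ys (λ y → w y ℤ.* (γ x ℤ.* f x y)))
      ≡⟨ ∑-cong xs (λ {x} _ → trans (∑-cong ys λ {y} _ → lemma (w y) (γ x) (f x y))
                                    (∑-* (γ x) (λ y → f x y ℤ.* w y) ys)) ⟩
    ∑ xs (λ x → γ x ℤ.* ∑ ys (λ y → f x y ℤ.* w y)) ∎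
    where
    open ≡-Reasoning
    lemma : ∀ a b c → a ℤ.* (b ℤ.* c) ≡ b ℤ.* (c ℤ.* a)
    lemma = solve-∀

  *-≢0 : ∀ {a b} → a ≢ 0ℤ → b ≢ 0ℤ → a ℤ.* b ≢ 0ℤ
  *-≢0 {a} {b} a≢0 b≢0 ab≡0 = [ a≢0 , b≢0 ]′ (ℤₚ.i*j≡0⇒i≡0∨j≡0 a ab≡0)

  opaque
    unfolding _∖_
    ∖-! : ∀ {X} Y → Unique X → Unique (X ∖ Y)
    ∖-! Y = Uniqueₚ.filter⁺ (_∉? Y)

  record Solution (eqs : List (Element → ℤ)) (unknowns : FinSet) : Set where
    field
      value    : Element → ℤ
      solves   : ∀ {eq} → eq ∈ eqs → ∑ unknowns (λ v → eq v ℤ.* value v) ≡ 0ℤ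
      support  : ∀ {v} → v ∉ unknowns → value v ≡ 0ℤ
      support∋ : Element
      nonzero  : value support∋ ≢ 0ℤ

    support∋∈ : support∋ ∈ unknowns
    support∋∈ with support∋ ∈? unknowns
    ... | yes s∈ = s∈
    ... | no  s∉ = ⊥-elim (nonzero (support s∉))

  -- Gaussian elimination without division. An equation with zero coefficients is dropped; otherwise
  -- a pivot removes one equation and one unknown. The bound `k` is the recursion measure, as the
  -- remaining equations are altered.
  underdetermined′ : ∀ k eqs unknowns → Unique unknowns → length eqs < length unknowns → length eqs ≤ k →
                     Solution eqs unknowns
  underdetermined′ _ [] (v ∷ vs) _ _ _ = record
    { value    = δ v
    ; solves   = λ ()
    ; support  = λ u∉ → δ-≢ λ { refl → u∉ (here refl) }
    ; support∋ = v
    ; nonzero  = λ δ≡0 → case trans (sym (δ-≡ v)) δ≡0 of λ ()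
    }
  underdetermined′ (suc k) (eq ∷ eqs) vs vs! lt (s≤s len) with any? (λ v → ¬? (eq v ℤₚ.≟ 0ℤ)) vs
  ... | no ¬some = record
    { value    = value
    ; solves   = λ { (here refl) → ∑-zero vs λ {v} v∈ → cong (ℤ._* value v)
                       (decidable-stable (eq v ℤₚ.≟ 0ℤ) λ eqv≢0 → ¬some (lose v∈ eqv≢0))
                   ; (there e∈)  → solves e∈ }
    ; support  = support
    ; support∋ = support∋
    ; nonzero  = nonzero
    }
    where open Solution (underdetermined′ k eqs vs vs! (ℕₚ.<⇒≤ lt) len)
  ... | yes some with find some
  ...   | v , v∈ , a≢0 = record
    { value    = u
    ; solves   = λ { (here refl) → trans (reduce eq) (lemma₁ a S)
                   ; (there {xs = es} e∈) → eliminated e∈ }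
    ; support  = λ {w} w∉ → trans (cong₂ (λ p q → a ℤ.* p ℤ.- q ℤ.* S)
                   (support λ w∈ → w∉ (∖⊆ vs (v ∷ []) w∈)) (δ-≢ λ { refl → w∉ v∈ })) (lemma₂ a S)
    ; support∋ = support∋
    ; nonzero  = λ u≡0 → *-≢0 a≢0 nonzero (trans (sym u-old) u≡0)
    }
    where
    a : ℤ
    a = eq v
    vs′ : FinSet
    vs′ = vs ∖ (v ∷ [])
    vs′! : Unique vs′
    vs′! = ∖-! (v ∷ []) vs!
    elim : (Element → ℤ) → Element → ℤ
    elim e w = a ℤ.* e w ℤ.- e v ℤ.* eq w
    lt′ : length (map elim eqs) < length vs′
    lt′ = ℕₚ.≤-pred (subst₂ _≤_ (cong (suc ∘ suc) (sym (length-map elim eqs)))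
      (cong suc (card-unique vs′!)) (ℕₚ.≤-trans lt (subst (_≤ suc ∣ vs′ ∣) (card-unique vs!) (card-∖-≤ v vs))))
    open Solution (underdetermined′ k (map elim eqs) vs′ vs′! lt′ (subst (_≤ k) (sym (length-map elim eqs)) len))
    S : ℤ
    S = ∑ vs′ (λ w → eq w ℤ.* value w)
    -- The solution of the smaller system is multiplied by the pivot `a`, and the pivot unknown,
    -- where `value` is zero, receives the value of minus `S`: this solves `eq` over the integers.
    u : Element → ℤ
    u w = a ℤ.* value w ℤ.- δ v w ℤ.* S
    lemma₁ : ∀ a S → a ℤ.* S ℤ.- a ℤ.* S ≡ 0ℤ
    lemma₁ = solve-∀
    lemma₂ : ∀ a S → a ℤ.* 0ℤ ℤ.- 0ℤ ℤ.* S ≡ 0ℤ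
    lemma₂ = solve-∀
    lemma₃ : ∀ e a p d S → e ℤ.* (a ℤ.* p ℤ.- d ℤ.* S) ≡ a ℤ.* (e ℤ.* p) ℤ.+ (ℤ.- S) ℤ.* (d ℤ.* e)
    lemma₃ = solve-∀
    lemma₄ : ∀ a P S e → a ℤ.* P ℤ.+ (ℤ.- S) ℤ.* e ≡ a ℤ.* P ℤ.- e ℤ.* S
    lemma₄ = solve-∀
    lemma₅ : ∀ a e f g p → (a ℤ.* e ℤ.- f ℤ.* g) ℤ.* p ≡ a ℤ.* (e ℤ.* p) ℤ.+ (ℤ.- f) ℤ.* (g ℤ.* p)
    lemma₅ = solve-∀
    lemma₆ : ∀ a P f S → a ℤ.* P ℤ.- f ℤ.* S ≡ a ℤ.* P ℤ.+ (ℤ.- f) ℤ.* S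
    lemma₆ = solve-∀
    u-old : u support∋ ≡ a ℤ.* value support∋
    u-old = trans (cong (λ d → a ℤ.* value support∋ ℤ.- d ℤ.* S)
        (δ-≢ λ v≡ → proj₂ (∈-∖⁻ vs (v ∷ []) support∋∈) (here (sym v≡))))
      (lemma₇ (a ℤ.* value support∋) S)
      where
      lemma₇ : ∀ p S → p ℤ.- 0ℤ ℤ.* S ≡ p
      lemma₇ = solve-∀
    reduce : ∀ (e : Element → ℤ) → ∑ vs (λ w → e w ℤ.* u w) ≡ a ℤ.* ∑ vs′ (λ w → e w ℤ.* value w) ℤ.- e v ℤ.* S
    reduce e = begin
      ∑ vs (λ w → e w ℤ.* u w)
        ≡⟨ ∑-cong vs (λ {w} _ → lemma₃ (e w) a (value w) (δ v w) S) ⟩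
      ∑ vs (λ w → a ℤ.* (e w ℤ.* value w) ℤ.+ (ℤ.- S) ℤ.* (δ v w ℤ.* e w))
        ≡⟨ ∑-linear a (ℤ.- S) (λ w → e w ℤ.* value w) (λ w → δ v w ℤ.* e w) vs ⟩
      a ℤ.* ∑ vs (λ w → e w ℤ.* value w) ℤ.+ (ℤ.- S) ℤ.* ∑ vs (λ w → δ v w ℤ.* e w)
        ≡⟨ cong₂ (λ p q → a ℤ.* p ℤ.+ (ℤ.- S) ℤ.* q)
             (∑-support (λ w → e w ℤ.* value w) vs′! vs! (∖⊆ vs (v ∷ []))
               λ {w} w∉ → trans (cong (ℤ._*_ (e w)) (support w∉)) (ℤₚ.*-zeroʳ (e w)))
             (∑-δ v e vs! v∈) ⟩
      a ℤ.* ∑ vs′ (λ w → e w ℤ.* value w) ℤ.+ (ℤ.- S) ℤ.* e v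
        ≡⟨ lemma₄ a _ S (e v) ⟩
      a ℤ.* ∑ vs′ (λ w → e w ℤ.* value w) ℤ.- e v ℤ.* S ∎
      where open ≡-Reasoning
    eliminated : ∀ {e} → e ∈ eqs → ∑ vs (λ w → e w ℤ.* u w) ≡ 0ℤ
    eliminated {e} e∈ = begin
      ∑ vs (λ w → e w ℤ.* u w)
        ≡⟨ reduce e ⟩
      a ℤ.* ∑ vs′ (λ w → e w ℤ.* value w) ℤ.- e v ℤ.* S
        ≡⟨ lemma₆ a _ (e v) S ⟩
      a ℤ.* ∑ vs′ (λ w → e w ℤ.* value w) ℤ.+ (ℤ.- e v) ℤ.* S
        ≡⟨ ∑-linear a (ℤ.- e v) (λ w → e w ℤ.* value w) (λ w → eq w ℤ.* value w) vs′ ⟨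
      ∑ vs′ (λ w → a ℤ.* (e w ℤ.* value w) ℤ.+ (ℤ.- e v) ℤ.* (eq w ℤ.* value w))
        ≡⟨ ∑-cong vs′ (λ {w} _ → lemma₅ a (e w) (e v) (eq w) (value w)) ⟨
      ∑ vs′ (λ w → elim e w ℤ.* value w)
        ≡⟨ solves (∈-map⁺ elim e∈) ⟩
      0ℤ ∎
      where open ≡-Reasoning

  underdetermined : ∀ eqs unknowns → Unique unknowns → length eqs < length unknowns → Solution eqs unknowns
  underdetermined eqs vs vs! lt = underdetermined′ (length eqs) eqs vs vs! lt ℕₚ.≤-refl

  -- Generic weights

  Entry : Set
  Entry = Bool × Element × Element

  _≟ᵉ_ : (d e : Entry) → Dec (d ≡ e)
  _≟ᵉ_ = Productₚ.≡-dec Boolₚ._≟_ (Productₚ.≡-dec _≟_ _≟_)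

  Weight : Set
  Weight = Entry → ℤ

  _[_≔_] : Weight → Entry → ℤ → Weight
  (W [ e ≔ z ]) d with d ≟ᵉ e
  ... | yes _ = z
  ... | no  _ = W d

  update-same : ∀ W {d e} z → d ≡ e → (W [ e ≔ z ]) d ≡ z
  update-same W {d} {e} z d≡e with d ≟ᵉ e
  ... | yes _  = refl
  ... | no d≢e = ⊥-elim (d≢e d≡e)

  update-other : ∀ W {d e} z → d ≢ e → (W [ e ≔ z ]) d ≡ W d
  update-other W {d} {e} z d≢e with d ≟ᵉ e
  ... | yes d≡e = ⊥-elim (d≢e d≡e)
  ... | no _    = refl

  fresh-ℤ : ∀ (zs : List ℤ) → ∃[ z ] z ∉ zs
  fresh-ℤ zs = ℤ.+ suc (sum (map ℤ.∣_∣ zs)) , λ z∈ → ℕₚ.<-irrefl refl (bound zs z∈)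
    where
    bound : ∀ zs {z} → z ∈ zs → ℤ.∣ z ∣ ≤ sum (map ℤ.∣_∣ zs)
    bound (z ∷ zs) (here refl) = ℕₚ.m≤m+n (ℤ.∣ z ∣) _
    bound (z ∷ zs) (there z∈)  = ℕₚ.≤-trans (bound zs z∈) (ℕₚ.m≤n+m _ (ℤ.∣ z ∣))

  -- The part of Zariski openness that survives without polynomials: on a line parallel
  -- to a coordinate axis, P fails at one value at most, or everywhere.
  LineOpen : (Weight → Set) → Set
  LineOpen P = ∀ {W e z₁ z₂} → z₁ ≢ z₂ → P W → ¬ P (W [ e ≔ z₁ ]) → ¬ ¬ P (W [ e ≔ z₂ ])

  Pointwise : (Weight → Set) → Set
  Pointwise P = ∀ {W W′} → (∀ e → W e ≡ W′ e) → P W → P W′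

  module _ {I : Set} (P : I → Weight → Set) (line-open : ∀ i → LineOpen (P i)) (resp : ∀ i → Pointwise (P i)) where

    -- By line-openness each condition forbids at most one value at the entry `e`. That value, if
    -- any, joins `excluded`, and a finite list never exhausts the integers.
    generic-value : ∀ e is (excluded : List ℤ) (W : I → Weight) → (∀ {i} → i ∈ is → P i (W i)) →
      ¬ ¬ (∃[ z ] (z ∉ excluded × (∀ {i} → i ∈ is → P i (W i [ e ≔ z ]))))
    generic-value e [] excluded W _ = return (case fresh-ℤ excluded of λ (z , z∉) → z , z∉ , λ ())
    generic-value e (i ∷ is) excluded W holds =
      ¬¬-excluded-middle {A = ∃[ z₁ ] (¬ P i (W i [ e ≔ z₁ ]))} >>= λ where
        (yes (z₁ , fails)) → generic-value e is (z₁ ∷ excluded) W (holds ∘ there) >>= λ (z , z∉ , rest) →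
          line-open i (λ z₁≡z → z∉ (here (sym z₁≡z))) (holds (here refl)) fails >>= λ Pz →
          return (z , z∉ ∘ there , λ { (here refl) → Pz ; (there i∈) → rest i∈ })
        (no never-fails) → generic-value e is excluded W (holds ∘ there) >>= λ (z , z∉ , rest) →
          (λ ¬Pz → never-fails (z , ¬Pz)) >>= λ Pz →
          return (z , z∉ , λ { (here refl) → Pz ; (there i∈) → rest i∈ })

    -- Conditions that are met separately can be met simultaneously: replace the entries
    -- of all witnesses by common ones, one entry at a time.
    generic : ∀ es is W₀ (W : I → Weight) → (∀ {i} → i ∈ is → P i (W i)) →
      (∀ {i e} → i ∈ is → e ∉ es → W i e ≡ W₀ e) →
      ¬ ¬ (∃[ W′ ] ((∀ {e} → e ∉ es → W′ e ≡ W₀ e) × (∀ {i} → i ∈ is → P i W′)))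
    generic [] is W₀ W holds agree =
      return (W₀ , (λ {_} _ → refl) , λ {i} i∈ → resp i (λ e → agree i∈ λ ()) (holds i∈))
    generic (e ∷ es) is W₀ W holds agree =
      generic-value e is [] W holds >>= λ (z , _ , holds′) →
      generic es is (W₀ [ e ≔ z ]) (λ i → W i [ e ≔ z ]) holds′ (agree′ z) >>= λ (W′ , W′-agrees , all) →
      return (W′ , (λ {d} d∉ → trans (W′-agrees (d∉ ∘ there)) (update-other W₀ z λ { refl → d∉ (here refl) })) ,
              λ {i} → all {i})
      where
      agree′ : ∀ z {i d} → i ∈ is → d ∉ es → (W i [ e ≔ z ]) d ≡ (W₀ [ e ≔ z ]) d
      agree′ z {d = d} i∈ d∉ with d ≟ᵉ e
      ... | yes _  = refl
      ... | no d≢e = agree i∈ λ { (here d≡e) → d≢e d≡e ; (there d∈) → d∉ d∈ }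

  -- Trivial kernel on the vectors supported in `Us`, in place of a non-vanishing maximal minor. The
  -- Boolean in an equation tells original entries from those of the second copies.
  Nonsingular : FinSet → FinSet → List (Bool × Element) → (Bool → Element → Element → ℤ) → Set
  Nonsingular V Us Qs M = ∀ (x : Element → ℤ) → (∀ {u} → u ∉ Us → x u ≡ 0ℤ) →
    (∀ {b q} → (b , q) ∈ Qs → ∑ V (λ u → x u ℤ.* M b u q) ≡ 0ℤ) → ∀ u → x u ≡ 0ℤ

  module _ {V Us : FinSet} (V! : Unique V) (Us⊆V : Us ⊆ V) (Qs : List (Bool × Element)) where

    private
      Kernel : (Bool → Element → Element → ℤ) → (Element → ℤ) → Set
      Kernel M x = (∀ {u} → u ∉ Us → x u ≡ 0ℤ) × (∀ {b q} → (b , q) ∈ Qs → ∑ V (λ u → x u ℤ.* M b u q) ≡ 0ℤ)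

      kernel-vector : ∀ {M} → ¬ Nonsingular V Us Qs M → ¬ ¬ (∃[ x ] (Kernel M x × ∃[ u ] x u ≢ 0ℤ))
      kernel-vector ¬ns ¬vec = ¬ns λ x supp ker u → decidable-stable (x u ℤₚ.≟ 0ℤ)
        λ xu≢0 → ¬vec (x , ((λ {w} → supp {w}) , λ {b} {q} → ker {b} {q}) , u , xu≢0)

      δᵠ : Bool × Element → Bool × Element → ℤ
      δᵠ p q with Productₚ.≡-dec Boolₚ._≟_ _≟_ p q
      ... | yes _ = 1ℤ
      ... | no  _ = 0ℤ

      -- Kernel vectors at two distinct values combine to one at every value.
      nonsingular-line : (M M₁ M₂ : Bool → Element → Element → ℤ) (b₀ : Bool) (u₀ q₀ : Element) (d₁ d₂ : ℤ) →
        d₁ ≢ d₂ →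
        (∀ b u q → M₁ b u q ≡ M b u q ℤ.+ δᵠ (b₀ , q₀) (b , q) ℤ.* (δ u₀ u ℤ.* d₁)) →
        (∀ b u q → M₂ b u q ≡ M b u q ℤ.+ δᵠ (b₀ , q₀) (b , q) ℤ.* (δ u₀ u ℤ.* d₂)) →
        Nonsingular V Us Qs M → ¬ Nonsingular V Us Qs M₁ → ¬ ¬ Nonsingular V Us Qs M₂
      nonsingular-line M M₁ M₂ b₀ u₀ q₀ d₁ d₂ d₁≢d₂ eq₁ eq₂ ns ¬ns₁ ¬ns₂ =
        kernel-vector ¬ns₁ λ (x₁ , ker₁ , u₁ , x₁≢0) →
        kernel-vector ¬ns₂ λ (x₂ , ker₂ , u₂ , x₂≢0) →
        conclude x₁ ker₁ u₁ x₁≢0 x₂ ker₂ u₂ x₂≢0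
        where
        shift : ∀ (x : Element → ℤ) {d} (M′ : Bool → Element → Element → ℤ) → (∀ {u} → u ∉ Us → x u ≡ 0ℤ) →
          (∀ b u q → M′ b u q ≡ M b u q ℤ.+ δᵠ (b₀ , q₀) (b , q) ℤ.* (δ u₀ u ℤ.* d)) → ∀ b q →
          ∑ V (λ u → x u ℤ.* M′ b u q) ≡ ∑ V (λ u → x u ℤ.* M b u q) ℤ.+ δᵠ (b₀ , q₀) (b , q) ℤ.* d ℤ.* x u₀
        shift x {d} M′ supp eq b q = begin
          ∑ V (λ u → x u ℤ.* M′ b u q)
            ≡⟨ ∑-cong V (λ {u} _ → trans (cong (ℤ._*_ (x u)) (eq b u q))
                 (lemma (x u) (M b u q) (δᵠ (b₀ , q₀) (b , q)) (δ u₀ u) d)) ⟩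
          ∑ V (λ u → x u ℤ.* M b u q ℤ.+ δᵠ (b₀ , q₀) (b , q) ℤ.* d ℤ.* (δ u₀ u ℤ.* x u))
            ≡⟨ trans (∑-+ (λ u → x u ℤ.* M b u q) (λ u → δᵠ (b₀ , q₀) (b , q) ℤ.* d ℤ.* (δ u₀ u ℤ.* x u)) V) (cong (ℤ._+_ (∑ V (λ u → x u ℤ.* M b u q))) (∑-* (δᵠ (b₀ , q₀) (b , q) ℤ.* d) (λ u → δ u₀ u ℤ.* x u) V)) ⟩
          ∑ V (λ u → x u ℤ.* M b u q) ℤ.+ δᵠ (b₀ , q₀) (b , q) ℤ.* d ℤ.* ∑ V (λ u → δ u₀ u ℤ.* x u)
            ≡⟨ cong (λ s → ∑ V (λ u → x u ℤ.* M b u q) ℤ.+ δᵠ (b₀ , q₀) (b , q) ℤ.* d ℤ.* s) pick ⟩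
          ∑ V (λ u → x u ℤ.* M b u q) ℤ.+ δᵠ (b₀ , q₀) (b , q) ℤ.* d ℤ.* x u₀ ∎
          where
          open ≡-Reasoning
          lemma : ∀ x m k e d → x ℤ.* (m ℤ.+ k ℤ.* (e ℤ.* d)) ≡ x ℤ.* m ℤ.+ k ℤ.* d ℤ.* (e ℤ.* x)
          lemma = solve-∀
          pick : ∑ V (λ u → δ u₀ u ℤ.* x u) ≡ x u₀
          pick with u₀ ∈? V
          ... | yes u₀∈ = ∑-δ u₀ x V! u₀∈
          ... | no  u₀∉ = trans (∑-δ-∉ u₀ x u₀∉) (sym (supp (u₀∉ ∘ Us⊆V)))
        -- A kernel vector that vanishes at `u₀` does not notice the changed entry and would be a
        -- kernel vector of `M` already.
        degenerate : ∀ (x : Element → ℤ) {d} (M′ : Bool → Element → Element → ℤ) {u} → Kernel M′ x →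
          (∀ b u q → M′ b u q ≡ M b u q ℤ.+ δᵠ (b₀ , q₀) (b , q) ℤ.* (δ u₀ u ℤ.* d)) →
          x u ≢ 0ℤ → x u₀ ≢ 0ℤ
        degenerate x {d} M′ (supp , ker) eq xu≢0 xu₀≡0 = xu≢0 (ns x supp (λ {b} {q} q∈ →
          trans (sym (lemma (∑ V (λ u → x u ℤ.* M b u q)) (δᵠ (b₀ , q₀) (b , q) ℤ.* d))) (trans (cong (λ s → ∑ V (λ u → x u ℤ.* M b u q) ℤ.+ δᵠ (b₀ , q₀) (b , q) ℤ.* d ℤ.* s)
            (sym xu₀≡0)) (trans (sym (shift x M′ supp eq b q)) (ker q∈)))) _)
          where
          lemma : ∀ S k → S ℤ.+ k ℤ.* 0ℤ ≡ S
          lemma = solve-∀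
        conclude : ∀ x₁ → Kernel M₁ x₁ → ∀ u₁ → x₁ u₁ ≢ 0ℤ → ∀ x₂ → Kernel M₂ x₂ → ∀ u₂ → x₂ u₂ ≢ 0ℤ → ⊥
        conclude x₁ k₁@(supp₁ , ker₁) u₁ x₁≢0 x₂ k₂@(supp₂ , ker₂) u₂ x₂≢0 =
          *-≢0 (*-≢0 t₁≢0 t₂≢0) (λ d≡0 → d₁≢d₂ (ℤₚ.i-j≡0⇒i≡j d₁ d₂ d≡0)) (trans (sym (at-u₀ d₁ d₂ (x₁ u₀) (x₂ u₀)))
            (ns x supp ker u₀))
          where
          t₁≢0 : x₁ u₀ ≢ 0ℤ
          t₁≢0 = degenerate x₁ M₁ k₁ eq₁ x₁≢0
          t₂≢0 : x₂ u₀ ≢ 0ℤ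
          t₂≢0 = degenerate x₂ M₂ k₂ eq₂ x₂≢0
          -- These coefficients cancel the contributions of the changed entry, so `x` is in the
          -- kernel of `M`; yet its value at `u₀` is a product of `d₁ - d₂` with two non-zero
          -- numbers.
          α β : ℤ
          α = ℤ.- d₂ ℤ.* x₂ u₀
          β = d₁ ℤ.* x₁ u₀
          x : Element → ℤ
          x u = α ℤ.* x₁ u ℤ.+ β ℤ.* x₂ u
          at-u₀ : ∀ d₁ d₂ t₁ t₂ → (ℤ.- d₂ ℤ.* t₂) ℤ.* t₁ ℤ.+ (d₁ ℤ.* t₁) ℤ.* t₂ ≡ t₁ ℤ.* t₂ ℤ.* (d₁ ℤ.- d₂)
          at-u₀ = solve-∀
          zeros : ∀ a b → a ℤ.* 0ℤ ℤ.+ b ℤ.* 0ℤ ≡ 0ℤ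
          zeros = solve-∀
          supp : ∀ {u} → u ∉ Us → x u ≡ 0ℤ
          supp u∉ = trans (cong₂ (λ p q → α ℤ.* p ℤ.+ β ℤ.* q) (supp₁ u∉) (supp₂ u∉)) (zeros α β)
          ker : ∀ {b q} → (b , q) ∈ Qs → ∑ V (λ u → x u ℤ.* M b u q) ≡ 0ℤ
          ker {b} {q} q∈ = begin
            ∑ V (λ u → x u ℤ.* M b u q)
              ≡⟨ ∑-cong V (λ {u} _ → distrib α (x₁ u) β (x₂ u) (M b u q)) ⟩
            ∑ V (λ u → α ℤ.* (x₁ u ℤ.* M b u q) ℤ.+ β ℤ.* (x₂ u ℤ.* M b u q))
              ≡⟨ ∑-linear α β (λ u → x₁ u ℤ.* M b u q) (λ u → x₂ u ℤ.* M b u q) V ⟩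
            α ℤ.* S₁ ℤ.+ β ℤ.* S₂
              ≡⟨ combine S₁ S₂ (δᵠ (b₀ , q₀) (b , q)) d₁ d₂ (x₁ u₀) (x₂ u₀) ⟩
            α ℤ.* (S₁ ℤ.+ k ℤ.* d₁ ℤ.* x₁ u₀) ℤ.+ β ℤ.* (S₂ ℤ.+ k ℤ.* d₂ ℤ.* x₂ u₀)
              ≡⟨ cong₂ (λ p q → α ℤ.* p ℤ.+ β ℤ.* q)
                   (trans (sym (shift x₁ M₁ supp₁ eq₁ b q)) (ker₁ q∈)) (trans (sym (shift x₂ M₂ supp₂ eq₂ b q)) (ker₂ q∈)) ⟩
            α ℤ.* 0ℤ ℤ.+ β ℤ.* 0ℤ
              ≡⟨ zeros α β ⟩
            0ℤ ∎
            where
            open ≡-Reasoning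
            S₁ S₂ k : ℤ
            S₁ = ∑ V (λ u → x₁ u ℤ.* M b u q)
            S₂ = ∑ V (λ u → x₂ u ℤ.* M b u q)
            k  = δᵠ (b₀ , q₀) (b , q)
            distrib : ∀ a x b y m → (a ℤ.* x ℤ.+ b ℤ.* y) ℤ.* m ≡ a ℤ.* (x ℤ.* m) ℤ.+ b ℤ.* (y ℤ.* m)
            distrib = solve-∀
            combine : ∀ S₁ S₂ k d₁ d₂ t₁ t₂ →
              (ℤ.- d₂ ℤ.* t₂) ℤ.* S₁ ℤ.+ (d₁ ℤ.* t₁) ℤ.* S₂ ≡
              (ℤ.- d₂ ℤ.* t₂) ℤ.* (S₁ ℤ.+ k ℤ.* d₁ ℤ.* t₁) ℤ.+ (d₁ ℤ.* t₁) ℤ.* (S₂ ℤ.+ k ℤ.* d₂ ℤ.* t₂)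
            combine = solve-∀

      δᵠ-update : ∀ (W : Weight) (pack : Bool → Element → Element → Entry) →
        (∀ {b u q b′ u′ q′} → pack b u q ≡ pack b′ u′ q′ → (b ≡ b′ × q ≡ q′) × u ≡ u′) →
        ∀ b₀ u₀ q₀ z b u q → (W [ pack b₀ u₀ q₀ ≔ z ]) (pack b u q) ≡
          W (pack b u q) ℤ.+ δᵠ (b₀ , q₀) (b , q) ℤ.* (δ u₀ u ℤ.* (z ℤ.- W (pack b₀ u₀ q₀)))
      δᵠ-update W pack pack-inj b₀ u₀ q₀ z b u q
        with Productₚ.≡-dec Boolₚ._≟_ _≟_ (b₀ , q₀) (b , q) | u₀ ≟ u
      ... | yes refl | yes refl = trans (update-same W {pack b₀ u₀ q₀} z refl) (lemma z (W (pack b₀ u₀ q₀)))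
        where
        lemma : ∀ z w → z ≡ w ℤ.+ 1ℤ ℤ.* (1ℤ ℤ.* (z ℤ.- w))
        lemma = solve-∀
      ... | yes refl | no u₀≢u = trans (update-other W z λ eq → u₀≢u (sym (proj₂ (pack-inj eq))))
                                       (lemma (W (pack b u q)) (z ℤ.- W (pack b₀ u₀ q₀)))
        where
        lemma : ∀ w d → w ≡ w ℤ.+ 1ℤ ℤ.* (0ℤ ℤ.* d)
        lemma = solve-∀
      ... | no ≢ | _ = trans (update-other W z λ eq → case pack-inj eq of λ { ((refl , refl) , _) → ≢ refl })
                             (sym (ℤₚ.+-identityʳ (W (pack b u q))))

    -- `pack` permits one weight to be read both as a matrix and as its transpose.
    nonsingular-open : (pack : Bool → Element → Element → Entry) →
      (∀ {b u q b′ u′ q′} → pack b u q ≡ pack b′ u′ q′ → (b ≡ b′ × q ≡ q′) × u ≡ u′) →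
      (∀ e → ∃[ b ] ∃[ u ] ∃[ q ] pack b u q ≡ e) →
      LineOpen (λ W → Nonsingular V Us Qs (λ b u q → W (pack b u q)))
    nonsingular-open pack pack-inj pack-surj {W} {e} {z₁} {z₂} z₁≢z₂ with pack-surj e
    ... | b₀ , u₀ , q₀ , refl = nonsingular-line
        (λ b u q → W (pack b u q)) (λ b u q → (W [ e ≔ z₁ ]) (pack b u q)) (λ b u q → (W [ e ≔ z₂ ]) (pack b u q)) b₀ u₀ q₀ (z₁ ℤ.- W e) (z₂ ℤ.- W e)
        (λ eq → z₁≢z₂ (ℤₚ.i-j≡0⇒i≡j z₁ z₂ (trans (lemma z₁ z₂ (W e)) (ℤₚ.i≡j⇒i-j≡0 eq))))
        (δᵠ-update W pack pack-inj b₀ u₀ q₀ z₁) (δᵠ-update W pack pack-inj b₀ u₀ q₀ z₂)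
        where
        lemma : ∀ a b w → a ℤ.- b ≡ (a ℤ.- w) ℤ.- (b ℤ.- w)
        lemma = solve-∀

  nonsingular-pointwise : ∀ V Us Qs (pack : Bool → Element → Element → Entry) →
    Pointwise (λ W → Nonsingular V Us Qs (λ b u q → W (pack b u q)))
  nonsingular-pointwise V Us Qs pack eq ns x supp ker = ns x supp λ q∈ →
    trans (∑-cong V λ {u} _ → cong (ℤ._*_ (x u)) (eq (pack _ u _))) (ker q∈)

  -- Elimination of a column

  module _ {M : Matroid} (R : NormalRep M) where

    open NormalRep R

    inner⊆rows : inner ⊆ rows
    inner⊆rows {c} c∈ with c ∈? rows | ∈-∖⁻ cols (E M) c∈
    ... | yes c∈rows | _ = c∈rows
    ... | no  c∉rows | c∈cols , c∉E = ⊥-elim (c∉E (targets (∈-∖⁺ c∈cols c∉rows)))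

    -- The possible non-zero positions after a pivot at the diagonal entry of `c`; in the digraph,
    -- paths through `c` are shortcut.
    Bypass : Element → Rel Element 0ℓ
    Bypass c i v = Adj i v ⊎ (Adj i c × Adj c v)

    bypass? : ∀ c → Decidable (Bypass c)
    bypass? c i v = Adj? i v ⊎-dec (Adj? i c ×-dec Adj? c v)

    Essential : Element → Set
    Essential c = ∃[ X ] (X ⊆ E M × ¬ Matchable Adj rows (cols ∖ X) ×
      Matchable (Bypass c) (rows ∖ (c ∷ [])) ((cols ∖ (c ∷ [])) ∖ X))

    -- The row matched with `c`, if it is not `c` itself, takes over the column of the row `c`.
    bypass-matchable : ∀ {c X} → c ∈ inner → Matchable Adj rows (cols ∖ X) →
      Matchable (Bypass c) (rows ∖ (c ∷ [])) ((cols ∖ (c ∷ [])) ∖ X)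
    bypass-matchable {c} {X} c∈ (σ , m) = σ′ , record
      { inside = inside′ ; along = along′ ; injective = injective′ }
      where
      row : ∀ {i} → i ∈ rows ∖ (c ∷ []) → i ∈ rows × i ≢ c
      row i∈ = case ∈-∖⁻ rows (c ∷ []) i∈ of λ (i∈rows , i∉) → i∈rows , i∉ ∘ here
      c-row : c ∈ rows
      c-row = inner⊆rows c∈
      σ′ : Element → Element
      σ′ i with σ i ≟ c
      ... | yes _ = σ c
      ... | no  _ = σ i
      σc≢c : ∀ {i} → i ∈ rows ∖ (c ∷ []) → σ i ≡ c → σ c ≢ c
      σc≢c i∈ σi≡c σc≡c = proj₂ (row i∈) (injective m (proj₁ (row i∈)) c-row (trans σi≡c (sym σc≡c)))
      keep : ∀ {v} → v ∈ cols ∖ X → v ≢ c → v ∈ (cols ∖ (c ∷ [])) ∖ X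
      keep v∈ v≢c = case ∈-∖⁻ cols X v∈ of λ (v∈cols , v∉X) →
        ∈-∖⁺ (∈-∖⁺ v∈cols λ { (here v≡c) → v≢c v≡c }) v∉X
      inside′ : ∀ {i} → i ∈ rows ∖ (c ∷ []) → σ′ i ∈ (cols ∖ (c ∷ [])) ∖ X
      inside′ {i} i∈ with σ i ≟ c
      ... | yes σi≡c = keep (inside m c-row) (σc≢c i∈ σi≡c)
      ... | no  σi≢c = keep (inside m (proj₁ (row i∈))) σi≢c
      along′ : ∀ {i} → i ∈ rows ∖ (c ∷ []) → Bypass c i (σ′ i)
      along′ {i} i∈ with σ i ≟ c
      ... | yes σi≡c = inj₂ (subst (Adj i) σi≡c (along m (proj₁ (row i∈))) , along m c-row)
      ... | no  _    = inj₁ (along m (proj₁ (row i∈)))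
      injective′ : ∀ {i j} → i ∈ rows ∖ (c ∷ []) → j ∈ rows ∖ (c ∷ []) → σ′ i ≡ σ′ j → i ≡ j
      injective′ {i} {j} i∈ j∈ eq with σ i ≟ c | σ j ≟ c
      ... | yes σi≡c | yes σj≡c = injective m (proj₁ (row i∈)) (proj₁ (row j∈)) (trans σi≡c (sym σj≡c))
      ... | yes _    | no  _    = ⊥-elim (proj₂ (row j∈) (sym (injective m c-row (proj₁ (row j∈)) eq)))
      ... | no  _    | yes _    = ⊥-elim (proj₂ (row i∈) (injective m (proj₁ (row i∈)) c-row eq))
      ... | no  _    | no  _    = injective m (proj₁ (row i∈)) (proj₁ (row j∈)) eq

    bypass : ∀ c → c ∈ inner → ¬ Essential c →
      Σ[ R′ ∈ NormalRep M ] ∣ NormalRep.inner R′ ∣ < ∣ inner ∣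
    bypass c c∈ ¬ess = record
      { Adj        = Bypass c
      ; Adj?       = bypass? c
      ; rows       = rows ∖ (c ∷ [])
      ; cols       = cols ∖ (c ∷ [])
      ; reflexive  = record { rows⊆cols = ∖-mono rows⊆cols (λ x∈ → x∈)
                            ; diagonal  = λ i∈ → inj₁ (diagonal (∖⊆ rows (c ∷ []) i∈)) }
      ; represents = E⊆ , λ X → mk⇔ (fwd X) (bwd X)
      ; targets    = targets′
      } , ℕₚ.≤-<-trans (card-mono inner′⊆) (card-∖-< c∈)
      where
      inner′⊆ : (cols ∖ (c ∷ [])) ∖ E M ⊆ inner ∖ (c ∷ [])
      inner′⊆ v∈ = case ∈-∖⁻ (cols ∖ (c ∷ [])) (E M) v∈ of λ (v∈∖ , v∉E) →
        case ∈-∖⁻ cols (c ∷ []) v∈∖ of λ (v∈cols , v∉c) → ∈-∖⁺ (∈-∖⁺ v∈cols v∉E) v∉c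
      E⊆ : E M ⊆ cols ∖ (c ∷ [])
      E⊆ x∈ = ∈-∖⁺ (proj₁ represents x∈) λ { (here refl) → proj₂ (∈-∖⁻ cols (E M) c∈) x∈ }
      targets′ : (cols ∖ (c ∷ [])) ∖ (rows ∖ (c ∷ [])) ⊆ E M
      targets′ v∈ = case ∈-∖⁻ (cols ∖ (c ∷ [])) (rows ∖ (c ∷ [])) v∈ of λ (v∈∖ , v∉) →
        case ∈-∖⁻ cols (c ∷ []) v∈∖ of λ (v∈cols , v∉c) →
        targets (∈-∖⁺ v∈cols λ v∈rows → v∉ (∈-∖⁺ v∈rows v∉c))
      fwd : ∀ X → Indep M X → X ⊆ E M × Matchable (Bypass c) (rows ∖ (c ∷ [])) ((cols ∖ (c ∷ [])) ∖ X)
      fwd X iX = (λ {x} → within M iX {x}) , bypass-matchable c∈ (indep⁻ iX)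
      bwd : ∀ X → X ⊆ E M × Matchable (Bypass c) (rows ∖ (c ∷ [])) ((cols ∖ (c ∷ [])) ∖ X) → Indep M X
      bwd X (X⊆E , m) with matchable? Adj? rows (cols ∖ X)
      ... | yes m′ = indep⁺ X⊆E m′
      ... | no ¬m′ = ⊥-elim (¬ess (X , (λ {x} → X⊆E {x}) , ¬m′ , m))

    -- X is a circuit of M and J a minimal set of rows too large for its columns W outside X.
    -- One column short, J could be matched with a second copy of c; one row in excess,
    -- the columns outside W and X could match the remaining rows with a second copy of c.
    record Obstruction (c : Element) : Set where
      field
        J X      : FinSet
        J⊆rows   : J ⊆ rows
        c∉J      : c ∉ J
        X⊆E      : X ⊆ E M
        almost   : ∃[ Z ] (Indep M Z × ∣ X ∣ ≤ suc ∣ Z ∣)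

      W : FinSet
      W = nbr Adj? J (cols ∖ X)

      field
        deficient : ∣ W ∣ < ∣ J ∣
        j₀        : Element
        j₀∈J      : j₀ ∈ J
        j₀→c      : Adj j₀ c
        left      : Matchable Adj (J ∖ (j₀ ∷ [])) W
        v₀        : Element
        v₀∈       : v₀ ∈ cols ∖ (W ++ X)
        c→v₀      : Adj c v₀
        right     : Matchable Adj (rows ∖ J) ((cols ∖ (W ++ X)) ∖ (v₀ ∷ []))

    private
      Dependent : FinSet → FinSet → Set
      Dependent X Y = Y ⊆ X × ¬ Matchable Adj rows (cols ∖ Y)

    module _ {c} (c∈ : c ∈ inner) {X} (X⊆E : X ⊆ E M)
             (bypassed : Matchable (Bypass c) (rows ∖ (c ∷ [])) ((cols ∖ (c ∷ [])) ∖ X))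
             {x₀} (almost : Matchable Adj rows (cols ∖ (X ∖ (x₀ ∷ [])))) where

      private
        N : FinSet → FinSet
        N K = nbr Adj? K (cols ∖ X)

        c∈cols∖X : c ∈ cols ∖ X
        c∈cols∖X = case ∈-∖⁻ cols (E M) c∈ of λ (c∈cols , c∉E) → ∈-∖⁺ c∈cols (c∉E ∘ X⊆E)

        hall-bypass : ∀ K → K ⊆ rows ∖ (c ∷ []) → ∣ K ∣ ≤ ∣ nbr (bypass? c) K ((cols ∖ (c ∷ [])) ∖ X) ∣
        hall-bypass = matches⇒hall (bypass? c) (proj₂ bypassed)

        -- With `c` in `K`, whatever a row of `K` reaches through `c` is a neighbour of `K` anyway.
        -- The Hall condition after the bypass thus carries over, the diagonal entry paying for `c`
        -- itself.
        no-violator∋c : ∀ K → K ⊆ rows → c ∈ K → ∣ K ∣ ≤ ∣ N K ∣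
        no-violator∋c K K⊆ c∈K = begin
          ∣ K ∣                   ≤⟨ card-∖-≤ c K ⟩
          suc ∣ K ∖ (c ∷ []) ∣    ≤⟨ s≤s (ℕₚ.≤-trans (hall-bypass (K ∖ (c ∷ [])) (∖-mono K⊆ (λ x∈ → x∈))) (card-mono sub)) ⟩
          suc ∣ N K ∖ (c ∷ []) ∣  ≤⟨ card-∖-< (∈-nbr⁺ Adj? c∈K c∈cols∖X (diagonal (K⊆ c∈K))) ⟩
          ∣ N K ∣                 ∎
          where
          open ℕₚ.≤-Reasoning
          sub : nbr (bypass? c) (K ∖ (c ∷ [])) ((cols ∖ (c ∷ [])) ∖ X) ⊆ N K ∖ (c ∷ [])
          sub v∈ with ∈-nbr⁻ (bypass? c) (K ∖ (c ∷ [])) ((cols ∖ (c ∷ [])) ∖ X) v∈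
          ... | v∈∖X , k , k∈ , step with ∈-∖⁻ (cols ∖ (c ∷ [])) X v∈∖X
          ...   | v∈∖c , v∉X with ∈-∖⁻ cols (c ∷ []) v∈∖c
          ...     | v∈cols , v∉c with step
          ...       | inj₁ a       = ∈-∖⁺ (∈-nbr⁺ Adj? (∖⊆ K (c ∷ []) k∈) (∈-∖⁺ v∈cols v∉X) a) v∉c
          ...       | inj₂ (_ , a) = ∈-∖⁺ (∈-nbr⁺ Adj? c∈K (∈-∖⁺ v∈cols v∉X) a) v∉c

        -- Giving back the single column `x₀` restores a full matching.
        deficiency≤1 : ∀ K → K ⊆ rows → ∣ K ∣ ≤ suc ∣ N K ∣
        deficiency≤1 K K⊆ = ℕₚ.≤-trans (matches⇒hall Adj? (proj₂ almost) K K⊆)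
          (ℕₚ.≤-trans (card-mono sub) (card-∷-≤ x₀ (N K)))
          where
          sub : nbr Adj? K (cols ∖ (X ∖ (x₀ ∷ []))) ⊆ x₀ ∷ N K
          sub {v} v∈ with v ≟ x₀ | ∈-nbr⁻ Adj? K (cols ∖ (X ∖ (x₀ ∷ []))) v∈
          ... | yes refl | _ = here refl
          ... | no v≢x₀ | v∈∖ , k , k∈ , a with ∈-∖⁻ cols (X ∖ (x₀ ∷ [])) v∈∖
          ...   | v∈cols , v∉ = there (∈-nbr⁺ Adj? k∈ (∈-∖⁺ v∈cols λ v∈X → v∉ (∈-∖⁺ v∈X λ { (here v≡) → v≢x₀ v≡ })) a)

      module _ {J} (J⊆ : J ⊆ rows) (deficient : ∣ N J ∣ < ∣ J ∣)
               (min : ∀ K → Violates Adj? rows (cols ∖ X) K → ∣ J ∣ ≤ ∣ K ∣) where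

        private
          W Y : FinSet
          W = N J
          Y = cols ∖ (W ++ X)

          c∉J : c ∉ J
          c∉J c∈J = ℕₚ.<⇒≱ deficient (no-violator∋c J J⊆ c∈J)

          -- If no row of `J` saw `c`, the bypass would add nothing to the neighbourhood of `J`, and
          -- `J` would stay deficient.
          c∈W : c ∈ W
          c∈W with c ∈? W
          ... | yes c∈W = c∈W
          ... | no  c∉W = ⊥-elim (ℕₚ.<⇒≱ deficient (ℕₚ.≤-trans
                  (hall-bypass J λ j∈ → ∈-∖⁺ (J⊆ j∈) λ { (here refl) → c∉J j∈ }) (card-mono sub)))
            where
            sub : nbr (bypass? c) J ((cols ∖ (c ∷ [])) ∖ X) ⊆ W
            sub v∈ with ∈-nbr⁻ (bypass? c) J ((cols ∖ (c ∷ [])) ∖ X) v∈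
            ... | v∈∖X , j , j∈ , inj₁ a = ∈-nbr⁺ Adj? j∈ (∖-mono (∖⊆ cols (c ∷ [])) (λ x∈ → x∈) v∈∖X) a
            ... | _ , j , j∈ , inj₂ (a , _) = ⊥-elim (c∉W (∈-nbr⁺ Adj? j∈ c∈cols∖X a))

          -- By minimality of `J`, its proper subsets satisfy the Hall condition.
          left : ∀ {j₀} → j₀ ∈ J → Matchable Adj (J ∖ (j₀ ∷ [])) W
          left {j₀} j₀∈ = hall Adj? (J ∖ (j₀ ∷ [])) W λ K K⊆ → ℕₚ.≮⇒≥ λ lt →
            ℕₚ.<⇒≱ (ℕₚ.≤-<-trans (card-mono K⊆) (card-∖-< j₀∈))
              (min K ((λ k∈ → J⊆ (∖⊆ J (j₀ ∷ []) (K⊆ k∈))) , ℕₚ.≤-<-trans (card-mono (sub K K⊆)) lt))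
            where
            sub : ∀ K → K ⊆ J ∖ (j₀ ∷ []) → N K ⊆ nbr Adj? K W
            sub K K⊆ v∈ with ∈-nbr⁻ Adj? K (cols ∖ X) v∈
            ... | v∈∖X , k , k∈ , a = ∈-nbr⁺ Adj? k∈ (∈-nbr⁺ Adj? (∖⊆ J (j₀ ∷ []) (K⊆ k∈)) v∈∖X a) a

          N-++ : ∀ K → N (J ++ K) ⊆ W ++ nbr Adj? K Y
          N-++ K {v} v∈ with v ∈? W | ∈-nbr⁻ Adj? (J ++ K) (cols ∖ X) v∈
          ... | yes v∈W | _ = ∈-++⁺ˡ v∈W
          ... | no  v∉W | v∈∖X , k , k∈ , a with ∈-++⁻ J k∈
          ...   | inj₁ k∈J = ⊥-elim (v∉W (∈-nbr⁺ Adj? k∈J v∈∖X a))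
          ...   | inj₂ k∈K = case ∈-∖⁻ cols X v∈∖X of λ (v∈cols , v∉X) →
                    ∈-++⁺ʳ W (∈-nbr⁺ Adj? k∈K (∈-∖⁺ v∈cols λ v∈ → [ v∉W , v∉X ]′ (∈-++⁻ W v∈)) a)

          N-++-≤ : ∀ K → ∣ N (J ++ K) ∣ ≤ ∣ W ∣ + ∣ nbr Adj? K Y ∣
          N-++-≤ K = ℕₚ.≤-trans (card-mono (N-++ K)) (card-++-≤ W (nbr Adj? K Y))

          J∩K=∅ : ∀ {K} → K ⊆ rows ∖ J → ∀ {j} → j ∈ J → j ∉ K
          J∩K=∅ K⊆ j∈J j∈K = proj₂ (∈-∖⁻ rows J (K⊆ j∈K)) j∈J

          -- `J` already exhausts the deficiency of one that any set of rows may have, so nothing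
          -- can be lacking in the remaining columns.
          hall-right : HallCondition Adj? (rows ∖ J) Y
          hall-right K K⊆ = ℕₚ.+-cancelˡ-≤ (∣ J ∣) _ _ (begin
            ∣ J ∣ + ∣ K ∣                  ≡⟨ card-++ (J∩K=∅ K⊆) ⟨
            ∣ J ++ K ∣                     ≤⟨ deficiency≤1 (J ++ K) (⊆-++⁻ J⊆ λ k∈ → ∖⊆ rows J (K⊆ k∈)) ⟩
            suc (∣ N (J ++ K) ∣)           ≤⟨ s≤s (N-++-≤ K) ⟩
            suc (∣ W ∣) + ∣ nbr Adj? K Y ∣ ≤⟨ ℕₚ.+-monoˡ-≤ _ deficient ⟩
            ∣ J ∣ + ∣ nbr Adj? K Y ∣       ∎)
            where open ℕₚ.≤-Reasoning

          -- Adding `c` to `J ++ K` would cost no new column, so `J ++ c ∷ K` would be a violator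
          -- containing `c`.
          not-blocked : ¬ (∃[ K ] (K ⊆ rows ∖ J × ∣ nbr Adj? K Y ∣ ≤ ∣ K ∣ × nbr Adj? (c ∷ []) Y ⊆ nbr Adj? K Y))
          not-blocked (K , K⊆ , tight , Z⊆) = ℕₚ.<⇒≱ deficient (ℕₚ.+-cancelʳ-≤ (∣ K ∣) _ _ (begin
            ∣ J ∣ + ∣ K ∣                 ≡⟨ card-++ (J∩K=∅ K⊆) ⟨
            ∣ J ++ K ∣                    ≤⟨ card-mono {J ++ K} {J ++ c ∷ K} (⊆-++⁻ {J} ∈-++⁺ˡ λ k∈ → ∈-++⁺ʳ J (there k∈)) ⟩
            ∣ J ++ c ∷ K ∣                ≤⟨ no-violator∋c (J ++ c ∷ K)
                                               (⊆-++⁻ J⊆ (∷-⊆ (inner⊆rows c∈) λ k∈ → ∖⊆ rows J (K⊆ k∈))) (∈-++⁺ʳ J (here refl)) ⟩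
            ∣ N (J ++ c ∷ K) ∣            ≤⟨ N-++-≤ (c ∷ K) ⟩
            ∣ W ∣ + ∣ nbr Adj? (c ∷ K) Y ∣ ≤⟨ ℕₚ.+-monoʳ-≤ _ (ℕₚ.≤-trans (card-mono sub) tight) ⟩
            ∣ W ∣ + ∣ K ∣                 ∎))
            where
            open ℕₚ.≤-Reasoning
            sub : nbr Adj? (c ∷ K) Y ⊆ nbr Adj? K Y
            sub v∈ with ∈-nbr⁻ Adj? (c ∷ K) Y v∈
            ... | v∈Y , k , here refl , a = Z⊆ (∈-nbr⁺ Adj? (here refl) v∈Y a)
            ... | v∈Y , k , there k∈  , a = ∈-nbr⁺ Adj? k∈ v∈Y a

          right : ∃[ v₀ ] (v₀ ∈ nbr Adj? (c ∷ []) Y × Matchable Adj (rows ∖ J) (Y ∖ (v₀ ∷ [])))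
          right with any? (λ v → matchable? Adj? (rows ∖ J) (Y ∖ (v ∷ []))) (nbr Adj? (c ∷ []) Y)
          ... | yes some = find some
          ... | no ¬some = ⊥-elim (blocked⇒tight Adj? hall-right (nbr Adj? (c ∷ []) Y)
                  (λ v∈ → proj₁ (∈-nbr⁻ Adj? (c ∷ []) Y v∈)) (λ v∈ m → ¬some (lose v∈ m)) not-blocked)

        obstruction : Obstruction c
        obstruction with ∈-nbr⁻ Adj? J (cols ∖ X) c∈W | right
        ... | _ , j₀ , j₀∈ , a | v₀ , v₀∈ , m with ∈-nbr⁻ Adj? (c ∷ []) Y v₀∈
        ...   | v₀∈Y , _ , here refl , c→v₀ = record
          { J = J ; X = X ; J⊆rows = J⊆ ; c∉J = c∉J ; X⊆E = X⊆E
          ; almost = X ∖ (x₀ ∷ []) , indep⁺ (λ x∈ → X⊆E (∖⊆ X (x₀ ∷ []) x∈)) almost , card-∖-≤ x₀ X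
          ; deficient = deficient ; j₀ = j₀ ; j₀∈J = j₀∈ ; j₀→c = a ; left = left j₀∈
          ; v₀ = v₀ ; v₀∈ = v₀∈Y ; c→v₀ = c→v₀ ; right = m
          }

    -- Passing from `X₀` to a circuit inside it keeps the matching after the bypass and makes the
    -- set independent once any `x₀` is removed.
    essential⇒obstruction : ∀ {c} → c ∈ inner → Essential c → ¬ ¬ Obstruction c
    essential⇒obstruction {c} c∈ (X₀ , X₀⊆E , dep , bypassed) =
      minimal (Dependent X₀) ((λ {x} x∈ → x∈) , dep) >>= λ (X , (X⊆X₀ , depX) , min) →
      with-circuit X X⊆X₀ depX min
      where
      with-circuit : ∀ X → X ⊆ X₀ → ¬ Matchable Adj rows (cols ∖ X) → (∀ Y → Dependent X₀ Y → ∣ X ∣ ≤ ∣ Y ∣) →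
        ¬ ¬ Obstruction c
      with-circuit [] _ depX _ = ⊥-elim (depX (indep⁻ (empty M)))
      with-circuit X@(x₀ ∷ _) X⊆X₀ depX min =
        ¬matchable⇒violator Adj? depX >>= λ (K , viol) →
        minimal (Violates Adj? rows (cols ∖ X)) viol >>= λ (J , (J⊆ , lt) , minJ) →
        return (obstruction c∈ (λ {_} x∈ → X₀⊆E (X⊆X₀ x∈)) (matchable-⊆ (∖-mono (λ v∈ → v∈) X⊆X₀) bypassed) {x₀}
          circuit (λ {_} → J⊆) lt minJ)
        where
        circuit : Matchable Adj rows (cols ∖ (X ∖ (x₀ ∷ [])))
        circuit with matchable? Adj? rows (cols ∖ (X ∖ (x₀ ∷ [])))
        ... | yes m = m
        ... | no ¬m = ⊥-elim (ℕₚ.<⇒≱ (card-∖-< (here refl))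
                (min (X ∖ (x₀ ∷ [])) ((λ {_} x∈ → X⊆X₀ (∖⊆ X (x₀ ∷ []) x∈)) , ¬m)))

  -- Separating vectors

  private
    indicator : ∀ {P : Set} → Dec P → ℤ
    indicator (yes _) = 1ℤ
    indicator (no _)  = 0ℤ

    indicator-yes : ∀ {P : Set} (P? : Dec P) → P → indicator P? ≡ 1ℤ
    indicator-yes (yes _) _ = refl
    indicator-yes (no ¬p) p = ⊥-elim (¬p p)

    indicator-no : ∀ {P : Set} (P? : Dec P) → ¬ P → indicator P? ≡ 0ℤ
    indicator-no (yes p) ¬p = ⊥-elim (¬p p)
    indicator-no (no _)  _  = refl

  -- The witnesses below are 0-1 weights of matchings: each unknown has an equation in which it
  -- occurs alone.
  diagonal-nonsingular : ∀ {V Us Qs} (Mx : Bool → Element → Element → ℤ) → Unique V → Us ⊆ V →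
    (∀ {u} → u ∈ Us → ∃[ b ] ∃[ q ] ((b , q) ∈ Qs × Mx b u q ≡ 1ℤ × (∀ {w} → w ∈ Us → w ≢ u → Mx b w q ≡ 0ℤ))) →
    Nonsingular V Us Qs Mx
  diagonal-nonsingular {V} {Us} Mx V! Us⊆V pivot x supp ker u with u ∈? Us
  ... | no  u∉ = supp u∉
  ... | yes u∈ with pivot u∈
  ...   | b , q , q∈ , one , zeros = begin
      x u                               ≡⟨ ℤₚ.*-identityʳ (x u) ⟨
      x u ℤ.* 1ℤ                        ≡⟨ cong (ℤ._*_ (x u)) one ⟨
      x u ℤ.* Mx b u q                  ≡⟨ ∑-single V! (Us⊆V u∈) others ⟨
      ∑ V (λ w → x w ℤ.* Mx b w q)      ≡⟨ ker q∈ ⟩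
      0ℤ                                ∎
    where
    open ≡-Reasoning
    others : ∀ {w} → w ∈ V → w ≢ u → x w ℤ.* Mx b w q ≡ 0ℤ
    others {w} _ w≢u with w ∈? Us
    ... | yes w∈ = trans (cong (ℤ._*_ (x w)) (zeros w∈ w≢u)) (ℤₚ.*-zeroʳ (x w))
    ... | no  w∉ = cong (ℤ._* Mx b w q) (supp w∉)

  module _ {M : Matroid} (R : NormalRep M) where

    open NormalRep R
    open Obstruction

    Vs : FinSet
    Vs = dedup cols

    Vs! : Unique Vs
    Vs! = dedup-! cols

    rows⊆Vs : rows ⊆ Vs
    rows⊆Vs i∈ = ∈-dedup⁺ (rows⊆cols i∈)

    -- The entry (false , i , v) is the weight of i → v, and (true , i , v) that of
    -- i′ → v or i → v′, where i′ and v′ are second copies of i and v.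
    entries : List Entry
    entries = filter (λ (_ , i , v) → Adj? i v)
      (cartesianProduct (false ∷ true ∷ []) (cartesianProduct rows cols))

    bool∈ : ∀ b → b ∈ false ∷ true ∷ []
    bool∈ false = here refl
    bool∈ true  = there (here refl)

    ∉entries : ∀ {b i v} → (b , i , v) ∉ entries → ¬ (i ∈ rows × v ∈ cols × Adj i v)
    ∉entries {b} e∉ (i∈ , v∈ , a) = e∉ (∈-filter⁺ (λ (_ , i , v) → Adj? i v)
      (∈-cartesianProduct⁺ (bool∈ b) (∈-cartesianProduct⁺ i∈ v∈)) a)

    entries⁻ : ∀ {b i v} → (b , i , v) ∈ entries → i ∈ rows × v ∈ cols × Adj i v
    entries⁻ e∈ = case ∈-filter⁻ (λ (_ , i , v) → Adj? i v)
        {xs = cartesianProduct (false ∷ true ∷ []) (cartesianProduct rows cols)} e∈ of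
      λ (e∈× , a) → case ∈-cartesianProduct⁻ rows cols
        (proj₂ (∈-cartesianProduct⁻ (false ∷ true ∷ []) (cartesianProduct rows cols) e∈×)) of
      λ (i∈ , v∈) → i∈ , v∈ , a

    Supported : Weight → Set
    Supported Wt = ∀ b {i v} → ¬ (i ∈ rows × v ∈ cols × Adj i v) → Wt (b , i , v) ≡ 0ℤ

    ByRow ByCol : Weight → Bool → Element → Element → ℤ
    ByRow Wt b i v = Wt (b , i , v)
    ByCol Wt b v i = Wt (b , i , v)

    view : Bool → Weight → Bool → Element → Element → ℤ
    view false = ByRow
    view true  = ByCol

    -- Each condition carries a witness of its own, vanishing off the arcs, because `generic` merges
    -- conditions that are satisfiable separately.
    record Condition : Set where
      field
        byCol     : Bool
        unknowns  : FinSet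
        equations : List (Bool × Element)
        unknowns⊆ : unknowns ⊆ Vs

      Holds : Weight → Set
      Holds Wt = Nonsingular Vs unknowns equations (view byCol Wt)

      field
        witness   : Weight
        holds     : Holds witness
        supported : Supported witness

    open Condition using (Holds)

    condition-open : ∀ k → LineOpen (Holds k)
    condition-open k with Condition.byCol k
    ... | false = nonsingular-open Vs! (Condition.unknowns⊆ k) (Condition.equations k)
                    (λ b i v → b , i , v) (λ { refl → (refl , refl) , refl }) (λ (b , i , v) → b , i , v , refl)
    ... | true  = nonsingular-open Vs! (Condition.unknowns⊆ k) (Condition.equations k)
                    (λ b v i → b , i , v) (λ { refl → (refl , refl) , refl }) (λ (b , i , v) → b , v , i , refl)

    condition-pointwise : ∀ k → Pointwise (Holds k)
    condition-pointwise k with Condition.byCol k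
    ... | false = nonsingular-pointwise Vs (Condition.unknowns k) (Condition.equations k) (λ b i v → b , i , v)
    ... | true  = nonsingular-pointwise Vs (Condition.unknowns k) (Condition.equations k) (λ b v i → b , i , v)

    identity : Weight
    identity (false , i , v) = indicator ((i ≟ v) ×-dec (i ∈? rows))
    identity (true  , _ , _) = 0ℤ

    identity-supported : Supported identity
    identity-supported false {i} {v} ¬arc = indicator-no ((i ≟ v) ×-dec (i ∈? rows))
      λ { (refl , i∈) → ¬arc (i∈ , rows⊆cols i∈ , diagonal i∈) }
    identity-supported true _ = refl

    -- The square part of the matrix on `rows` is to be invertible from both sides. This lets left
    -- vectors be recovered from their products with columns, and right vectors in the kernel from
    -- their entries at targets.
    rows-independent columns-independent : Condition
    rows-independent = record
      { byCol = false ; unknowns = rows ; equations = map (false ,_) rows ; unknowns⊆ = rows⊆Vs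
      ; witness = identity ; supported = identity-supported
      ; holds = diagonal-nonsingular (ByRow identity) Vs! rows⊆Vs λ {u} u∈ → false , u , ∈-map⁺ (false ,_) u∈ ,
          indicator-yes ((u ≟ u) ×-dec (u ∈? rows)) (refl , u∈) ,
          λ {w} _ w≢u → indicator-no ((w ≟ u) ×-dec (w ∈? rows)) (w≢u ∘ proj₁)
      }
    columns-independent = record
      { byCol = true ; unknowns = rows ; equations = map (false ,_) rows ; unknowns⊆ = rows⊆Vs
      ; witness = identity ; supported = identity-supported
      ; holds = diagonal-nonsingular (ByCol identity) Vs! rows⊆Vs λ {u} u∈ → false , u , ∈-map⁺ (false ,_) u∈ ,
          indicator-yes ((u ≟ u) ×-dec (u ∈? rows)) (refl , u∈) ,
          λ {w} _ w≢u → indicator-no ((u ≟ w) ×-dec (u ∈? rows)) (λ eq → w≢u (sym (proj₁ eq)))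
      }

    module _ {c} (O : Obstruction R c) where

      others : FinSet
      others = rows ∖ J O

      μ ν : Element → Element
      μ = proj₁ (left O)
      ν = proj₁ (right O)

      right-cols : FinSet
      right-cols = v₀ O ∷ map ν others

      ν-col : ∀ {i} → i ∈ others → ν i ∈ cols ∖ (W O ++ X O) × ν i ≢ v₀ O
      ν-col i∈ = case ∈-∖⁻ (cols ∖ (W O ++ X O)) (v₀ O ∷ []) (inside (proj₂ (right O)) i∈) of
        λ (v∈ , v∉) → v∈ , v∉ ∘ here

      right-cols⊆ : right-cols ⊆ cols ∖ (W O ++ X O)
      right-cols⊆ = ∷-⊆ (v₀∈ O) λ v∈ → case ∈-map⁻ ν v∈ of λ { (i , i∈ , refl) → proj₁ (ν-col i∈) }

      W⊆cols : W O ⊆ cols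
      W⊆cols v∈ = ∖⊆ cols (X O) (proj₁ (∈-nbr⁻ Adj? (J O) (cols ∖ X O) v∈))

      -- The original entries carry the matching of the obstruction, the copied ones its additional
      -- arc, `j₀` to the copy of `c` or the copy of `c` to `v₀`.
      left-weight right-weight : Weight
      left-weight (false , j , v) = indicator ((v ≟ μ j) ×-dec (j ∈? J O ∖ (j₀ O ∷ [])))
      left-weight (true  , j , v) = indicator ((j ≟ j₀ O) ×-dec (v ≟ c))
      right-weight (false , i , v) = indicator ((v ≟ ν i) ×-dec (i ∈? others))
      right-weight (true  , i , v) = indicator ((i ≟ c) ×-dec (v ≟ v₀ O))

      left-equations right-equations : List (Bool × Element)
      left-equations  = map (false ,_) (W O) ++ (true , c) ∷ []
      right-equations = map (false ,_) others ++ (true , c) ∷ []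

      -- Its purpose: a non-zero vector on `J` annihilated by the columns `W` cannot be annihilated
      -- by the copy of the column `c` as well.
      left-condition : c ∈ cols → Condition
      left-condition c∈cols = record
        { byCol = false ; unknowns = J O ; equations = left-equations ; unknowns⊆ = λ j∈ → rows⊆Vs (J⊆rows O j∈)
        ; witness = left-weight ; supported = supported′
        ; holds = diagonal-nonsingular (ByRow left-weight) Vs! (λ j∈ → rows⊆Vs (J⊆rows O j∈)) pivot
        }
        where
        supported′ : Supported left-weight
        supported′ false {j} {v} ¬arc = indicator-no ((v ≟ μ j) ×-dec (j ∈? J O ∖ (j₀ O ∷ [])))
          λ { (refl , j∈) → ¬arc (J⊆rows O (∖⊆ (J O) (j₀ O ∷ []) j∈) ,
                W⊆cols (inside (proj₂ (left O)) j∈) , along (proj₂ (left O)) j∈) }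
        supported′ true {j} {v} ¬arc = indicator-no ((j ≟ j₀ O) ×-dec (v ≟ c))
          λ { (refl , refl) → ¬arc (J⊆rows O (j₀∈J O) , c∈cols , j₀→c O) }
        pivot : ∀ {u} → u ∈ J O → ∃[ b ] ∃[ q ] ((b , q) ∈ left-equations ×
          ByRow left-weight b u q ≡ 1ℤ × (∀ {w} → w ∈ J O → w ≢ u → ByRow left-weight b w q ≡ 0ℤ))
        pivot {u} u∈ with u ≟ j₀ O
        ... | yes refl = true , c , ∈-++⁺ʳ (map (false ,_) (W O)) (here refl) ,
          indicator-yes ((u ≟ j₀ O) ×-dec (c ≟ c)) (refl , refl) ,
          λ {w} _ w≢u → indicator-no ((w ≟ j₀ O) ×-dec (c ≟ c)) (w≢u ∘ proj₁)
        ... | no u≢j₀ = false , μ u , ∈-++⁺ˡ (∈-map⁺ (false ,_) (inside (proj₂ (left O)) u∈′)) ,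
          indicator-yes ((μ u ≟ μ u) ×-dec (u ∈? J O ∖ (j₀ O ∷ []))) (refl , u∈′) ,
          λ {w} _ w≢u → indicator-no ((μ u ≟ μ w) ×-dec (w ∈? J O ∖ (j₀ O ∷ [])))
            λ (eq , w∈′) → w≢u (sym (injective (proj₂ (left O)) u∈′ w∈′ eq))
          where
          u∈′ : u ∈ J O ∖ (j₀ O ∷ [])
          u∈′ = ∈-∖⁺ u∈ λ { (here u≡j₀) → u≢j₀ u≡j₀ }

      -- The mirror image: a non-zero vector on `right-cols` annihilated by the rows outside `J` is
      -- not annihilated by the copy of the row `c`.
      right-condition : c ∈ rows → Condition
      right-condition c∈rows = record
        { byCol = true ; unknowns = right-cols ; equations = right-equations ; unknowns⊆ = ⊆Vs
        ; witness = right-weight ; supported = supported′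
        ; holds = diagonal-nonsingular (ByCol right-weight) Vs! ⊆Vs pivot
        }
        where
        ⊆Vs : right-cols ⊆ Vs
        ⊆Vs v∈ = ∈-dedup⁺ (∖⊆ cols (W O ++ X O) (right-cols⊆ v∈))
        supported′ : Supported right-weight
        supported′ false {i} {v} ¬arc = indicator-no ((v ≟ ν i) ×-dec (i ∈? others))
          λ { (refl , i∈) → ¬arc (∖⊆ rows (J O) i∈ ,
                ∖⊆ cols (W O ++ X O) (proj₁ (ν-col i∈)) , along (proj₂ (right O)) i∈) }
        supported′ true {i} {v} ¬arc = indicator-no ((i ≟ c) ×-dec (v ≟ v₀ O))
          λ { (refl , refl) → ¬arc (c∈rows , ∖⊆ cols (W O ++ X O) (v₀∈ O) , c→v₀ O) }
        pivot : ∀ {u} → u ∈ right-cols → ∃[ b ] ∃[ q ] ((b , q) ∈ right-equations ×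
          ByCol right-weight b u q ≡ 1ℤ × (∀ {w} → w ∈ right-cols → w ≢ u → ByCol right-weight b w q ≡ 0ℤ))
        pivot (here refl) = true , c , ∈-++⁺ʳ (map (false ,_) others) (here refl) ,
          indicator-yes ((c ≟ c) ×-dec (v₀ O ≟ v₀ O)) (refl , refl) ,
          λ {w} _ w≢u → indicator-no ((c ≟ c) ×-dec (w ≟ v₀ O)) (w≢u ∘ proj₂)
        pivot (there u∈) with ∈-map⁻ ν u∈
        ... | i , i∈ , refl = false , i , ∈-++⁺ˡ (∈-map⁺ (false ,_) i∈) ,
          indicator-yes ((ν i ≟ ν i) ×-dec (i ∈? others)) (refl , i∈) ,
          λ {w} _ w≢u → indicator-no ((w ≟ ν i) ×-dec (i ∈? others)) (w≢u ∘ proj₁)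

    module _ (Wt : Weight) where

      L L′ : (Element → ℤ) → Element → ℤ
      L  x v = ∑ Vs (λ i → x i ℤ.* Wt (false , i , v))
      L′ x v = ∑ Vs (λ i → x i ℤ.* Wt (true , i , v))

      Lᵀ L′ᵀ : (Element → ℤ) → Element → ℤ
      Lᵀ  y i = ∑ Vs (λ v → y v ℤ.* Wt (false , i , v))
      L′ᵀ y i = ∑ Vs (λ v → y v ℤ.* Wt (true , i , v))

      -- The product of `L′ x d` and `L′ᵀ y d` is the pairing of the tensor of `x` and `y` with `d`.
      -- It is non-zero at `c`, and for inner `d` it can be non-zero only in the small set `S`.
      record IsSeparator (r : ℕ) (c : Element) (x y : Element → ℤ) (S : FinSet) : Set where
        field
          x-support : ∀ {i} → i ∉ rows → x i ≡ 0ℤ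
          y-support : ∀ {v} → v ∉ cols → y v ≡ 0ℤ
          x-kernel  : ∀ {v} → v ∈ inner → L x v ≡ 0ℤ
          y-kernel  : ∀ {i} → i ∈ rows → Lᵀ y i ≡ 0ℤ
          x-own     : L′ x c ≢ 0ℤ
          y-own     : L′ᵀ y c ≢ 0ℤ
          others-0  : ∀ {d} → d ∈ inner → d ∉ S → L′ x d ≡ 0ℤ ⊎ L′ᵀ y d ≡ 0ℤ
          small     : ∣ S ∣ ≤ r

      module _ (supp : Supported Wt) {r : ℕ} (rank : ∀ {Z} → Indep M Z → ∣ Z ∣ ≤ r)
               {c} (c∈ : c ∈ inner) (O : Obstruction R c)
               (leftH : Holds (left-condition O (∖⊆ cols (E M) c∈)) Wt)
               (rightH : Holds (right-condition O (inner⊆rows R c∈)) Wt) where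

        private
          Js : FinSet
          Js = dedup (J O)

          x-sol : Solution (map (λ v i → Wt (false , i , v)) (dedup (W O))) Js
          x-sol = underdetermined _ _ (dedup-! (J O)) (subst (_< ∣ J O ∣)
            (sym (length-map (λ v i → Wt (false , i , v)) (dedup (W O)))) (deficient O))

          module X = Solution x-sol

          x-supp : ∀ {i} → i ∉ J O → X.value i ≡ 0ℤ
          x-supp i∉ = X.support (i∉ ∘ ∈-dedup⁻ (J O))

          J⊆Vs : Js ⊆ Vs
          J⊆Vs j∈ = rows⊆Vs (J⊆rows O (∈-dedup⁻ (J O) j∈))

          -- Rows of `J` have no arcs to such columns, so no weight on arcs, original or copied,
          -- contributes.
          vanish : ∀ b {v} → v ∉ W O → v ∉ X O → ∑ Vs (λ i → X.value i ℤ.* Wt (b , i , v)) ≡ 0ℤ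
          vanish b {v} v∉W v∉X = ∑-zero Vs λ {i} _ → term i
            where
            term : ∀ i → X.value i ℤ.* Wt (b , i , v) ≡ 0ℤ
            term i with i ∈? J O
            ... | no  i∉ = cong (ℤ._* Wt (b , i , v)) (x-supp i∉)
            ... | yes i∈ = trans (cong (ℤ._*_ (X.value i)) (supp b λ (_ , v∈ , a) →
                             v∉W (∈-nbr⁺ Adj? i∈ (∈-∖⁺ v∈ v∉X) a))) (ℤₚ.*-zeroʳ (X.value i))

          x-W : ∀ {v} → v ∈ W O → L X.value v ≡ 0ℤ
          x-W {v} v∈ = begin
            ∑ Vs (λ i → X.value i ℤ.* Wt (false , i , v))
              ≡⟨ ∑-support (λ i → X.value i ℤ.* Wt (false , i , v)) (dedup-! (J O)) Vs! J⊆Vs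
                   (λ {i} i∉ → cong (ℤ._* Wt (false , i , v)) (X.support i∉)) ⟩
            ∑ Js (λ i → X.value i ℤ.* Wt (false , i , v))
              ≡⟨ ∑-cong Js (λ {i} _ → ℤₚ.*-comm (X.value i) (Wt (false , i , v))) ⟩
            ∑ Js (λ i → Wt (false , i , v) ℤ.* X.value i)
              ≡⟨ X.solves (∈-map⁺ (λ v i → Wt (false , i , v)) (∈-dedup⁺ v∈)) ⟩
            0ℤ ∎
            where open ≡-Reasoning

          X∩inner=∅ : ∀ {v} → v ∈ inner → v ∉ X O
          X∩inner=∅ v∈ v∈X = proj₂ (∈-∖⁻ cols (E M) v∈) (X⊆E O v∈X)

          x-ker : ∀ {v} → v ∈ inner → L X.value v ≡ 0ℤ
          x-ker {v} v∈ with v ∈? W O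
          ... | yes v∈W = x-W v∈W
          ... | no  v∉W = vanish false v∉W (X∩inner=∅ v∈)

          x-own′ : L′ X.value c ≢ 0ℤ
          x-own′ L′≡0 = X.nonzero (leftH X.value x-supp equations X.support∋)
            where
            equations : ∀ {b q} → (b , q) ∈ left-equations O → ∑ Vs (λ i → X.value i ℤ.* Wt (b , i , q)) ≡ 0ℤ
            equations q∈ with ∈-++⁻ (map (false ,_) (W O)) q∈
            ... | inj₂ (here refl) = L′≡0
            ... | inj₁ q∈W with ∈-map⁻ (false ,_) q∈W
            ...   | v , v∈ , refl = x-W v∈

          Ys : FinSet
          Ys = dedup (right-cols O)

          y-lt : length (map (λ i v → Wt (false , i , v)) (dedup (others O))) < length Ys
          y-lt = begin-strict
            length (map (λ i v → Wt (false , i , v)) (dedup (others O)))  ≡⟨ length-map _ (dedup (others O)) ⟩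
            ∣ others O ∣                      ≡⟨ card-map (ν O) (others O) (injective (proj₂ (right O))) ⟨
            ∣ map (ν O) (others O) ∣          <⟨ ℕₚ.n<1+n _ ⟩
            suc (∣ map (ν O) (others O) ∣)    ≡⟨ card-∷ v₀∉ ⟨
            ∣ right-cols O ∣                  ∎
            where
            open ℕₚ.≤-Reasoning
            v₀∉ : v₀ O ∉ map (ν O) (others O)
            v₀∉ v∈ = case ∈-map⁻ (ν O) v∈ of λ (i , i∈ , eq) → proj₂ (ν-col O i∈) (sym eq)

          y-sol : Solution (map (λ i v → Wt (false , i , v)) (dedup (others O))) Ys
          y-sol = underdetermined _ _ (dedup-! (right-cols O)) y-lt

          module Y = Solution y-sol

          y-supp : ∀ {v} → v ∉ right-cols O → Y.value v ≡ 0ℤ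
          y-supp v∉ = Y.support (v∉ ∘ ∈-dedup⁻ (right-cols O))

          Y⊆Vs : Ys ⊆ Vs
          Y⊆Vs v∈ = ∈-dedup⁺ (∖⊆ cols (W O ++ X O) (right-cols⊆ O (∈-dedup⁻ (right-cols O) v∈)))

          -- The support of `Y.value` avoids `W` and `X`, where all arcs from `J` end.
          vanishᵀ : ∀ b {i} → i ∈ J O → ∑ Vs (λ v → Y.value v ℤ.* Wt (b , i , v)) ≡ 0ℤ
          vanishᵀ b {i} i∈ = ∑-zero Vs λ {v} _ → term v
            where
            term : ∀ v → Y.value v ℤ.* Wt (b , i , v) ≡ 0ℤ
            term v with v ∈? right-cols O
            ... | no  v∉ = cong (ℤ._* Wt (b , i , v)) (y-supp v∉)
            ... | yes v∈ = trans (cong (ℤ._*_ (Y.value v)) (supp b λ (_ , v∈cols , a) →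
                case ∈-∖⁻ cols (W O ++ X O) (right-cols⊆ O v∈) of λ (_ , v∉) →
                v∉ (∈-++⁺ˡ (∈-nbr⁺ Adj? i∈ (∈-∖⁺ v∈cols (v∉ ∘ ∈-++⁺ʳ (W O))) a)))) (ℤₚ.*-zeroʳ (Y.value v))

          y-others : ∀ {i} → i ∈ others O → Lᵀ Y.value i ≡ 0ℤ
          y-others {i} i∈ = begin
            ∑ Vs (λ v → Y.value v ℤ.* Wt (false , i , v))
              ≡⟨ ∑-support (λ v → Y.value v ℤ.* Wt (false , i , v)) (dedup-! (right-cols O)) Vs! Y⊆Vs
                   (λ {v} v∉ → cong (ℤ._* Wt (false , i , v)) (Y.support v∉)) ⟩
            ∑ Ys (λ v → Y.value v ℤ.* Wt (false , i , v))
              ≡⟨ ∑-cong Ys (λ {v} _ → ℤₚ.*-comm (Y.value v) (Wt (false , i , v))) ⟩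
            ∑ Ys (λ v → Wt (false , i , v) ℤ.* Y.value v)
              ≡⟨ Y.solves (∈-map⁺ (λ i v → Wt (false , i , v)) (∈-dedup⁺ i∈)) ⟩
            0ℤ ∎
            where open ≡-Reasoning

          y-ker : ∀ {i} → i ∈ rows → Lᵀ Y.value i ≡ 0ℤ
          y-ker {i} i∈ with i ∈? J O
          ... | yes i∈J = vanishᵀ false i∈J
          ... | no  i∉J = y-others (∈-∖⁺ i∈ i∉J)

          y-own′ : L′ᵀ Y.value c ≢ 0ℤ
          y-own′ L′≡0 = Y.nonzero (rightH Y.value y-supp equations Y.support∋)
            where
            equations : ∀ {b q} → (b , q) ∈ right-equations O → ∑ Vs (λ v → Y.value v ℤ.* Wt (b , q , v)) ≡ 0ℤ
            equations q∈ with ∈-++⁻ (map (false ,_) (others O)) q∈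
            ... | inj₂ (here refl) = L′≡0
            ... | inj₁ q∈others with ∈-map⁻ (false ,_) q∈others
            ...   | i , i∈ , refl = y-others i∈

          -- By the diagonal, `J` lies in the union of `W` and `X`. As `J` is larger than `W`, fewer
          -- elements than `X` has remain for `W` off `J`, and the circuit `X` has at most `r + 1`.
          small′ : ∣ W O ∖ J O ∣ ≤ r
          small′ = case almost O of λ (Z , iZ , ∣X∣≤) → ℕₚ.≤-trans (ℕₚ.≤-pred (ℕₚ.≤-trans bound ∣X∣≤)) (rank iZ)
            where
            open ℕₚ.≤-Reasoning
            cover : (W O ∖ J O) ++ J O ⊆ W O ++ X O
            cover = ⊆-++⁻ (λ v∈ → ∈-++⁺ˡ (∖⊆ (W O) (J O) v∈)) J⊆
              where
              J⊆ : J O ⊆ W O ++ X O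
              J⊆ {j} j∈ with j ∈? X O
              ... | yes j∈X = ∈-++⁺ʳ (W O) j∈X
              ... | no  j∉X = ∈-++⁺ˡ (∈-nbr⁺ Adj? j∈ (∈-∖⁺ (rows⊆cols (J⊆rows O j∈)) j∉X) (diagonal (J⊆rows O j∈)))
            bound : suc (∣ W O ∖ J O ∣) ≤ ∣ X O ∣
            bound = ℕₚ.+-cancelˡ-≤ (∣ W O ∣) _ _ (begin
              ∣ W O ∣ + suc (∣ W O ∖ J O ∣)   ≡⟨ ℕₚ.+-suc (∣ W O ∣) _ ⟩
              suc (∣ W O ∣) + ∣ W O ∖ J O ∣   ≤⟨ ℕₚ.+-monoˡ-≤ _ (deficient O) ⟩
              ∣ J O ∣ + ∣ W O ∖ J O ∣         ≡⟨ ℕₚ.+-comm (∣ J O ∣) _ ⟩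
              ∣ W O ∖ J O ∣ + ∣ J O ∣         ≡⟨ card-++ (λ v∈ → proj₂ (∈-∖⁻ (W O) (J O) v∈)) ⟨
              ∣ (W O ∖ J O) ++ J O ∣          ≤⟨ card-mono cover ⟩
              ∣ W O ++ X O ∣                  ≤⟨ card-++-≤ (W O) (X O) ⟩
              ∣ W O ∣ + ∣ X O ∣               ∎)

          -- Off `W` the left factor vanishes, on `J` the right one.
          others-0′ : ∀ {d} → d ∈ inner → d ∉ W O ∖ J O → L′ X.value d ≡ 0ℤ ⊎ L′ᵀ Y.value d ≡ 0ℤ
          others-0′ {d} d∈ d∉ with d ∈? W O | d ∈? J O
          ... | no d∉W | _       = inj₁ (vanish true d∉W (X∩inner=∅ d∈))
          ... | yes _  | yes d∈J = inj₂ (vanishᵀ true d∈J)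
          ... | yes d∈W | no d∉J = ⊥-elim (d∉ (∈-∖⁺ d∈W d∉J))

        separator : ∃[ x ] ∃[ y ] ∃[ S ] IsSeparator r c x y S
        separator = X.value , Y.value , W O ∖ J O , record
          { x-support = λ i∉ → x-supp (i∉ ∘ J⊆rows O)
          ; y-support = λ v∉ → y-supp λ v∈ → v∉ (∖⊆ cols (W O ++ X O) (right-cols⊆ O v∈))
          ; x-kernel = x-ker ; y-kernel = y-ker ; x-own = x-own′ ; y-own = y-own′
          ; others-0 = others-0′ ; small = small′
          }

  -- The dimension bound

  length-cartesianProduct : ∀ (xs ys : FinSet) → length (cartesianProduct xs ys) ≡ length xs * length ys
  length-cartesianProduct []       ys = refl
  length-cartesianProduct (x ∷ xs) ys = trans (length-++ (map (x ,_) ys))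
    (cong₂ _+_ (length-map (x ,_) ys) (length-cartesianProduct xs ys))

  ¬¬-all : ∀ {P : Element → Set} Z → (∀ {z} → z ∈ Z → ¬ ¬ P z) → ¬ ¬ All P Z
  ¬¬-all []      _   = return []
  ¬¬-all (z ∷ Z) ¬¬P = ¬¬P (here refl) >>= λ Pz → ¬¬-all Z (¬¬P ∘ there) >>= λ PZ → return (Pz ∷ PZ)

  module _ {M : Matroid} (R : NormalRep M) where

    open NormalRep R

    targetSet : FinSet
    targetSet = cols ∖ rows

    module _ (Wt : Weight) {r : ℕ}
             (rowsH : Condition.Holds (rows-independent R) Wt) (colsH : Condition.Holds (columns-independent R) Wt)
             (x y : Element → Element → ℤ) (S : Element → FinSet)
             (sep : ∀ {c} → c ∈ inner → IsSeparator R Wt r c (x c) (y c) (S c)) where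

      private
        module Sep {c} (c∈ : c ∈ inner) = IsSeparator (sep c∈)
        open Sep

        Columns : FinSet
        Columns = Vs R

        -- The newest column stands in front and avoids the sets `S q` of the older ones, so the
        -- older tensors pair to zero with it.
        data Triangular : FinSet → Set where
          []  : Triangular []
          _∷_ : ∀ {p ps} → p ∈ inner × (∀ {q} → q ∈ ps → p ∉ S q) → Triangular ps → Triangular (p ∷ ps)

        triangular-∈ : ∀ {ps p} → Triangular ps → p ∈ ps → p ∈ inner
        triangular-∈ ((p∈ , _) ∷ _) (here refl) = p∈
        triangular-∈ (_ ∷ tri)      (there p∈)  = triangular-∈ tri p∈

        own∈S : ∀ {c} → c ∈ inner → c ∈ S c
        own∈S {c} c∈ with c ∈? S c
        ... | yes c∈S = c∈S
        ... | no  c∉S = ⊥-elim ([ x-own c∈ , y-own c∈ ]′ (others-0 c∈ c∈ c∉S))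

        triangular-! : ∀ {ps} → Triangular ps → Unique ps
        triangular-! [] = []
        triangular-! {p ∷ ps} ((p∈ , new) ∷ tri) =
          All.tabulate (λ {q} q∈ p≡q → new (subst (_∈ ps) (sym p≡q) q∈) (own∈S p∈)) ∷ triangular-! tri

        pairing : Element → Element → ℤ
        pairing c d = L′ R Wt (x c) d ℤ.* L′ᵀ R Wt (y c) d

        pairing-own : ∀ {c} → c ∈ inner → pairing c c ≢ 0ℤ
        pairing-own c∈ = *-≢0 (x-own c∈) (y-own c∈)

        pairing-other : ∀ {c d} → c ∈ inner → d ∈ inner → d ∉ S c → pairing c d ≡ 0ℤ
        pairing-other {c} {d} c∈ d∈ d∉ with others-0 c∈ d∈ d∉
        ... | inj₁ eq = cong (ℤ._* L′ᵀ R Wt (y c) d) eq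
        ... | inj₂ eq = trans (cong (ℤ._*_ (L′ R Wt (x c) d)) eq) (ℤₚ.*-zeroʳ (L′ R Wt (x c) d))

        -- Pairing the relation with the first column `p` leaves only the term of `p`, whose pairing
        -- with itself is non-zero.
        triangular-independent : ∀ {ps} → Triangular ps → (γ : Element → ℤ) →
          (∀ {d} → d ∈ inner → ∑ ps (λ c → γ c ℤ.* pairing c d) ≡ 0ℤ) → ∀ {c} → c ∈ ps → γ c ≡ 0ℤ
        triangular-independent {p ∷ ps} ((p∈ , new) ∷ tri) γ relation = λ where
            (here refl) → γp≡0
            (there c∈)  → triangular-independent tri γ relation′ c∈
          where
          later-0 : ∑ ps (λ c → γ c ℤ.* pairing c p) ≡ 0ℤ
          later-0 = ∑-zero ps λ {c} c∈ → trans (cong (ℤ._*_ (γ c))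
            (pairing-other (triangular-∈ tri c∈) p∈ (new c∈))) (ℤₚ.*-zeroʳ (γ c))
          γp≡0 : γ p ≡ 0ℤ
          γp≡0 with ℤₚ.i*j≡0⇒i≡0∨j≡0 (γ p) (trans (sym (ℤₚ.+-identityʳ (γ p ℤ.* pairing p p)))
            (trans (cong (ℤ._+_ (γ p ℤ.* pairing p p)) (sym later-0)) (relation p∈)))
          ... | inj₁ γp≡0 = γp≡0
          ... | inj₂ pp≡0 = ⊥-elim (pairing-own p∈ pp≡0)
          relation′ : ∀ {d} → d ∈ inner → ∑ ps (λ c → γ c ℤ.* pairing c d) ≡ 0ℤ
          relation′ {d} d∈ = trans (sym (ℤₚ.+-identityˡ (∑ ps (λ c → γ c ℤ.* pairing c d))))
            (trans (cong (λ g → g ℤ.* pairing p d ℤ.+ ∑ ps (λ c → γ c ℤ.* pairing c d)) (sym γp≡0)) (relation d∈))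

        union : FinSet → FinSet
        union []       = []
        union (p ∷ ps) = S p ++ union ps

        ∈-union : ∀ {ps q} → q ∈ ps → S q ⊆ union ps
        ∈-union (here refl) v∈ = ∈-++⁺ˡ v∈
        ∈-union {p ∷ ps} (there q∈) v∈ = ∈-++⁺ʳ (S p) (∈-union q∈ v∈)

        card-union : ∀ {ps} → Triangular ps → ∣ union ps ∣ ≤ length ps * r
        card-union [] = z≤n
        card-union {p ∷ ps} ((p∈ , _) ∷ tri) = ℕₚ.≤-trans (card-++-≤ (S p) (union ps))
          (ℕₚ.+-mono-≤ (small p∈) (card-union tri))

        -- `k` chosen columns block at most `k * r` others. The set `S` of the last choice blocks
        -- nothing further, whence `suc k` columns in all.
        greedy : ∀ k → k * r < ∣ inner ∣ → ∃[ ps ] (Triangular ps × length ps ≡ suc k)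
        greedy k lt = append k lt (initial k lt)
          where
          append : ∀ k → k * r < ∣ inner ∣ → ∃[ ps ] (Triangular ps × length ps ≡ k) →
                   ∃[ ps ] (Triangular ps × length ps ≡ suc k)
          append k lt (ps , tri , refl) =
            case card-<-∃ (union ps) inner (ℕₚ.≤-<-trans (card-union tri) lt) of λ (p , p∈ , p∉) →
            p ∷ ps , (p∈ , λ q∈ p∈S → p∉ (∈-union q∈ p∈S)) ∷ tri , refl
          initial : ∀ k → k * r < ∣ inner ∣ → ∃[ ps ] (Triangular ps × length ps ≡ k)
          initial zero    _  = [] , [] , refl
          initial (suc k) lt = append k (ℕₚ.≤-<-trans (ℕₚ.m≤n+m (k * r) r) lt)
                                 (initial k (ℕₚ.≤-<-trans (ℕₚ.m≤n+m (k * r) r) lt))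

        tensor : Element × Element → Element → ℤ
        tensor (e , t) c = L R Wt (x c) e ℤ.* y c t

        indices : List (Element × Element)
        indices = cartesianProduct (dedup (E M)) (dedup targetSet)

        -- The tensors x c ⊗ y c are determined by their coordinates at E × targetSet, and
        -- the pairing with d is a linear function of the tensor.
        relation⇒pairing : ∀ {ps} → Triangular ps → (γ : Element → ℤ) →
          (∀ {i} → i ∈ indices → ∑ ps (λ c → tensor i c ℤ.* γ c) ≡ 0ℤ) →
          ∀ d → ∑ ps (λ c → γ c ℤ.* pairing c d) ≡ 0ℤ
        relation⇒pairing {ps} tri γ relation d = begin
          ∑ ps (λ c → γ c ℤ.* (lx c ℤ.* L′ᵀ R Wt (y c) d))
            ≡⟨ ∑-cong ps (λ {c} _ → ℤₚ.*-assoc (γ c) (lx c) (L′ᵀ R Wt (y c) d)) ⟨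
          ∑ ps (λ c → γ c ℤ.* lx c ℤ.* L′ᵀ R Wt (y c) d)
            ≡⟨ ∑-combination ps Columns (λ c → γ c ℤ.* lx c) y (λ v → Wt (true , d , v)) ⟨
          L′ᵀ R Wt w d
            ≡⟨ ∑-zero Columns (λ {v} _ → cong (ℤ._* Wt (true , d , v)) (w≡0 v)) ⟩
          0ℤ ∎
          where
          open ≡-Reasoning
          inn : ∀ {c} → c ∈ ps → c ∈ inner
          inn = triangular-∈ tri
          lx : Element → ℤ
          lx c = L′ R Wt (x c) d
          -- `z t` contracts the combination of the tensors with the coordinate `t` on the right;
          -- `w` contracts it with the copy of the column `d` on the left.
          z : Element → Element → ℤ
          z t i = ∑ ps (λ c → γ c ℤ.* y c t ℤ.* x c i)
          w : Element → ℤ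
          w v = ∑ ps (λ c → γ c ℤ.* lx c ℤ.* y c v)
          a*0 : ∀ {a b} → b ≡ 0ℤ → a ℤ.* b ≡ 0ℤ
          a*0 {a} refl = ℤₚ.*-zeroʳ a
          -- Its product with a column vanishes by the relation if the column is in `E M`, and by
          -- `x-kernel` otherwise, so `rowsH` applies.
          z≡0 : ∀ {t} → t ∈ targetSet → ∀ i → z t i ≡ 0ℤ
          z≡0 {t} t∈ = rowsH (z t) (λ i∉ → ∑-zero ps λ {c} c∈ → a*0 {γ c ℤ.* y c t} (x-support (inn c∈) i∉)) equations
            where
            lemma : ∀ g y l → g ℤ.* y ℤ.* l ≡ l ℤ.* y ℤ.* g
            lemma = solve-∀
            at : ∀ v → v ∈ rows → ∑ ps (λ c → γ c ℤ.* y c t ℤ.* L R Wt (x c) v) ≡ 0ℤ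
            at v v∈ with v ∈? E M
            ... | yes v∈E = trans (∑-cong ps λ {c} _ → lemma (γ c) (y c t) (L R Wt (x c) v))
                    (relation (∈-cartesianProduct⁺ (∈-dedup⁺ v∈E) (∈-dedup⁺ t∈)))
            ... | no  v∉E = ∑-zero ps λ {c} c∈ → a*0 {γ c ℤ.* y c t} (x-kernel (inn c∈) (∈-∖⁺ (rows⊆cols v∈) v∉E))
            equations : ∀ {b q} → (b , q) ∈ map (false ,_) rows → ∑ Columns (λ i → z t i ℤ.* Wt (b , i , q)) ≡ 0ℤ
            equations q∈ with ∈-map⁻ (false ,_) q∈
            ... | v , v∈ , refl = trans (∑-combination ps Columns (λ c → γ c ℤ.* y c t) x (λ i → Wt (false , i , v))) (at v v∈)
          -- `w` vanishes at the targets because `z` does, and all rows annihilate it by `y-kernel`,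
          -- so `colsH` applies.
          w≡0 : ∀ v → w v ≡ 0ℤ
          w≡0 = colsH w off equations
            where
            lemma : ∀ g l y → g ℤ.* l ℤ.* y ≡ g ℤ.* y ℤ.* l
            lemma = solve-∀
            off : ∀ {v} → v ∉ rows → w v ≡ 0ℤ
            off {v} v∉ with v ∈? cols
            ... | no  v∉cols = ∑-zero ps λ {c} c∈ → a*0 {γ c ℤ.* lx c} (y-support (inn c∈) v∉cols)
            ... | yes v∈cols = begin
              ∑ ps (λ c → γ c ℤ.* lx c ℤ.* y c v)
                ≡⟨ ∑-cong ps (λ {c} _ → lemma (γ c) (lx c) (y c v)) ⟩
              ∑ ps (λ c → γ c ℤ.* y c v ℤ.* lx c)
                ≡⟨ ∑-combination ps Columns (λ c → γ c ℤ.* y c v) x (λ i → Wt (true , i , d)) ⟨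
              L′ R Wt (z v) d
                ≡⟨ ∑-zero Columns (λ {i} _ → cong (ℤ._* Wt (true , i , d)) (z≡0 (∈-∖⁺ v∈cols v∉) i)) ⟩
              0ℤ ∎
            equations : ∀ {b q} → (b , q) ∈ map (false ,_) rows → ∑ Columns (λ v → w v ℤ.* Wt (b , q , v)) ≡ 0ℤ
            equations q∈ with ∈-map⁻ (false ,_) q∈
            ... | i , i∈ , refl = trans (∑-combination ps Columns (λ c → γ c ℤ.* lx c) y (λ v → Wt (false , i , v)))
                  (∑-zero ps λ {c} c∈ → a*0 {γ c ℤ.* lx c} (y-kernel (inn c∈) i∈))

      separated-bound : ∣ inner ∣ ≤ ∣ E M ∣ * ∣ targetSet ∣ * r
      separated-bound = ℕₚ.≮⇒≥ λ lt → case greedy _ lt of λ (ps , tri , len) → contradict tri len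
        where
        contradict : ∀ {ps} → Triangular ps → length ps ≡ suc (∣ E M ∣ * ∣ targetSet ∣) → ⊥
        contradict {ps} tri len = nonzero (triangular-independent tri value
            (λ {d} _ → relation⇒pairing tri value (λ i∈ → solves (∈-map⁺ tensor i∈)) d) support∋∈)
          where
          lt : length (map tensor indices) < length ps
          lt = subst₂ _<_ (sym (trans (length-map tensor indices) (length-cartesianProduct (dedup (E M)) (dedup targetSet))))
                 (sym len) (ℕₚ.n<1+n _)
          open Solution (underdetermined (map tensor indices) ps (triangular-! tri) lt)

    module _ {r : ℕ} (rank : ∀ {Z} → Indep M Z → ∣ Z ∣ ≤ r) where

      private
        conditions : ∀ {Z} → Z ⊆ inner → All (Obstruction R) Z → List (Condition R)
        conditions _  []       = []
        conditions Z⊆ (O ∷ Os) = left-condition R O (∖⊆ cols (E M) (Z⊆ (here refl)))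
          ∷ right-condition R O (inner⊆rows R (Z⊆ (here refl))) ∷ conditions (Z⊆ ∘ there) Os

        Separated : Weight → Element → Set
        Separated Wt c = ∃[ x ] ∃[ y ] ∃[ S ] IsSeparator R Wt r c x y S

        separators : ∀ {Wt Z} → Supported R Wt → (Z⊆ : Z ⊆ inner) (Os : All (Obstruction R) Z) →
          (∀ {k} → k ∈ conditions Z⊆ Os → Condition.Holds k Wt) → All (Separated Wt) Z
        separators _ _ [] _ = []
        separators {Wt} supp Z⊆ (O ∷ Os) holds =
          separator R Wt supp rank (Z⊆ (here refl)) O (holds (here refl)) (holds (there (here refl)))
            ∷ separators {Wt} supp (Z⊆ ∘ there) Os λ k∈ → holds (there (there k∈))

        bounded : ∀ {Wt} → Condition.Holds (rows-independent R) Wt → Condition.Holds (columns-independent R) Wt →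
          All (Separated Wt) inner → ∣ inner ∣ ≤ ∣ E M ∣ * ∣ targetSet ∣ * r
        bounded {Wt} rowsH colsH seps = separated-bound Wt rowsH colsH x y S sep
          where
          x y : Element → Element → ℤ
          x c with c ∈? inner
          ... | yes c∈ = proj₁ (All.lookup seps c∈)
          ... | no _   = λ _ → 0ℤ
          y c with c ∈? inner
          ... | yes c∈ = proj₁ (proj₂ (All.lookup seps c∈))
          ... | no _   = λ _ → 0ℤ
          S : Element → FinSet
          S c with c ∈? inner
          ... | yes c∈ = proj₁ (proj₂ (proj₂ (All.lookup seps c∈)))
          ... | no _   = []
          sep : ∀ {c} → c ∈ inner → IsSeparator R Wt r c (x c) (y c) (S c)
          sep {c} c∈ with c ∈? inner
          ... | yes c∈′ = proj₂ (proj₂ (proj₂ (All.lookup seps c∈′)))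
          ... | no  c∉  = ⊥-elim (c∉ c∈)

      obstructed-bound : All (Obstruction R) inner → ∣ inner ∣ ≤ ∣ E M ∣ * ∣ targetSet ∣ * r
      obstructed-bound Os = decidable-stable (∣ inner ∣ ℕₚ.≤? (∣ E M ∣ * ∣ targetSet ∣ * r))
        (generic (λ k → Condition.Holds k) (condition-open R) (condition-pointwise R) (entries R) all
          -- All witnesses agree with the zero weight off `entries`, and so will the generic weight:
          -- hence it is supported on arcs.
          (λ _ → 0ℤ) Condition.witness (λ {k} _ → Condition.holds k)
          (λ {k} {e} _ e∉ → Condition.supported k (proj₁ e) (∉entries R e∉)) >>= λ (Wt , off , holds) →
         return (bounded {Wt} (holds (here refl)) (holds (there (here refl)))
           (separators {Wt} (λ b ¬arc → off (¬arc ∘ entries⁻ R)) (λ c∈ → c∈) Os λ k∈ → holds (there (there k∈)))))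
        where
        all : List (Condition R)
        all = rows-independent R ∷ columns-independent R ∷ conditions (λ c∈ → c∈) Os

      essential-bound : (∀ {c} → c ∈ inner → ¬ ¬ Essential R c) → ∣ inner ∣ ≤ ∣ E M ∣ * ∣ targetSet ∣ * r
      essential-bound essential = decidable-stable (∣ inner ∣ ℕₚ.≤? (∣ E M ∣ * ∣ targetSet ∣ * r))
        (¬¬-all inner (λ c∈ → essential c∈ >>= essential⇒obstruction R c∈) >>= λ Os → return (obstructed-bound Os))

      targets-bound : ∣ targetSet ∣ ≤ r
      targets-bound = rank (indep⁺ targets (reflexive-matches reflexive))

  -- Above the bound not all inner columns can be essential, and eliminating an inessential one
  -- lowers their number. Such a column is obtained only classically, hence the double negation.
  sparsify : ∀ {M r} → (∀ {Z} → Indep M Z → ∣ Z ∣ ≤ r) → NormalRep M →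
    ¬ ¬ (Σ[ R ∈ NormalRep M ] ∣ NormalRep.inner R ∣ ≤ ∣ E M ∣ * r * r)
  sparsify {M} {r} rank R₀ = go ∣ NormalRep.inner R₀ ∣ R₀ ℕₚ.≤-refl
    where
    go : ∀ k R → ∣ NormalRep.inner R ∣ ≤ k → ¬ ¬ (Σ[ R ∈ NormalRep M ] ∣ NormalRep.inner R ∣ ≤ ∣ E M ∣ * r * r)
    go k R bound with ∣ NormalRep.inner R ∣ ℕₚ.≤? (∣ E M ∣ * r * r)
    ... | yes small = return (R , small)
    ... | no  large = λ ¬sparse → large (ℕₚ.≤-trans
            (essential-bound R rank λ {c} c∈ ¬ess → shrink k bound c∈ ¬ess ¬sparse)
            (ℕₚ.*-monoˡ-≤ r (ℕₚ.*-monoʳ-≤ (∣ E M ∣) (targets-bound R rank))))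
      where
      shrink : ∀ k → ∣ NormalRep.inner R ∣ ≤ k → ∀ {c} → c ∈ NormalRep.inner R → ¬ Essential R c →
        ¬ ¬ (Σ[ R ∈ NormalRep M ] ∣ NormalRep.inner R ∣ ≤ ∣ E M ∣ * r * r)
      shrink k bound {c} c∈ ¬ess with bypass R c c∈ ¬ess
      shrink zero    bound _ _ | R′ , lt = ⊥-elim (ℕₚ.<⇒≱ lt (ℕₚ.≤-trans bound z≤n))
      shrink (suc k) bound _ _ | R′ , lt = go k R′ (ℕₚ.≤-pred (ℕₚ.≤-trans lt bound))

  -- Matroid tableaux

  ∈-subsets : ∀ {X} C → X ⊆ C → ∃[ Y ] (Y ∈ subsets C × X ⊆ Y × Y ⊆ X)
  ∈-subsets [] X⊆[] = [] , here refl , X⊆[] , λ ()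
  ∈-subsets {X} (c ∷ C) X⊆ with ∈-subsets {X ∩ C} C (λ x∈ → proj₂ (∈-∩⁻ X C x∈)) | c ∈? X
  ... | Y , Y∈ , ⊆Y , Y⊆ | yes c∈X = c ∷ Y , ∈-++⁺ʳ (subsets C) (∈-map⁺ (c ∷_) Y∈) , X⊆cY ,
    λ {_} → ∷-⊆ c∈X λ y∈ → proj₁ (∈-∩⁻ X C (Y⊆ y∈))
    where
    X⊆cY : X ⊆ c ∷ Y
    X⊆cY x∈ with X⊆ x∈
    ... | here x≡c  = here x≡c
    ... | there x∈C = there (⊆Y (∈-∩⁺ x∈ x∈C))
  ... | Y , Y∈ , ⊆Y , Y⊆ | no c∉X = Y , ∈-++⁺ˡ Y∈ , X⊆Y , λ {_} y∈ → proj₁ (∈-∩⁻ X C (Y⊆ y∈))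
    where
    X⊆Y : X ⊆ Y
    X⊆Y x∈ with X⊆ x∈
    ... | here refl = ⊥-elim (c∉X x∈)
    ... | there x∈C = ⊆Y (∈-∩⁺ x∈ x∈C)

  indep⇒card≤rk : ∀ M {X} → Indep M X → ∣ X ∣ ≤ rk M (E M)
  indep⇒card≤rk M {X} iX with ∈-subsets (E M) (within M iX)
  ... | Y , Y∈ , X⊆Y , Y⊆X = v≤max⁺ 0 (map ∣_∣ (filter (indep? M) (subsets (E M)))) (inj₂ (lose
    (∈-map⁺ ∣_∣ (∈-filter⁺ (indep? M) Y∈ (hereditary M Y⊆X iX))) (card-mono X⊆Y)))

  -- At most `n` columns lie in the ground set and at most `n * r * r` outside it. The summand `r`
  -- of the prescribed size is slack, taken up by the padding, because no target lies outside the
  -- ground set.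
  gammoid⇒strict-extension : ∀ {G} → Gammoid G → let r = rk G (E G) ; n = ∣ E G ∣ in
    ¬ ¬ (∃[ N ] (IsExtension N G × ∣ E N ∣ ≡ r ^ 2 * n + r + n × StrictGammoid N))
  gammoid⇒strict-extension {G} (D , T , isΓ) =
    sparsify (indep⇒card≤rk G) (normalize {M = G} (step? D) (Γ⇒represents {M = G} isΓ)) >>= λ (R , bound) →
    return (strict-extension R (r ^ 2 * n + r + n) (enough R bound))
    where
    r n : ℕ
    r = rk G (E G)
    n = ∣ E G ∣
    enough : ∀ R → ∣ NormalRep.inner R ∣ ≤ n * r * r → ∣ NormalRep.cols R ∣ ≤ r ^ 2 * n + r + n
    enough R bound = begin
      ∣ cols ∣                          ≡⟨ card-split cols (E G) ⟩
      ∣ cols ∩ E G ∣ + ∣ inner ∣        ≤⟨ ℕₚ.+-mono-≤ (card-mono λ x∈ → proj₂ (∈-∩⁻ cols (E G) x∈)) bound ⟩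
      n + n * r * r                     ≡⟨ lemma n r ⟩
      r ^ 2 * n + n                     ≤⟨ ℕₚ.+-monoˡ-≤ n (ℕₚ.m≤m+n (r ^ 2 * n) r) ⟩
      r ^ 2 * n + r + n                 ∎
      where
      open ℕₚ.≤-Reasoning
      open NormalRep R using (cols; inner)
      lemma : ∀ n r → n + n * r * r ≡ r * (r * 1) * n + n
      lemma = solve-∀-ℕ

  ≈-sym : ∀ {M N} → M ≈ N → N ≈ M
  ≈-sym (E∼ , M⊆N , N⊆M) = (λ {_} → ⇔-sym E∼) , N⊆M , M⊆N

  ≈-trans : ∀ {M N K} → M ≈ N → N ≈ K → M ≈ K
  ≈-trans (E∼ , M⊆N , N⊆M) (E∼′ , N⊆K , K⊆N) =
    (λ {_} → E∼′ ⇔-∘ E∼) , (λ i → N⊆K (M⊆N i)) , λ i → N⊆M (K⊆N i)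

  extension-≈ : ∀ {K M N} → M ≈ N → IsExtension K M → IsExtension K N
  extension-≈ (E∼ , M⊆N , N⊆M) (E⊆ , restrict) = (λ x∈ → E⊆ (from E∼ x∈)) , λ X → mk⇔
    (λ iX → case to (restrict X) (N⊆M iX) of λ iX×X⊆ → proj₁ iX×X⊆ , λ {_} x∈ → to E∼ (proj₂ iX×X⊆ x∈))
    (λ iX×X⊆ → M⊆N (from (restrict X) (proj₁ iX×X⊆ , λ {_} x∈ → from E∼ (proj₂ iX×X⊆ x∈))))

  minor-≈ : ∀ {G M N} → M ≈ N → IsMinor M G → IsMinor N G
  minor-≈ {M = M} {N} M≈N (C , K , contr , ext) = C , K , contr , extension-≈ {K} {M} {N} M≈N ext

  minor-refl : ∀ G → IsMinor G G
  minor-refl G = [] , G , ((λ ()) , (λ x → mk⇔ (λ x∈ → x∈ , λ ()) proj₁) , λ X → mk⇔ (fwd X) (bwd X)) ,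
      (λ x∈ → x∈) , λ X → mk⇔ (λ iX → iX , λ {_} → within G iX) proj₁
    where
    fwd : ∀ X → Indep G X → X ⊆ E G × ∃[ B ] (IsBase G [] B × Indep G (X ++ B))
    fwd X iX = within G iX , [] , ((λ ()) , empty G , λ ()) , hereditary G (⊆-++⁻ {X} (λ x∈ → x∈) λ ()) iX
    bwd : ∀ X → X ⊆ E G × ∃[ B ] (IsBase G [] B × Indep G (X ++ B)) → Indep G X
    bwd X (_ , B , _ , iXB) = hereditary G ∈-++⁺ˡ iXB

  gammoid-≈ : ∀ {M N} → M ≈ N → Gammoid M → Gammoid N
  gammoid-≈ {M} {N} M≈N (D , T , isΓ) =
    D , T , extension-Γ {M = N} {N = M} (extension-≈ {M} {M} {N} M≈N ((λ x∈ → x∈) , λ X → mk⇔ (λ iX → iX , λ {_} → within M iX) proj₁)) isΓ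

  -- Validity of the conclusion tableau

  module _ {T : Tuple} (isT : IsTableau T) (valid : IsValid T) where

    open Tuple T
    open IsTableau isT
    open IsValid valid

    -- The class of the goal contains the gammoid `M`, which leaves only the alternative that all
    -- its members are gammoids.
    goal-gammoid : D1 T → Gammoid G
    goal-gammoid (M , 𝒢M , G≃M) with classes G (proj₁ (≃-on G≃M))
    ... | inj₁ all  = all G (≃-trans G≃M (≃-sym G≃M))
    ... | inj₂ none = ⊥-elim (none M G≃M (gammoids M 𝒢M))

    goal-nonGammoid : D2 T ⊎ D3 T → ¬ Gammoid G
    goal-nonGammoid (inj₁ (X , 𝒳X , N , minor , X≅N)) gammoid =
      nonGams X 𝒳X (iso-gammoid X≅N (minor-gammoid {N} {G} minor gammoid))
    goal-nonGammoid (inj₂ d3) gammoid = gammoid⇒strict-extension {G} gammoid λ (N , ext , size , strict) →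
      case d3 N ext size of λ (M , ℳM , M≅N) → nonStrict M ℳM (iso-strictGammoid M≅N strict)

    -- The added matroids are minors of the goal (the goal is one of itself), so they are in the
    -- domain already. The domain and the classes stay the same, and only the new members of the
    -- families need an argument.
    conclusion-valid : ∀ {T!} → IsConclusion T T! → IsTableau T! × IsValid T!
    conclusion-valid (accept d1) = record
        { 𝒢-resp  = λ { {M} {N} M≈N (inj₁ 𝒢M) → inj₁ (𝒢-resp M≈N 𝒢M)
                      ; {M} {N} M≈N (inj₂ minor) → inj₂ (minor-≈ {G} {M} {N} M≈N minor) }
        ; ℳ-resp  = ℳ-resp
        ; 𝒳-resp  = 𝒳-resp
        ; ≃-on    = λ M≃N → extend-domain (proj₁ (≃-on M≃N)) , extend-domain (proj₂ (≃-on M≃N))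
        ; ≃-refl  = λ M∈ → ≃-refl (restrict-domain M∈)
        ; ≃-sym   = ≃-sym
        ; ≃-trans = ≃-trans
        } , record
        { gammoids  = λ { M (inj₁ 𝒢M) → gammoids M 𝒢M
                        ; M (inj₂ minor) → minor-gammoid {M} {G} minor (goal-gammoid d1) }
        ; nonStrict = nonStrict
        ; nonGams   = nonGams
        ; classes   = λ M M∈ → classes M (restrict-domain M∈)
        }
      where
      Domain! : Family
      Domain! M = IsMinor M G ⊎ (𝒢 M ⊎ IsMinor M G) ⊎ ℳ M ⊎ 𝒳 M
      extend-domain : ∀ {M} → Domain M → Domain! M
      extend-domain (inj₁ minor)     = inj₁ minor
      extend-domain (inj₂ (inj₁ 𝒢M)) = inj₂ (inj₁ (inj₁ 𝒢M))
      extend-domain (inj₂ (inj₂ M∈)) = inj₂ (inj₂ M∈)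
      restrict-domain : ∀ {M} → Domain! M → Domain M
      restrict-domain (inj₁ minor)               = inj₁ minor
      restrict-domain (inj₂ (inj₁ (inj₁ 𝒢M)))    = inj₂ (inj₁ 𝒢M)
      restrict-domain (inj₂ (inj₁ (inj₂ minor))) = inj₁ minor
      restrict-domain (inj₂ (inj₂ M∈))           = inj₂ (inj₂ M∈)
    conclusion-valid (reject d) = record
        { 𝒢-resp  = 𝒢-resp
        ; ℳ-resp  = ℳ-resp
        ; 𝒳-resp  = λ { {M} {N} M≈N (inj₁ 𝒳M) → inj₁ (𝒳-resp M≈N 𝒳M)
                      ; {M} {N} M≈N (inj₂ G≈M) → inj₂ (≈-trans {G} {M} {N} G≈M M≈N) }
        ; ≃-on    = λ M≃N → extend-domain (proj₁ (≃-on M≃N)) , extend-domain (proj₂ (≃-on M≃N))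
        ; ≃-refl  = λ M∈ → ≃-refl (restrict-domain M∈)
        ; ≃-sym   = ≃-sym
        ; ≃-trans = ≃-trans
        } , record
        { gammoids  = gammoids
        ; nonStrict = nonStrict
        ; nonGams   = λ { M (inj₁ 𝒳M) → nonGams M 𝒳M
                        ; M (inj₂ G≈M) gammoid → goal-nonGammoid d (gammoid-≈ {M} {G} (≈-sym {G} {M} G≈M) gammoid) }
        ; classes   = λ M M∈ → classes M (restrict-domain M∈)
        }
      where
      Domain! : Family
      Domain! M = IsMinor M G ⊎ 𝒢 M ⊎ ℳ M ⊎ (𝒳 M ⊎ G ≈ M)
      extend-domain : ∀ {M} → Domain M → Domain! M
      extend-domain (inj₁ minor)            = inj₁ minor
      extend-domain (inj₂ (inj₁ 𝒢M))        = inj₂ (inj₁ 𝒢M)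
      extend-domain (inj₂ (inj₂ (inj₁ ℳM))) = inj₂ (inj₂ (inj₁ ℳM))
      extend-domain (inj₂ (inj₂ (inj₂ 𝒳M))) = inj₂ (inj₂ (inj₂ (inj₁ 𝒳M)))
      restrict-domain : ∀ {M} → Domain! M → Domain M
      restrict-domain (inj₁ minor)                       = inj₁ minor
      restrict-domain (inj₂ (inj₁ 𝒢M))                   = inj₂ (inj₁ 𝒢M)
      restrict-domain (inj₂ (inj₂ (inj₁ ℳM)))            = inj₂ (inj₂ (inj₁ ℳM))
      restrict-domain (inj₂ (inj₂ (inj₂ (inj₁ 𝒳M))))     = inj₂ (inj₂ (inj₂ 𝒳M))
      restrict-domain {M} (inj₂ (inj₂ (inj₂ (inj₂ G≈M)))) = inj₁ (minor-≈ {G} {G} {M} G≈M (minor-refl G))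

corollary3p10 : (𝕌 : Universe) → let open Matroids 𝕌 in
    (T T! : Tuple) → IsTableau T → IsDecisive T → IsConclusion T T! →
    IsTableau T! × IsValid T!
corollary3p10 𝕌 T T! isT (valid , _) conclusion = conclusion-valid 𝕌 isT valid conclusion
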